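{- For every $k\ge 1$, Fair $k$-Division Under Conflicts is solvable in time $\mathcal{O}(n^{k+2}(Q+1)^k)$ for cocomparability conflict graphs $G$ with $n$ vertices, where $Q=\max_{1\le j\le k}p_j(V(G))$.
   Context: A graph is a cocomparability graph if its complement admits a transitive orientation. A partial $k$-coloring of a graph $G=(V,E)$ is a sequence $(X_1,\dots,X_k)$ of $k$ pairwise disjoint independent sets of $G$. Given profit functions $p_1,\dots,p_k:V\to\mathbb{Z}_+$, write $p_j(X)=\sum_{v\in X}p_j(v)$; the satisfaction level of $(X_1,\dots,X_k)$ is $\min_j p_j(X_j)$. Fair $k$-Division Under Conflicts: given $G$ and $p_1,\dots,p_k$, compute a partial $k$-coloring of $G$ with maximum satisfaction level. -}

module Defs where

import Algebra.Properties.CommutativeMonoid.Sum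
open import Data.Bool using (Bool; true; false; not; _∧_; if_then_else_; T)
open import Data.Bool.Properties using (∧-zeroʳ)
open import Data.Fin using (Fin; toℕ; fromℕ<; combine; remQuot)
open import Data.Fin.Subset using (Subset; _∈_; _∩_; Empty; ⊤)
import Data.Fin.Properties as Fin
open import Data.Nat using (ℕ; suc; _+_; _*_; _∸_; _⊓_; _⊔_; _≤_; NonZero; _≟_; _<?_)
open import Data.Nat.Properties using (+-0-commutativeMonoid)
open import Data.Product using (_,_; ∃; uncurry)
open import Data.Sum using (_⊎_)
open import Data.Vec using (lookup)
open import Data.Vec.Functional using (Vector; foldr; head; tail)
open import Level using (0ℓ)
open import Relation.Binary using (Rel; Transitive; Asymmetric)
open import Relation.Binary.PropositionalEquality using (_≡_; _≢_; refl; sym; cong₂)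
open import Relation.Nullary using (¬_; does; yes; no; contradiction)

open Algebra.Properties.CommutativeMonoid.Sum +-0-commutativeMonoid using (sum)

private
  variable
    k n : ℕ

record Graph (n : ℕ) : Set where
  field
    adj        : Fin n → Fin n → Bool
    adj-sym    : ∀ u v → adj u v ≡ adj v u
    adj-irrefl : ∀ v → adj v v ≡ false

  Edge : Rel (Fin n) 0ℓ
  Edge u v = T (adj u v)

open Graph public

complement : Graph n → Graph n
complement G .adj u v = not (adj G u v) ∧ not (does (u Fin.≟ v))
complement G .adj-sym u v = cong₂ (λ a b → not a ∧ not b) (adj-sym G u v) does-sym
  where
  does-sym : does (u Fin.≟ v) ≡ does (v Fin.≟ u)
  does-sym with u Fin.≟ v | v Fin.≟ u
  ... | yes _   | yes _   = refl
  ... | no _    | no _    = refl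
  ... | yes u≡v | no v≢u  = contradiction (sym u≡v) v≢u
  ... | no u≢v  | yes v≡u = contradiction (sym v≡u) u≢v
complement G .adj-irrefl v with v Fin.≟ v
... | yes _  = ∧-zeroʳ (not (adj G v v))
... | no v≢v = contradiction refl v≢v

record IsTransitiveOrientation (G : Graph n) (_⟶_ : Rel (Fin n) 0ℓ) : Set where
  field
    ⟶⇒edge     : ∀ {u v} → u ⟶ v → Edge G u v
    edge⇒⟶     : ∀ {u v} → Edge G u v → u ⟶ v ⊎ v ⟶ u
    asymmetric : Asymmetric _⟶_
    transitive : Transitive _⟶_

IsCocomparability : Graph n → Set₁
IsCocomparability G = ∃ (IsTransitiveOrientation (complement G))

Independent : Graph n → Subset n → Set
Independent G X = ∀ {u v} → u ∈ X → v ∈ X → ¬ Edge G u v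

record IsPartialColoring (G : Graph n) (X : Vector (Subset n) k) : Set where
  field
    independent : ∀ j → Independent G (X j)
    disjoint    : ∀ {i j} → i ≢ j → Empty (X i ∩ X j)

Profits : ℕ → ℕ → Set
Profits k n = Fin k → Fin n → ℕ

profit : (Fin n → ℕ) → Subset n → ℕ
profit p X = sum λ v → if lookup X v then p v else 0

minimum : .{{_ : NonZero k}} → Vector ℕ k → ℕ
minimum {suc k} f = foldr _⊓_ (head f) (tail f)

maximum : Vector ℕ k → ℕ
maximum = foldr _⊔_ 0

satisfaction : .{{_ : NonZero k}} → Profits k n → Vector (Subset n) k → ℕ
satisfaction p X = minimum λ j → profit (p j) (X j)

record IsOptimal .{{_ : NonZero k}} (G : Graph n) (p : Profits k n)
                 (X : Vector (Subset n) k) : Set where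
  field
    isPartialColoring : IsPartialColoring G X
    maximal           : ∀ Y → IsPartialColoring G Y → satisfaction p Y ≤ satisfaction p X

maxTotalProfit : Profits k n → ℕ
maxTotalProfit p = maximum λ j → profit (p j) ⊤

-- A structured-control-flow version of the unit-cost Cook–Reckhow RAM: a program
-- mentions finitely many registers and finitely many unbounded arrays, all
-- holding natural numbers.  Every expression node, every assignment and every
-- test costs one step.  There is deliberately no multiplication, since with
-- it unit cost on unbounded numbers would be an unrealistic measure.

data Expr : Set where
  lit     : ℕ → Expr
  reg     : ℕ → Expr
  _⟦_⟧    : ℕ → Expr → Expr
  _⊕_ _⊖_ : Expr → Expr → Expr

infixl 6 _⊕_ _⊖_
infix  7 _⟦_⟧
infix  4 _≔_ _⟦_⟧≔_
infixr 3 _⨾_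

data Program : Set where
  skip           : Program
  _≔_            : ℕ → Expr → Program
  _⟦_⟧≔_         : ℕ → Expr → Expr → Program
  _⨾_            : Program → Program → Program
  ifz_then_else_ : Expr → Program → Program → Program
  while_loop_    : Expr → Program → Program

record State : Set where
  constructor ⟨_,_⟩
  field
    registers : ℕ → ℕ
    arrays    : ℕ → ℕ → ℕ

open State public

_[_↦_] : {A : Set} → (ℕ → A) → ℕ → A → ℕ → A
(f [ i ↦ x ]) j = if does (j ≟ i) then x else f j

eval : State → Expr → ℕ
eval s (lit c)   = c
eval s (reg x)   = registers s x
eval s (a ⟦ e ⟧) = arrays s a (eval s e)
eval s (e ⊕ f)   = eval s e + eval s f
eval s (e ⊖ f)   = eval s e ∸ eval s f

cost : Expr → ℕ
cost (lit c)   = 1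
cost (reg x)   = 1
cost (a ⟦ e ⟧) = suc (cost e)
cost (e ⊕ f)   = suc (cost e + cost f)
cost (e ⊖ f)   = suc (cost e + cost f)

setRegister : State → ℕ → ℕ → State
setRegister s x m = ⟨ registers s [ x ↦ m ] , arrays s ⟩

setCell : State → ℕ → ℕ → ℕ → State
setCell s a i m = ⟨ registers s , arrays s [ a ↦ arrays s a [ i ↦ m ] ] ⟩

infix 4 ⟪_,_⟫⇓[_]_

-- ⟪ P , s ⟫⇓[ t ] s′ : started in s, P halts after exactly t steps in s′.
data ⟪_,_⟫⇓[_]_ : Program → State → ℕ → State → Set where
  skip    : ∀ {s} → ⟪ skip , s ⟫⇓[ 1 ] s
  assign  : ∀ {s x e} → ⟪ x ≔ e , s ⟫⇓[ suc (cost e) ] setRegister s x (eval s e)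
  store   : ∀ {s a e f} →
            ⟪ a ⟦ e ⟧≔ f , s ⟫⇓[ suc (cost e + cost f) ] setCell s a (eval s e) (eval s f)
  seq     : ∀ {P P′ s s′ s″ t t′} →
            ⟪ P , s ⟫⇓[ t ] s′ → ⟪ P′ , s′ ⟫⇓[ t′ ] s″ → ⟪ P ⨾ P′ , s ⟫⇓[ t + t′ ] s″
  if-zero : ∀ {e P P′ s s′ t} → eval s e ≡ 0 →
            ⟪ P , s ⟫⇓[ t ] s′ → ⟪ ifz e then P else P′ , s ⟫⇓[ suc (cost e + t) ] s′
  if-pos  : ∀ {e P P′ s s′ t} → eval s e ≢ 0 →
            ⟪ P′ , s ⟫⇓[ t ] s′ → ⟪ ifz e then P else P′ , s ⟫⇓[ suc (cost e + t) ] s′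
  stop    : ∀ {e P s} → eval s e ≡ 0 → ⟪ while e loop P , s ⟫⇓[ suc (cost e) ] s
  loop    : ∀ {e P s s′ s″ t t′} → eval s e ≢ 0 →
            ⟪ P , s ⟫⇓[ t ] s′ → ⟪ while e loop P , s′ ⟫⇓[ t′ ] s″ →
            ⟪ while e loop P , s ⟫⇓[ suc (cost e + (t + t′)) ] s″

-- Running time and final state are determined by the program and the
-- initial state, so exhibiting one halting run describes the behaviour fully.
⇓-deterministic : ∀ {P s t₁ t₂ s₁ s₂} →
                  ⟪ P , s ⟫⇓[ t₁ ] s₁ → ⟪ P , s ⟫⇓[ t₂ ] s₂ → (t₁ , s₁) ≡ (t₂ , s₂)
⇓-deterministic skip skip = refl
⇓-deterministic assign assign = refl
⇓-deterministic store store = refl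
⇓-deterministic (seq p q) (seq p′ q′) with ⇓-deterministic p p′
... | refl with ⇓-deterministic q q′
... | refl = refl
⇓-deterministic (if-zero _ p) (if-zero _ p′) with ⇓-deterministic p p′
... | refl = refl
⇓-deterministic (if-zero z _) (if-pos nz _) = contradiction z nz
⇓-deterministic (if-pos nz _) (if-zero z _) = contradiction z nz
⇓-deterministic (if-pos _ p) (if-pos _ p′) with ⇓-deterministic p p′
... | refl = refl
⇓-deterministic (stop _) (stop _) = refl
⇓-deterministic (stop z) (loop nz _ _) = contradiction z nz
⇓-deterministic (loop nz _ _) (stop z) = contradiction z nz
⇓-deterministic (loop _ p q) (loop _ p′ q′) with ⇓-deterministic p p′
... | refl with ⇓-deterministic q q′
... | refl = refl

bit : Bool → ℕ
bit b = if b then 1 else 0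

-- Row-major layout: entry (i , j) is in cell n * i + j, and the remaining
-- cells are 0.
matrix : ∀ m n → (Fin m → Fin n → ℕ) → ℕ → ℕ
matrix m n M c with c <? m * n
... | yes c<mn = uncurry M (remQuot n (fromℕ< c<mn))
... | no _     = 0

-- Register 0 holds n, array 0 the adjacency matrix, array 1 the profits.
input : Graph n → Profits k n → State
input {n} {k} G p = ⟨ (λ _ → 0) [ 0 ↦ n ] , inputArrays ⟩
  where
  inputArrays : ℕ → ℕ → ℕ
  inputArrays 0 = matrix n n λ u v → bit (adj G u v)
  inputArrays 1 = matrix k n p
  inputArrays _ = λ _ → 0

-- Array 2 holds the characteristic vectors of X₁ , … , Xₖ.
Outputs : State → Vector (Subset n) k → Set
Outputs s X = ∀ j v → arrays s 2 (toℕ (combine j v)) ≡ bit (lookup (X j) v)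

{-# OPTIONS --safe #-}
-- The complement of G is a comparability graph.  Orient each implication class of its
-- edges (Golumbic) so that it contains the lexicographically smallest arc of the class
-- and its reversal; the triangle lemma shows that the result is transitive, and it is
-- found by breadth-first closure in time O(n³).
--
-- Independent sets of G are then chains, and a chain can be extended by v exactly when
-- its last vertex has an arc to v.  Processing the vertices in a topological order, a
-- partial coloring matters only through the last vertex and the profit of each class,
-- so there are at most (n + 1)ᵏ (Q + 1)ᵏ states.  The reachable states are kept in a list
-- without repetitions, recognised by their key in mixed radix notation; each points to
-- the state it was extended from, and the optimal coloring is read off by following
-- these pointers from the best state.
module Submission where

open import Defs
open import Data.Bool using (Bool; true; false; not; _∧_; _∨_; if_then_else_; T)
open import Data.Bool.Properties using (T-≡; ¬-not)
open import Data.Empty using (⊥; ⊥-elim; ⊥-elim-irr)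
open import Data.Fin using (Fin; toℕ; fromℕ<; combine; remQuot) renaming (zero to fzero; suc to fsuc)
open import Data.Fin.Subset using (Subset; _∈_; ⊤)
open import Data.Fin.Subset.Properties using (x∈p∩q⁺; x∈p∩q⁻)
import Data.Fin.Properties as Fin
import Data.Bool.Properties as Bool
open import Data.Nat using (ℕ; zero; suc; _+_; _*_; _∸_; _^_; _⊓_; _≤_; _<_; z≤n; s≤s; z<s; NonZero; >-nonZero; _≟_; _≡ᵇ_; _<ᵇ_; _<?_; _≤?_)
open import Data.Nat.Properties hiding (_≟_; _<?_; _≤?_)
open import Data.Nat.Tactic.RingSolver using (solve-∀)
open import Data.Product using (_×_; _,_; proj₁; proj₂; ∃-syntax; Σ-syntax; uncurry)
open import Data.Sum using (_⊎_; inj₁; inj₂)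
open import Data.Unit using (tt)
open import Data.Vec using (lookup; tabulate)
open import Data.Vec.Functional using (Vector; foldr)
open import Data.Vec.Properties using (lookup∘tabulate; lookup-replicate; []=⇒lookup; lookup⇒[]=)
open import Function using (_∘_; id; case_of_; Equivalence)
open import Relation.Binary.PropositionalEquality using (_≡_; _≢_; refl; sym; trans; cong; cong₂; subst; subst₂; module ≡-Reasoning)
open import Relation.Binary.Definitions using (tri<; tri≈; tri>)
open import Relation.Nullary using (¬_; does; yes; no; contradiction; Dec)
import Algebra.Properties.CommutativeMonoid.Sum
open Algebra.Properties.CommutativeMonoid.Sum +-0-commutativeMonoid using (sum)

-- A Hoare logic with running times

-- The given transitive orientation is only known to exist. The program computes one of its own, and
-- the given one serves to show that no implication class contains an arc together with its
-- reversal. The machine has no multiplication, so row starts, slot addresses and multiples of the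
-- digit weights come from tables built by addition; the key of a state then costs a number of steps
-- that depends on k alone. All arrays except the two input ones start at 0, so neither the table of
-- seen keys nor the output has to be cleared. The exponent k + 2 arises as follows: the topological
-- order is produced by scanning all n vertices for each rank from 0 to n, and each of these n(n +
-- 1) visits is charged a full pass over at most (n + 1)^k (Q + 1)^k states. The cubic orientation
-- phase fits because k is at least 1. Bounds are kept in n + 1 and Q + 1, which are never 0, and n
-- + 1 is replaced by 2n only at the end. What a program leaves untouched is read off its text
-- (`Frame`), so the invariants mention only memory that changes.

update-same : {A : Set} (f : ℕ → A) (i : ℕ) (x : A) → (f [ i ↦ x ]) i ≡ x
-- `does (i ≟ i)` computes to `i ≡ᵇ i`, which is therefore the term to abstract.
update-same f i x with i ≡ᵇ i | ≡⇒≡ᵇ i i refl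
... | true | _ = refl

update-other : {A : Set} (f : ℕ → A) {i j : ℕ} (x : A) → j ≢ i → (f [ i ↦ x ]) j ≡ f j
update-other f {i} {j} x j≢i with j ≡ᵇ i | ≡ᵇ⇒≡ j i
... | true  | j≡i = contradiction (j≡i tt) j≢i
... | false | _   = refl

writesRegister : Program → ℕ → Bool
writesRegister skip r = false
writesRegister (x ≔ e) r = does (r ≟ x)
writesRegister (a ⟦ e ⟧≔ f) r = false
writesRegister (P ⨾ P′) r = writesRegister P r ∨ writesRegister P′ r
writesRegister (ifz e then P else P′) r = writesRegister P r ∨ writesRegister P′ r
writesRegister (while e loop P) r = writesRegister P r

writesArray : Program → ℕ → Bool
writesArray skip a = false
writesArray (x ≔ e) a = false
writesArray (b ⟦ e ⟧≔ f) a = does (a ≟ b)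
writesArray (P ⨾ P′) a = writesArray P a ∨ writesArray P′ a
writesArray (ifz e then P else P′) a = writesArray P a ∨ writesArray P′ a
writesArray (while e loop P) a = writesArray P a

-- The side conditions are implicit so that they are discharged by evaluation
-- at literal register and array numbers.
record Frame (P : Program) (s s′ : State) : Set where
  field
    register : ∀ r {_ : T (not (writesRegister P r))} → registers s′ r ≡ registers s r
    array    : ∀ a {_ : T (not (writesArray P a))} → arrays s′ a ≡ arrays s a

open Frame public

∨-leftᶠ : ∀ x y → T (not (x ∨ y)) → T (not x)
∨-leftᶠ false y _ = tt

∨-rightᶠ : ∀ x y → T (not (x ∨ y)) → T (not y)
∨-rightᶠ false y h = h

module _ where

  private
    variable
      T₁ T₂ : ℕ
      s s′ : State
      P P′ : Program
      e : Expr
      Q Q′ : State → Set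

  frame-refl : Frame P s s
  frame-refl .register r = refl
  frame-refl .array a = refl

  frame-trans : ∀ {s₁ s₂ s₃} → Frame P s₁ s₂ → Frame P s₂ s₃ → Frame P s₁ s₃
  frame-trans f g .register r {h} = trans (register g r {h}) (register f r {h})
  frame-trans f g .array a {h} = trans (array g a {h}) (array f a {h})

  frame-left : ∀ P P′ → Frame P s s′ → Frame (P ⨾ P′) s s′
  frame-left P P′ f .register r {h} = register f r {∨-leftᶠ (writesRegister P r) (writesRegister P′ r) h}
  frame-left P P′ f .array a {h} = array f a {∨-leftᶠ (writesArray P a) (writesArray P′ a) h}

  frame-right : ∀ P P′ → Frame P′ s s′ → Frame (P ⨾ P′) s s′
  frame-right P P′ f .register r {h} = register f r {∨-rightᶠ (writesRegister P r) (writesRegister P′ r) h}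
  frame-right P P′ f .array a {h} = array f a {∨-rightᶠ (writesArray P a) (writesArray P′ a) h}

  frame-assign : ∀ {x v} → Frame (x ≔ e) s (setRegister s x v)
  frame-assign {x = x} .register r {h} with does (r ≟ x) | h
  ... | false | _ = refl
  frame-assign .array a = refl

  frame-store : ∀ {a i v e f} → Frame (a ⟦ e ⟧≔ f) s (setCell s a i v)
  frame-store .register r = refl
  frame-store {a = b} .array a {h} with does (a ≟ b) | h
  ... | false | _ = refl

  ⇓-frame : ∀ {t} → ⟪ P , s ⟫⇓[ t ] s′ → Frame P s s′
  ⇓-frame skip = frame-refl
  ⇓-frame (assign {e = e}) = frame-assign {e = e}
  ⇓-frame (store {e = e} {f}) = frame-store {e = e} {f}
  ⇓-frame (seq {P} {P′} p q) =
    frame-trans {P = P ⨾ P′} (frame-left P P′ (⇓-frame p)) (frame-right P P′ (⇓-frame q))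
  ⇓-frame (if-zero {P = P} {P′} _ p) = record { register = register f ; array = array f }
    where f = frame-left P P′ (⇓-frame p)
  ⇓-frame (if-pos {P = P} {P′} _ p) = record { register = register f ; array = array f }
    where f = frame-right P P′ (⇓-frame p)
  ⇓-frame (stop _) = frame-refl
  ⇓-frame (loop {e} {P} _ p q) =
    record { register = λ r {h} → trans (register (⇓-frame q) r {h}) (register (⇓-frame p) r {h})
           ; array    = λ a {h} → trans (array (⇓-frame q) a {h}) (array (⇓-frame p) a {h}) }

  -- A total-correctness triple in which `T` only bounds the time from above, so that costs may be
  -- rounded up freely.
  record Run (P : Program) (s : State) (T : ℕ) (Q : State → Set) : Set where
    constructor run
    field
      {time}  : ℕ
      {final} : State
      halts   : ⟪ P , s ⟫⇓[ time ] final
      fast    : time ≤ T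
      post    : Q final

  open Run public

  run-skip : Q s → Run skip s 1 Q
  run-skip q = run skip ≤-refl q

  run-assign : ∀ {x} → Q (setRegister s x (eval s e)) → Run (x ≔ e) s (suc (cost e)) Q
  run-assign q = run assign ≤-refl q

  run-store : ∀ {a f} → Q (setCell s a (eval s e) (eval s f)) →
              Run (a ⟦ e ⟧≔ f) s (suc (cost e + cost f)) Q
  run-store q = run store ≤-refl q

  -- The continuation receives the frame of `P`, so `Q` need not repeat facts about memory that `P`
  -- does not write.
  run-seq : Run P s T₁ Q → (∀ s′ → Frame P s s′ → Q s′ → Run P′ s′ T₂ Q′) →
            Run (P ⨾ P′) s (T₁ + T₂) Q′
  run-seq (run p t q) r with r _ (⇓-frame p) q
  ... | run p′ t′ q′ = run (seq p p′) (+-mono-≤ t t′) q′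

  assign-then : ∀ {x} → Run P (setRegister s x (eval s e)) T₁ Q →
                Run (x ≔ e ⨾ P) s (suc (cost e) + T₁) Q
  assign-then {T₁ = T₁} (run p t q) = run (seq assign p) (+-monoʳ-≤ _ t) q

  store-then : ∀ {a f} → Run P (setCell s a (eval s e) (eval s f)) T₁ Q →
               Run (a ⟦ e ⟧≔ f ⨾ P) s (suc (cost e + cost f) + T₁) Q
  store-then (run p t q) = run (seq store p) (+-monoʳ-≤ _ t) q

  -- Charging both branches keeps every bound a sum, at the price of a constant factor.
  run-if : (eval s e ≡ 0 → Run P s T₁ Q) → (eval s e ≢ 0 → Run P′ s T₂ Q) →
           Run (ifz e then P else P′) s (suc (cost e + (T₁ + T₂))) Q
  run-if {s} {e} {T₁ = T₁} {T₂ = T₂} z nz with eval s e ≟ 0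
  ... | yes e≡0 with z e≡0
  ...   | run p t q = run (if-zero e≡0 p) (s≤s (+-monoʳ-≤ (cost e) (≤-trans t (m≤m+n T₁ T₂)))) q
  run-if {s} {e} {T₁ = T₁} {T₂ = T₂} z nz | no e≢0 with nz e≢0
  ...   | run p t q = run (if-pos e≢0 p) (s≤s (+-monoʳ-≤ (cost e) (≤-trans t (m≤n+m T₂ T₁)))) q

  run-mono : T₁ ≤ T₂ → (∀ s′ → Frame P s s′ → Q s′ → Q′ s′) → Run P s T₁ Q → Run P s T₂ Q′
  run-mono T≤ q⇒ (run p t q) = run p (≤-trans t T≤) (q⇒ _ (⇓-frame p) q)

  -- The body runs at most `μ s` times, and the extra unit pays for the failing test. The recursion
  -- is on an upper bound of the measure, since `μ` may drop by more than one.
  run-while : (I : State → Set) (μ : State → ℕ) →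
              (∀ s → I s → eval s e ≢ 0 → Run P s T₁ (λ s′ → I s′ × μ s′ < μ s)) →
              I s → Run (while e loop P) s (suc (μ s) * (suc (cost e) + T₁)) (λ s′ → I s′ × eval s′ e ≡ 0)
  run-while {e} {P} {T₁} I μ body i = go _ i ≤-refl
    where
    c = suc (cost e) + T₁
    go : ∀ m {s} → I s → μ s ≤ m → Run (while e loop P) s (suc m * c) (λ s′ → I s′ × eval s′ e ≡ 0)
    go m {s} i μ≤m with eval s e ≟ 0
    ... | yes e≡0 = run (stop e≡0) (≤-trans (m≤m+n _ T₁) (m≤m+n c (m * c))) (i , e≡0)
    go zero i μ≤m | no e≢0 with body _ i e≢0
    ... | run _ _ (_ , μ<) = contradiction (≤-trans μ< μ≤m) (λ ())
    go (suc m) i μ≤m | no e≢0 with body _ i e≢0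
    ... | run {t₁} p t (i′ , μ<) with go m i′ (≤-pred (≤-trans μ< μ≤m))
    ... | run {t₂} p′ t′ q = run (loop e≢0 p p′) le q
      where
      open ≤-Reasoning
      le = begin
        suc (cost e + (t₁ + t₂))            ≤⟨ s≤s (+-monoʳ-≤ (cost e) (+-mono-≤ t t′)) ⟩
        suc (cost e + (T₁ + suc m * c))     ≡⟨ cong suc (+-assoc (cost e) T₁ _) ⟨
        c + suc m * c                       ∎

  for : ℕ → Expr → Program → Program
  for x e P = x ≔ lit 0 ⨾ while e ⊖ reg x loop (P ⨾ x ≔ reg x ⊕ lit 1)

  -- Each round pays `cost e + 3` for the test and 4 for the increment. The other 2 of the constant
  -- 9 cover the initial assignment, charged to every round so that the bound is a product.
  forTime : ℕ → Expr → ℕ → ℕ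
  forTime m e T = suc m * (T + (cost e + 9))

  -- Every round is handed a frame that starts before the loop, so `I` describes only what the loop
  -- changes. The second hypothesis makes `I` blind to the counter, which is updated outside of the
  -- body.
  run-for : ∀ {x} (m : ℕ) (I : ℕ → State → Set) →
            {_ : T (not (writesRegister P x))} →
            (∀ {s′} → Frame (for x e P) s s′ → eval s′ e ≡ m) →
            (∀ {i v s′} → I i s′ → I i (setRegister s′ x v)) →
            (∀ (i : Fin m) s′ → registers s′ x ≡ toℕ i → Frame (for x e P) s s′ → I (toℕ i) s′ →
               Run P s′ T₁ (I (suc (toℕ i)))) →
            I 0 s → Run (for x e P) s (forTime m e T₁) (I m)
  run-for {P} {e} {s} {T₁} {x} m I {x∉} bound stable body i₀ =
    run-mono le (λ _ _ → finish) (assign-then (run-while J μ step start))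
    where
    F = for x e P
    J : State → Set
    J s′ = Frame F s s′ × registers s′ x ≤ m × I (registers s′ x) s′
    μ : State → ℕ
    μ s′ = m ∸ registers s′ x
    s₀ = setRegister s x 0
    s₀x : registers s₀ x ≡ 0
    s₀x = update-same (registers s) x 0
    inc : Expr
    inc = reg x ⊕ lit 1
    frame-body : ∀ {s₁ s₂} → Frame (P ⨾ x ≔ inc) s₁ s₂ → Frame F s₁ s₂
    frame-body f = record { register = λ r {h} → register f r {∨-rightᶠ (does (r ≟ x)) _ h}
                          ; array = λ a {h} → array f a {h} }
    start : J s₀
    start = frame-left (x ≔ lit 0) (while e ⊖ reg x loop (P ⨾ x ≔ reg x ⊕ lit 1)) (frame-assign {e = lit 0})
          , subst (_≤ m) (sym s₀x) z≤n , subst (λ i → I i s₀) (sym s₀x) (stable i₀)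
    step : ∀ s′ → J s′ → eval s′ (e ⊖ reg x) ≢ 0 →
           Run (P ⨾ x ≔ inc) s′ (T₁ + 4) (λ s″ → J s″ × μ s″ < μ s′)
    step s′ (f , _ , i) ≢0 = run-mono ≤-refl after
      (run-seq (body v s′ (sym vx) f (subst (λ i → I i s′) (sym vx) i)) λ s₁ f₁ i₁ →
        run-assign ( (stable i₁)
                   , trans (update-same (registers s₁) x _)
                       (trans (+-comm (registers s₁ x) 1) (cong suc (trans (register f₁ x {x∉}) (sym vx))))))
      where
      lt : registers s′ x < m
      lt with m ≤? registers s′ x
      ... | yes m≤ = contradiction (trans (cong (_∸ registers s′ x) (bound f)) (m≤n⇒m∸n≡0 m≤)) ≢0
      ... | no m≰  = ≰⇒> m≰
      v : Fin m
      v = fromℕ< lt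
      vx : toℕ v ≡ registers s′ x
      vx = Fin.toℕ-fromℕ< lt
      after : ∀ s″ → Frame (P ⨾ x ≔ inc) s′ s″ → I (suc (toℕ v)) s″ × registers s″ x ≡ suc (toℕ v) → J s″ × μ s″ < μ s′
      after s″ f″ (i″ , eq) =
        ( frame-trans {P = F} f (frame-body f″)
        , subst (_≤ m) (sym eq) (Fin.toℕ<n v) , subst (λ i → I i s″) (sym eq) i″)
        , subst (λ y → m ∸ y < μ s′) (sym (trans eq (cong suc vx))) (∸-monoʳ-< (n<1+n _) lt)
    finish : ∀ {s′} → J s′ × eval s′ (e ⊖ reg x) ≡ 0 → I m s′
    finish {s′} ((f , ≤m , i) , ≡0) =
      subst (λ y → I y s′) (≤-antisym ≤m (m∸n≡0⇒m≤n (trans (cong (_∸ registers s′ x) (sym (bound f))) ≡0))) i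
    le : 2 + suc (μ s₀) * (suc (cost (e ⊖ reg x)) + (T₁ + 4)) ≤ forTime m e T₁
    le rewrite s₀x = begin
      2 + suc m * (suc (suc (cost e + 1)) + (T₁ + 4)) ≤⟨ +-monoˡ-≤ _ (m≤m+n 2 (2 * m)) ⟩
      2 + 2 * m + suc m * (suc (suc (cost e + 1)) + (T₁ + 4)) ≡⟨ eq m (cost e) T₁ ⟩
      suc m * (T₁ + (cost e + 9)) ∎
      where
      open ≤-Reasoning
      eq : ∀ m c T → 2 + 2 * m + suc m * (suc (suc (c + 1)) + (T + 4)) ≡ suc m * (T + (c + 9))
      eq = solve-∀

  run-whileᶠ : (I : State → Set) (μ : State → ℕ) →
               (∀ s′ → Frame P s s′ → I s′ → eval s′ e ≢ 0 → Run P s′ T₁ (λ s″ → I s″ × μ s″ < μ s′)) →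
               I s → Run (while e loop P) s (suc (μ s) * (suc (cost e) + T₁)) (λ s′ → I s′ × eval s′ e ≡ 0)
  run-whileᶠ {P} {s} I μ body i = run-mono ≤-refl (λ _ _ q → proj₂ (proj₁ q) , proj₂ q)
    (run-while (λ s′ → Frame P s s′ × I s′) μ
      (λ s′ (f , i′) ≢0 → run-mono ≤-refl
        (λ _ f′ (i″ , μ<) → (frame-trans {P = P} f f′ , i″) , μ<) (body s′ f i′ ≢0))
      (frame-refl {P = P} , i))

-- The pigeonhole principle, for bounding the queue by the number of arcs and the list of states by
-- the number of keys.
injection⇒≤ : ∀ {a b} (f : ℕ → ℕ) → (∀ {i} → i < a → f i < b) →
              (∀ {i j} → i < a → j < a → f i ≡ f j → i ≡ j) → a ≤ b
injection⇒≤ {a} {b} f f< f-inj = Fin.injective⇒≤ {f = g} g-inj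
  where
  g : Fin a → Fin b
  g i = fromℕ< (f< (Fin.toℕ<n i))
  g-inj : ∀ {i j} → g i ≡ g j → i ≡ j
  g-inj {i} {j} eq = Fin.toℕ-injective (f-inj (Fin.toℕ<n i) (Fin.toℕ<n j)
    (trans (sym (Fin.toℕ-fromℕ< (f< (Fin.toℕ<n i)))) (trans (cong toℕ eq) (Fin.toℕ-fromℕ< (f< (Fin.toℕ<n j))))))

-- Implication classes and the lexicographic orientation

cell : ∀ {m n} → Fin m → Fin n → ℕ
cell i j = toℕ (combine i j)

cell-injective : ∀ {m n} {i i′ : Fin m} {j j′ : Fin n} → cell i j ≡ cell i′ j′ → i ≡ i′ × j ≡ j′
cell-injective eq = Fin.combine-injective _ _ _ _ (Fin.toℕ-injective eq)

-- For `lexFirst-acyclic`, where only the first vertices of the seeds are compared.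
cell≤⇒≤ : ∀ {m n} {i i′ : Fin m} {j j′ : Fin n} → cell i j ≤ cell i′ j′ → toℕ i ≤ toℕ i′
cell≤⇒≤ {i = i} {i′} {j} {j′} le with toℕ i ≤? toℕ i′
... | yes i≤i′ = i≤i′
... | no i≰i′  = contradiction le (<⇒≱ (Fin.combine-monoˡ-< j′ j (≰⇒> i≰i′)))

matrix-cell : ∀ {m n} (M : Fin m → Fin n → ℕ) i j → matrix m n M (cell i j) ≡ M i j
matrix-cell {m} {n} M i j with cell i j <? m * n
... | yes lt = trans (cong (uncurry M ∘ remQuot n) (Fin.fromℕ<-toℕ (combine i j) lt))
                     (cong (uncurry M) (Fin.remQuot-combine i j))
... | no ≮ = contradiction (Fin.toℕ<n (combine i j)) ≮

edge-sym : ∀ {n} (H : Graph n) {u v} → Edge H u v → Edge H v u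
edge-sym H {u} {v} = subst T (adj-sym H u v)

edge-irrefl : ∀ {n} (H : Graph n) {v} → ¬ Edge H v v
edge-irrefl H {v} = subst T (adj-irrefl H v)

edge? : ∀ {n} (H : Graph n) u v → Dec (Edge H u v)
edge? H u v with adj H u v
... | true  = yes tt
... | false = no id

-- Golumbic's implication classes: Forces H u v x y says that every transitive
-- orientation of H containing the arc (u , v) contains the arc (x , y).
data Forces {n} (H : Graph n) (u v : Fin n) : Fin n → Fin n → Set where
  here : Forces H u v u v
  tail : ∀ {x y z} → Forces H u v x y → Edge H x z → ¬ Edge H y z → Forces H u v x z
  head : ∀ {x y z} → Forces H u v x y → Edge H z y → ¬ Edge H x z → Forces H u v z y

module _ {n : ℕ} {H : Graph n} where

  forces-edge : ∀ {u v x y} → Edge H u v → Forces H u v x y → Edge H x y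
  forces-edge e here = e
  forces-edge e (tail _ e′ _) = e′
  forces-edge e (head _ e′ _) = e′

  forces-trans : ∀ {u v x y a b} → Forces H u v x y → Forces H x y a b → Forces H u v a b
  forces-trans f here = f
  forces-trans f (tail g e ne) = tail (forces-trans f g) e ne
  forces-trans f (head g e ne) = head (forces-trans f g) e ne

  -- Each step is undone by a step of the same kind: the same missing edge justifies both
  -- directions.
  forces-sym : ∀ {u v x y} → Edge H u v → Forces H u v x y → Forces H x y u v
  forces-sym e here = here
  forces-sym e (tail f _ ne) =
    forces-trans (tail here (forces-edge e f) (ne ∘ edge-sym H)) (forces-sym e f)
  forces-sym e (head f _ ne) =
    forces-trans (head here (forces-edge e f) (ne ∘ edge-sym H)) (forces-sym e f)

  forces-reverse : ∀ {u v x y} → Forces H u v x y → Forces H v u y x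
  forces-reverse here = here
  forces-reverse (tail f e ne) = head (forces-reverse f) (edge-sym H e) ne
  forces-reverse (head f e ne) = tail (forces-reverse f) (edge-sym H e) ne

-- The arc (u , v) lies on the side of its implication class that contains
-- the lexicographically smallest arc of the class and its reversal.
record LexFirst {n} (H : Graph n) (u v : Fin n) : Set where
  field
    edge      : Edge H u v
    {a b}     : Fin n
    seed-edge : Edge H a b
    seed      : Forces H a b u v
    smallest  : ∀ {x y} → Forces H u v x y → cell a b ≤ cell x y × cell a b ≤ cell y x

module _ {n : ℕ} {H : Graph n} where

  lexFirst-forces : ∀ {u v x y} → LexFirst H u v → Forces H u v x y → LexFirst H x y
  lexFirst-forces l f = record
    { edge      = forces-edge (LexFirst.edge l) f
    ; seed-edge = LexFirst.seed-edge l
    ; seed      = forces-trans (LexFirst.seed l) f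
    ; smallest  = λ g → LexFirst.smallest l (forces-trans f g)
    }

  to-seed : ∀ {u v} (l : LexFirst H u v) → Forces H u v (LexFirst.a l) (LexFirst.b l)
  to-seed l = forces-sym (LexFirst.seed-edge l) (LexFirst.seed l)

module LexOrientation {n : ℕ} {H : Graph n} {_⟶_ : Fin n → Fin n → Set}
                      (F : IsTransitiveOrientation H _⟶_) where

  open IsTransitiveOrientation F

  private
    variable
      u v w x y : Fin n

  -- If the new edge were oriented the other way, transitivity with the previous arc would create
  -- the edge whose absence justifies the step.
  forces-⟶ : Forces H u v x y → u ⟶ v → x ⟶ y
  forces-⟶ here h = h
  forces-⟶ (tail f e ne) h with edge⇒⟶ e
  ... | inj₁ x⟶z = x⟶z
  ... | inj₂ z⟶x = contradiction (edge-sym H (⟶⇒edge (transitive z⟶x (forces-⟶ f h)))) ne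
  forces-⟶ (head f e ne) h with edge⇒⟶ e
  ... | inj₁ z⟶y = z⟶y
  ... | inj₂ y⟶z = contradiction (⟶⇒edge (transitive (forces-⟶ f h) y⟶z)) ne

  -- This is what the given orientation contributes: it contains one of the two arcs, and hence
  -- would contain both.
  forces-irreversible : Edge H u v → ¬ Forces H u v v u
  forces-irreversible e f with edge⇒⟶ e
  ... | inj₁ u⟶v = asymmetric u⟶v (forces-⟶ f u⟶v)
  ... | inj₂ v⟶u = asymmetric v⟶u (forces-⟶ (forces-reverse f) v⟶u)

  -- Reversal exchanges the classes of the two arcs, and `smallest` ranges over arcs and their
  -- reversals alike. So both seeds are the same arc, which would then force its own reversal.
  lexFirst-asym : LexFirst H u v → ¬ LexFirst H v u
  lexFirst-asym {u} {v} l l′ = forces-irreversible (LexFirst.seed-edge l)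
    (forces-trans (LexFirst.seed l) (subst (λ z → Forces H u v z a) b′≡b (subst (Forces H u v b′) a′≡a
      (forces-reverse (to-seed l′)))))
    where
    open LexFirst l using (a; b)
    open LexFirst l′ using () renaming (a to a′; b to b′)
    ab≡a′b′ : a ≡ a′ × b ≡ b′
    ab≡a′b′ = cell-injective (≤-antisym
      (proj₂ (LexFirst.smallest l (forces-reverse (to-seed l′))))
      (proj₂ (LexFirst.smallest l′ (forces-reverse (to-seed l)))))
    a′≡a = sym (proj₁ ab≡a′b′)
    b′≡b = sym (proj₂ ab≡a′b′)

  -- Golumbic's triangle lemma for a cyclic triangle, by induction along the forcing chain. If `v`
  -- were not adjacent to the new end of the arc, the new arc would force the edge between `v` and
  -- the retained end. The direction forced is opposite to the one that this edge inherits from the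
  -- class of `(v , w)` or `(u , v)`, against asymmetry.
  triangle : LexFirst H u v → LexFirst H v w → LexFirst H w u → Forces H w u x y →
             Forces H w v x v × Forces H v u v y
  triangle uv vw wu here = here , here
  triangle {v = v} uv vw wu (tail {x} {y} {z} f e ne) with triangle uv vw wu f | edge? H v z
  ... | wv , vu | yes vz = wv , tail vu vz ne
  ... | wv , vu | no ¬vz = contradiction
    (lexFirst-forces wu (tail (tail f e ne) (forces-edge (edge-sym H (LexFirst.edge vw)) wv) (¬vz ∘ edge-sym H)))
    (lexFirst-asym (lexFirst-forces vw (forces-reverse wv)))
  triangle {v = v} uv vw wu (head {x} {y} {z} f e ne) with triangle uv vw wu f | edge? H z v
  ... | wv , vu | yes zv = head wv zv ne , vu
  ... | wv , vu | no ¬zv = contradiction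
    (lexFirst-forces wu (head (head f e ne) (forces-edge (edge-sym H (LexFirst.edge uv)) vu) ¬zv))
    (lexFirst-asym (lexFirst-forces uv (forces-reverse vu)))

  -- Each class of the cycle sees the first vertices of the others' seeds, so
  -- all three seeds start at the same vertex; moving the cycle onto that
  -- vertex then makes it adjacent to itself.
  lexFirst-acyclic : LexFirst H u v → LexFirst H v w → ¬ LexFirst H w u
  lexFirst-acyclic {u} {v} {w} uv vw wu =
    edge-irrefl H (subst (λ z → Edge H z a₁) a₂≡a₁
      (forces-edge (edge-sym H (LexFirst.edge ab)) (proj₁ (triangle wa ab bw toB))))
    where
    a₁ = LexFirst.a uv
    a₂ = LexFirst.a vw
    a₃ = LexFirst.a wu
    t₁ = triangle vw wu uv (to-seed uv)
    t₂ = triangle wu uv vw (to-seed vw)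
    t₃ = triangle uv vw wu (to-seed wu)
    -- The class of `(w , u)` contains `(w , a₁)`, whose reversal starts at `a₁`; the next two
    -- comparisons arise by rotating the cycle.
    a₃≤a₁ : toℕ a₃ ≤ toℕ a₁
    a₃≤a₁ = cell≤⇒≤ (proj₂ (LexFirst.smallest wu (forces-reverse (proj₁ t₁))))
    a₁≤a₂ : toℕ a₁ ≤ toℕ a₂
    a₁≤a₂ = cell≤⇒≤ (proj₂ (LexFirst.smallest uv (forces-reverse (proj₁ t₂))))
    a₂≤a₃ : toℕ a₂ ≤ toℕ a₃
    a₂≤a₃ = cell≤⇒≤ (proj₂ (LexFirst.smallest vw (forces-reverse (proj₁ t₃))))
    a₂≡a₁ : a₂ ≡ a₁
    a₂≡a₁ = Fin.toℕ-injective (≤-antisym (≤-trans a₂≤a₃ a₃≤a₁) a₁≤a₂)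
    wa = lexFirst-forces wu (forces-reverse (proj₁ t₁))
    ab = lexFirst-forces uv (to-seed uv)
    vw~bw = forces-reverse (proj₂ t₁)
    bw = lexFirst-forces vw vw~bw
    toB = forces-trans (forces-sym (LexFirst.edge vw) vw~bw) (to-seed vw)

  lexFirst-orientation : (∀ {u v} → Edge H u v → LexFirst H u v ⊎ LexFirst H v u) →
                         IsTransitiveOrientation H (LexFirst H)
  lexFirst-orientation total = record
    { ⟶⇒edge     = LexFirst.edge
    ; edge⇒⟶     = total
    ; asymmetric = lexFirst-asym
    ; transitive = trans′
    }
    where
    -- A missing edge `u w` would make `(u , v)` force `(w , v)`, against asymmetry; an edge
    -- directed from `w` to `u` would close a cyclic triangle.
    trans′ : LexFirst H u v → LexFirst H v w → LexFirst H u w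
    trans′ {u} {v} {w} uv vw with edge? H u w
    ... | no ¬uw = contradiction
      (lexFirst-forces uv (head here (edge-sym H (LexFirst.edge vw)) ¬uw)) (lexFirst-asym vw)
    ... | yes uw with total uw
    ...   | inj₁ l = l
    ...   | inj₂ l = contradiction l (lexFirst-acyclic uv vw)

-- Memory layout, the row table and the adjacency of the complement.

rN rAcc rI rHead rTail rA rB rU rV rW rX rY : ℕ
rN    = 0
rAcc  = 1
rI    = 2
rHead = 3
rTail = 4
rA    = 5
rB    = 6
rU    = 7
rV    = 8
rW    = 9
rX    = 10
rY    = 11

aAdj aProfit aOut aRow aArc aQueueX aQueueY : ℕ
aAdj    = 0
aProfit = 1
aOut    = 2
aRow    = 3
aArc    = 4
aQueueX = 5
aQueueY = 6

infix 7 _⟦_∙_⟧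
-- Without multiplication, the start `n * i` of row `i` has to be looked up.
_⟦_∙_⟧ : ℕ → ℕ → ℕ → Expr
a ⟦ x ∙ y ⟧ = a ⟦ aRow ⟦ reg x ⟧ ⊕ reg y ⟧

Rows : ℕ → ℕ → (ℕ → ℕ) → Set
Rows n m A = ∀ (i : Fin m) → A (toℕ i) ≡ n * toℕ i

row-cell : ∀ {m n A r r′} → Rows n m A → (i : Fin m) (j : Fin n) → r ≡ toℕ i → r′ ≡ toℕ j →
           A r + r′ ≡ cell i j
row-cell rows i j refl refl = trans (cong (_+ toℕ j) (rows i)) (sym (Fin.toℕ-combine i j))

rowTable : ℕ → Program
rowTable k =
  rAcc ≔ lit 0 ⨾
  for rI (reg rN ⊕ lit k)
    ( aRow ⟦ reg rI ⟧≔ reg rAcc ⨾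
      rAcc ≔ reg rAcc ⊕ reg rN )

run-rowTable : ∀ {s n} k → registers s rN ≡ n →
  Run (rowTable k) s (2 + forTime (n + k) (reg rN ⊕ lit k) 7)
      (λ s′ → ∀ i → i < n + k → arrays s′ aRow i ≡ n * i)
run-rowTable {s} {n} k n≡ = assign-then (run-mono ≤-refl (λ _ _ → proj₂)
  (run-for (n + k) I (λ f → cong (_+ k) (trans (register f rN) n≡)) id body (sym (*-zeroʳ n) , λ _ ())))
  where
  I : ℕ → State → Set
  I i s′ = registers s′ rAcc ≡ n * i × (∀ i′ → i′ < i → arrays s′ aRow i′ ≡ n * i′)
  body : ∀ (i : Fin (n + k)) s′ → registers s′ rI ≡ toℕ i → _ → I (toℕ i) s′ → Run _ s′ 7 (I (suc (toℕ i)))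
  body i s′ i≡ f (acc , rows) = store-then (run-assign
    ( trans (cong₂ _+_ acc (trans (register f rN) n≡)) (trans (+-comm _ n) (sym (*-suc n (toℕ i))))
    , rows′))
    where
    rows′ : ∀ i′ → i′ < suc (toℕ i) → (arrays s′ aRow [ registers s′ rI ↦ registers s′ rAcc ]) i′ ≡ n * i′
    rows′ i′ i′< with i′ ≟ toℕ i
    ... | yes refl = trans (cong (λ r → (arrays s′ aRow [ r ↦ registers s′ rAcc ]) (toℕ i)) i≡)
                       (trans (update-same (arrays s′ aRow) (toℕ i) _) acc)
    ... | no i′≢ = trans (update-other (arrays s′ aRow) _ (λ eq → i′≢ (trans eq i≡)))
                     (rows i′ (≤∧≢⇒< (≤-pred i′<) i′≢))

-- Setting the diagonal of the adjacency matrix of G to 1 makes the zeros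
-- exactly the edges of the complement of G.
diagonal : Program
diagonal = for rI (reg rN) (aAdj ⟦ aRow ⟦ reg rI ⟧ ⊕ reg rI ⟧≔ lit 1)

NonEdges : ∀ {n} → Graph n → (ℕ → ℕ) → Set
NonEdges H A = ∀ u v → A (cell u v) ≡ bit (not (adj H u v))

nonEdges-zero : ∀ {n} {H : Graph n} {A u v} → NonEdges H A → A (cell u v) ≡ 0 → Edge H u v
nonEdges-zero {H = H} {u = u} {v} A≡ 0≡ with adj H u v | trans (sym (A≡ u v)) 0≡
... | true | _ = tt

nonEdges-nonzero : ∀ {n} {H : Graph n} {A u v} → NonEdges H A → A (cell u v) ≢ 0 → ¬ Edge H u v
nonEdges-nonzero {H = H} {u = u} {v} A≡ ≢0 e with adj H u v | A≡ u v
... | true | eq = ≢0 eq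

complement-bit : ∀ {n} (G : Graph n) {u v} → u ≢ v → bit (not (adj (complement G) u v)) ≡ bit (adj G u v)
complement-bit G {u} {v} u≢v with adj G u v | u Fin.≟ v
... | _     | yes u≡v = contradiction u≡v u≢v
... | true  | no _    = refl
... | false | no _    = refl

run-diagonal : ∀ {s n} (G : Graph n) → registers s rN ≡ n → Rows n n (arrays s aRow) →
  (∀ u v → arrays s aAdj (cell u v) ≡ bit (adj G u v)) →
  Run diagonal s (forTime n (reg rN) 6) (λ s′ → NonEdges (complement G) (arrays s′ aAdj))
run-diagonal {s} {n} G n≡ rows A≡ =
  run-mono ≤-refl finish (run-for n I (λ f → trans (register f rN) n≡) id body ((λ u v _ → A≡ u v) , λ _ ()))
  where
  I : ℕ → State → Set
  I i s′ = (∀ u v → u ≢ v → arrays s′ aAdj (cell u v) ≡ bit (adj G u v))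
         × (∀ u → toℕ u < i → arrays s′ aAdj (cell u u) ≡ 1)
  body : ∀ (i : Fin n) s′ → registers s′ rI ≡ toℕ i → _ → I (toℕ i) s′ → Run _ s′ 6 (I (suc (toℕ i)))
  body i s′ i≡ f (off , on) = run-store (off′ , on′)
    where
    A = arrays s′ aAdj
    address : arrays s′ aRow (registers s′ rI) + registers s′ rI ≡ cell i i
    address = row-cell {A = arrays s′ aRow} (λ j → trans (cong (λ A → A (toℕ j)) (array f aRow)) (rows j)) i i i≡ i≡
    off′ : ∀ u v → u ≢ v → (A [ _ ↦ 1 ]) (cell u v) ≡ bit (adj G u v)
    off′ u v u≢v = trans (update-other A 1 λ eq → u≢v (case cell-injective (trans eq address) of λ { (p , q) → trans p (sym q) }))
                     (off u v u≢v)
    on′ : ∀ u → toℕ u < suc (toℕ i) → (A [ _ ↦ 1 ]) (cell u u) ≡ 1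
    on′ u u< with u Fin.≟ i
    ... | yes refl = trans (cong (λ c → (A [ c ↦ 1 ]) (cell i i)) address) (update-same A (cell i i) 1)
    ... | no u≢i   = trans (update-other A 1 λ eq → u≢i (proj₁ (cell-injective (trans eq address))))
                       (on u (≤∧≢⇒< (≤-pred u<) (u≢i ∘ Fin.toℕ-injective)))
  finish : ∀ s′ → _ → I n s′ → NonEdges (complement G) (arrays s′ aAdj)
  finish s′ _ (off , on) u v = split (u Fin.≟ v)
    where
    split : Dec (u ≡ v) → _
    split (yes refl) = trans (on u (Fin.toℕ<n u)) (cong (bit ∘ not) (sym (adj-irrefl (complement G) u)))
    split (no u≢v)   = trans (off u v u≢v) (sym (complement-bit G u≢v))

-- Computing the orientation by closing implication classes

push : Program
push =
  ifz aArc ⟦ rX ∙ rY ⟧ then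
    ( aArc ⟦ aRow ⟦ reg rX ⟧ ⊕ reg rY ⟧≔ lit 1 ⨾
      aQueueX ⟦ reg rTail ⟧≔ reg rX ⨾
      aQueueY ⟦ reg rTail ⟧≔ reg rY ⨾
      rTail ≔ reg rTail ⊕ lit 1 )
  else skip

-- A zero in `aAdj` is an edge of the complement. A vertex `w` forces something exactly when it is
-- adjacent to one end of the arc and not to the other, and the new arc then joins `w` to the
-- adjacent end.
choose scanBody scan : Program

choose =
  ifz aAdj ⟦ rU ∙ rW ⟧
    then (ifz aAdj ⟦ rV ∙ rW ⟧ then skip else (rY ≔ reg rW))
    else (ifz aAdj ⟦ rV ∙ rW ⟧ then (rX ≔ reg rW) else skip)

-- When w forces nothing, the arc (rU , rV) itself is pushed, which is a no-op.
scanBody = rX ≔ reg rU ⨾ rY ≔ reg rV ⨾ choose ⨾ push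

scan = for rW (reg rN) scanBody

-- The tested sum vanishes exactly for an edge that has not been oriented in either direction.
seed : Program
seed =
  ifz aAdj ⟦ rA ∙ rB ⟧ ⊕ aArc ⟦ rA ∙ rB ⟧ ⊕ aArc ⟦ rB ∙ rA ⟧ then
    ( rX ≔ reg rA ⨾
      rY ≔ reg rB ⨾
      push )
  else skip

advance : Program
advance =
  rB ≔ reg rB ⊕ lit 1 ⨾
  ifz reg rN ⊖ reg rB then (rB ≔ lit 0 ⨾ rA ≔ reg rA ⊕ lit 1) else skip

pop : Program
pop =
  rU ≔ aQueueX ⟦ reg rHead ⟧ ⨾
  rV ≔ aQueueY ⟦ reg rHead ⟧ ⨾
  rHead ≔ reg rHead ⊕ lit 1 ⨾
  scan

-- A new class is seeded only when the queue is empty, i.e. when the arcs found so far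
-- are closed under forcing.
orient : Program
orient =
  rHead ≔ lit 0 ⨾ rTail ≔ lit 0 ⨾ rA ≔ lit 0 ⨾ rB ≔ lit 0 ⨾
  while (reg rN ⊖ reg rA) ⊕ (reg rTail ⊖ reg rHead) loop
    (ifz reg rTail ⊖ reg rHead then (seed ⨾ advance) else pop)

-- Popped entries stay in place and only the head moves on, so the queue also enumerates, without
-- repetition, all arcs found so far.
record Queue {n} (H : Graph n) (D qx qy : ℕ → ℕ) (tl : ℕ) : Set where
  field
    lexFirst : ∀ {x y : Fin n} → D (cell x y) ≢ 0 → LexFirst H x y
    binary   : ∀ c → D c ≤ 1
    queued   : ∀ {i} → i < tl → Σ[ x ∈ Fin n ] Σ[ y ∈ Fin n ] (qx i ≡ toℕ x × qy i ≡ toℕ y × D (cell x y) ≢ 0)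
    found    : ∀ {x y : Fin n} → D (cell x y) ≢ 0 → ∃[ i ] (i < tl × qx i ≡ toℕ x × qy i ≡ toℕ y)
    distinct : ∀ {i j} → i < tl → j < tl → qx i ≡ qx j → qy i ≡ qy j → i ≡ j

record Grows (D qx qy : ℕ → ℕ) (tl : ℕ) (D′ qx′ qy′ : ℕ → ℕ) (tl′ : ℕ) : Set where
  field
    tl≤  : tl ≤ tl′
    arcs : ∀ {c} → D c ≢ 0 → D′ c ≢ 0
    oldx : ∀ {i} → i < tl → qx′ i ≡ qx i
    oldy : ∀ {i} → i < tl → qy′ i ≡ qy i

grows-refl : ∀ {D qx qy tl} → Grows D qx qy tl D qx qy tl
grows-refl = record { tl≤ = ≤-refl ; arcs = id ; oldx = λ _ → refl ; oldy = λ _ → refl }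

grows-trans : ∀ {D qx qy tl D′ qx′ qy′ tl′ D″ qx″ qy″ tl″} →
              Grows D qx qy tl D′ qx′ qy′ tl′ → Grows D′ qx′ qy′ tl′ D″ qx″ qy″ tl″ →
              Grows D qx qy tl D″ qx″ qy″ tl″
grows-trans g h = record
  { tl≤  = ≤-trans (Grows.tl≤ g) (Grows.tl≤ h)
  ; arcs = Grows.arcs h ∘ Grows.arcs g
  ; oldx = λ i< → trans (Grows.oldx h (<-≤-trans i< (Grows.tl≤ g))) (Grows.oldx g i<)
  ; oldy = λ i< → trans (Grows.oldy h (<-≤-trans i< (Grows.tl≤ g))) (Grows.oldy g i<)
  }

queue-length : ∀ {n} {H : Graph n} {D qx qy tl} → Queue H D qx qy tl → tl ≤ n * n
queue-length {n} {H} {D} {qx} {qy} {tl} q = injection⇒≤ f f< f-inj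
  where
  open Queue q
  f : ℕ → ℕ
  f i = n * qx i + qy i
  f< : ∀ {i} → i < tl → f i < n * n
  f< i< with queued i<
  ... | x , y , x≡ , y≡ , _ rewrite x≡ | y≡ | sym (Fin.toℕ-combine x y) = Fin.toℕ<n (combine x y)
  f-inj : ∀ {i j} → i < tl → j < tl → f i ≡ f j → i ≡ j
  f-inj {i} {j} i< j< eq with queued i< | queued j<
  ... | x , y , x≡ , y≡ , _ | x′ , y′ , x′≡ , y′≡ , _ = distinct i< j<
    (trans x≡ (trans (cong toℕ (proj₁ same)) (sym x′≡)))
    (trans y≡ (trans (cong toℕ (proj₂ same)) (sym y′≡)))
    where
    same : x ≡ x′ × y ≡ y′
    same = cell-injective (begin
      cell x y              ≡⟨ Fin.toℕ-combine x y ⟩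
      n * toℕ x + toℕ y     ≡⟨ cong₂ (λ a b → n * a + b) x≡ y≡ ⟨
      n * qx i + qy i       ≡⟨ eq ⟩
      n * qx j + qy j       ≡⟨ cong₂ (λ a b → n * a + b) x′≡ y′≡ ⟩
      n * toℕ x′ + toℕ y′   ≡⟨ Fin.toℕ-combine x′ y′ ⟨
      cell x′ y′            ∎)
      where open ≡-Reasoning

module _ {n : ℕ} {H : Graph n} {D qx qy : ℕ → ℕ} {tl : ℕ} (q : Queue H D qx qy tl)
         {x y : Fin n} (new : D (cell x y) ≡ 0) where

  open Queue q

  private
    D′ qx′ qy′ : ℕ → ℕ
    D′ = D [ cell x y ↦ 1 ]
    qx′ = qx [ tl ↦ toℕ x ]
    qy′ = qy [ tl ↦ toℕ y ]

    mono : ∀ {c} → D c ≢ 0 → D′ c ≢ 0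
    mono {c} ≢0 with c ≟ cell x y
    ... | yes refl = contradiction new ≢0
    ... | no c≢    = λ eq → ≢0 (trans (sym (update-other D 1 c≢)) eq)

  grows-push : Grows D qx qy tl D′ qx′ qy′ (suc tl)
  grows-push = record
    { tl≤  = n≤1+n tl
    ; arcs = mono
    ; oldx = λ i< → update-other qx _ (<⇒≢ i<)
    ; oldy = λ i< → update-other qy _ (<⇒≢ i<)
    }

  pushed : D′ (cell x y) ≢ 0
  pushed eq = contradiction (trans (sym (update-same D (cell x y) 1)) eq) λ ()

  queue-push : LexFirst H x y → Queue H D′ qx′ qy′ (suc tl)
  queue-push l = record { lexFirst = lexFirst′ ; binary = binary′ ; queued = queued′ ; found = found′ ; distinct = distinct′ }
    where
    open Grows grows-push
    entryx : qx′ tl ≡ toℕ x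
    entryx = update-same qx tl _
    entryy : qy′ tl ≡ toℕ y
    entryy = update-same qy tl _
    lexFirst′ : ∀ {a b} → D′ (cell a b) ≢ 0 → LexFirst H a b
    lexFirst′ {a} {b} ≢0 with cell a b ≟ cell x y
    ... | no c≢ = lexFirst {a} {b} λ eq → ≢0 (trans (update-other D 1 c≢) eq)
    ... | yes c≡ with cell-injective {i = a} {x} {b} {y} c≡
    ...   | refl , refl = l
    binary′ : ∀ c → D′ c ≤ 1
    binary′ c with c ≟ cell x y
    ... | yes refl = ≤-reflexive (update-same D (cell x y) 1)
    ... | no c≢    = subst (_≤ 1) (sym (update-other D 1 c≢)) (binary c)
    queued′ : ∀ {i} → i < suc tl → ∃[ a ] ∃[ b ] (qx′ i ≡ toℕ a × qy′ i ≡ toℕ b × D′ (cell a b) ≢ 0)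
    queued′ {i} i< with i ≟ tl
    ... | yes refl = x , y , entryx , entryy , pushed
    ... | no i≢ with ≤∧≢⇒< (≤-pred i<) i≢
    ...   | i<tl with queued i<tl
    ...     | a , b , a≡ , b≡ , ≢0 = a , b , trans (oldx i<tl) a≡ , trans (oldy i<tl) b≡ , mono ≢0
    found′ : ∀ {a b} → D′ (cell a b) ≢ 0 → ∃[ i ] (i < suc tl × qx′ i ≡ toℕ a × qy′ i ≡ toℕ b)
    found′ {a} {b} ≢0 with cell a b ≟ cell x y
    ... | yes c≡ with cell-injective {i = a} {x} {b} {y} c≡
    ...   | refl , refl = tl , n<1+n tl , entryx , entryy
    found′ {a} {b} ≢0 | no c≢ with found {a} {b} (λ eq → ≢0 (trans (update-other D 1 c≢) eq))
    ...   | i , i< , a≡ , b≡ = i , m<n⇒m<1+n i< , trans (oldx i<) a≡ , trans (oldy i<) b≡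
    fresh : ∀ {i} → i < tl → qx i ≡ toℕ x → qy i ≡ toℕ y → ⊥
    fresh i< x≡ y≡ with queued i<
    ... | a , b , a≡ , b≡ , ≢0 with Fin.toℕ-injective (trans (sym a≡) x≡) | Fin.toℕ-injective (trans (sym b≡) y≡)
    ...   | refl | refl = ≢0 new
    distinct′ : ∀ {i j} → i < suc tl → j < suc tl → qx′ i ≡ qx′ j → qy′ i ≡ qy′ j → i ≡ j
    distinct′ {i} {j} i< j< x≡ y≡ with i ≟ tl | j ≟ tl
    ... | yes refl | yes refl = refl
    ... | yes refl | no j≢ = ⊥-elim (fresh j<tl (trans (sym (oldx j<tl)) (trans (sym x≡) entryx))
                                                (trans (sym (oldy j<tl)) (trans (sym y≡) entryy)))
      where j<tl = ≤∧≢⇒< (≤-pred j<) j≢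
    ... | no i≢ | yes refl = ⊥-elim (fresh i<tl (trans (sym (oldx i<tl)) (trans x≡ entryx))
                                                (trans (sym (oldy i<tl)) (trans y≡ entryy)))
      where i<tl = ≤∧≢⇒< (≤-pred i<) i≢
    ... | no i≢ | no j≢ = distinct i<tl j<tl (trans (sym (oldx i<tl)) (trans x≡ (oldx j<tl)))
                                             (trans (sym (oldy i<tl)) (trans y≡ (oldy j<tl)))
      where
      i<tl = ≤∧≢⇒< (≤-pred i<) i≢
      j<tl = ≤∧≢⇒< (≤-pred j<) j≢

QueueAt : ∀ {n} → Graph n → State → Set
QueueAt H s = Queue H (arrays s aArc) (arrays s aQueueX) (arrays s aQueueY) (registers s rTail)

GrowsAt : State → State → Set
GrowsAt s s′ = Grows (arrays s aArc) (arrays s aQueueX) (arrays s aQueueY) (registers s rTail)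
                     (arrays s′ aArc) (arrays s′ aQueueX) (arrays s′ aQueueY) (registers s′ rTail)

-- 6 for the test, 16 for recording an arc and 1 for `skip`.
pushTime : ℕ
pushTime = 23

run-push : ∀ {n} {H : Graph n} {s} {x y : Fin n} → Rows n n (arrays s aRow) →
  registers s rX ≡ toℕ x → registers s rY ≡ toℕ y → QueueAt H s → LexFirst H x y →
  Run push s pushTime (λ s′ → QueueAt H s′ × GrowsAt s s′ × arrays s′ aArc (cell x y) ≢ 0)
run-push {n} {H} {s} {x} {y} rows x≡ y≡ q l = run-if
  (λ eq → store-then (store-then (store-then (run-assign (after address x≡ y≡ (+-comm tl 1) (trans (cong D (sym address)) eq))))))
  (λ ≢0 → run-skip (q , grows-refl , λ eq → ≢0 (trans (cong D address) eq)))
  where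
  D  = arrays s aArc
  qx = arrays s aQueueX
  qy = arrays s aQueueY
  tl = registers s rTail
  address : arrays s aRow (registers s rX) + registers s rY ≡ cell x y
  address = row-cell {A = arrays s aRow} rows x y x≡ y≡
  Goal : ℕ → ℕ → ℕ → ℕ → Set
  Goal c a b t = Queue H (D [ c ↦ 1 ]) (qx [ tl ↦ a ]) (qy [ tl ↦ b ]) t
               × Grows D qx qy tl (D [ c ↦ 1 ]) (qx [ tl ↦ a ]) (qy [ tl ↦ b ]) t
               × (D [ c ↦ 1 ]) (cell x y) ≢ 0
  -- With the machine's values generalised to variables, matching on `refl` brings the nested
  -- updates literally into the form of `queue-push`.
  after : ∀ {c a b t} → c ≡ cell x y → a ≡ toℕ x → b ≡ toℕ y → t ≡ suc tl → D (cell x y) ≡ 0 → Goal c a b t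
  after refl refl refl refl new = queue-push q new l , grows-push q new , pushed q new

Forced : ∀ {n} → Graph n → (ℕ → ℕ) → Fin n → Fin n → Fin n → Set
Forced H D x y z = (Edge H x z → ¬ Edge H y z → D (cell x z) ≢ 0)
                 × (Edge H z y → ¬ Edge H x z → D (cell z y) ≢ 0)

forced-mono : ∀ {n} {H : Graph n} {D D′ : ℕ → ℕ} {x y z} → (∀ {c} → D c ≢ 0 → D′ c ≢ 0) →
              Forced H D x y z → Forced H D′ x y z
forced-mono mono (f , g) = (λ e ne → mono (f e ne)) , (λ e ne → mono (g e ne))

module Scan {n : ℕ} {H : Graph n} {s : State} {u v : Fin n}
            (n≡ : registers s rN ≡ n) (rows : Rows n n (arrays s aRow)) (nonEdges : NonEdges H (arrays s aAdj))
            (u≡ : registers s rU ≡ toℕ u) (v≡ : registers s rV ≡ toℕ v) (uv : LexFirst H u v) where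

  I : ℕ → State → Set
  I i s′ = QueueAt H s′ × GrowsAt s s′ × (∀ z → toℕ z < i → Forced H (arrays s′ aArc) u v z)

  -- At most one of the two forcing steps through `w` can apply to `(u , v)`. Hence the presence of
  -- the single arc that was picked settles all of `Forced`.
  Choice : Fin n → State → Set
  Choice w s′ = Σ[ x ∈ Fin n ] Σ[ y ∈ Fin n ]
    ( registers s′ rX ≡ toℕ x × registers s′ rY ≡ toℕ y × Forces H u v x y
    × (∀ {D} → D (cell x y) ≢ 0 → Forced H D u v w) × I (toℕ w) s′ × Rows n n (arrays s′ aRow))

  bodyTime : ℕ
  bodyTime = 4 + (24 + pushTime)

  body : ∀ (w : Fin n) s′ → registers s′ rW ≡ toℕ w → Frame scan s s′ → I (toℕ w) s′ →
         Run scanBody s′ bodyTime (I (suc (toℕ w)))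
  body w s′ w≡ f inv = assign-then (assign-then (run-seq {Q = Choice w} run-choose λ s₂ _ → add s₂))
    where
    rows′ : Rows n n (arrays s′ aRow)
    rows′ = subst (Rows n n) (sym (array f aRow)) rows
    nonEdges′ : NonEdges H (arrays s′ aAdj)
    nonEdges′ = subst (NonEdges H) (sym (array f aAdj)) nonEdges
    u≡′ = trans (register f rU) u≡
    v≡′ = trans (register f rV) v≡
    uw : arrays s′ aRow (registers s′ rU) + registers s′ rW ≡ cell u w
    uw = row-cell {A = arrays s′ aRow} rows′ u w u≡′ w≡
    vw : arrays s′ aRow (registers s′ rV) + registers s′ rW ≡ cell v w
    vw = row-cell {A = arrays s′ aRow} rows′ v w v≡′ w≡
    A = arrays s′ aAdj
    edge : ∀ {c x y} → c ≡ cell x y → A c ≡ 0 → Edge H x y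
    edge c≡ eq = nonEdges-zero {H = H} {A} nonEdges′ (trans (cong A (sym c≡)) eq)
    nonEdge : ∀ {c x y} → c ≡ cell x y → A c ≢ 0 → ¬ Edge H x y
    nonEdge c≡ ≢0 = nonEdges-nonzero {H = H} {A} nonEdges′ (λ eq → ≢0 (trans (cong A c≡) eq))
    run-choose : Run choose (setRegister (setRegister s′ rX (registers s′ rU)) rY (registers s′ rV)) 24 (Choice w)
    run-choose = run-if
      (λ uw-edge → run-if
        (λ vw-edge → run-skip (u , v , u≡′ , v≡′ , here
          , (λ _ → (λ _ ¬vw → contradiction (edge vw vw-edge) ¬vw) , (λ _ ¬uw → contradiction (edge uw uw-edge) ¬uw))
          , inv , rows′))
        (λ vw-non → run-assign (u , w , u≡′ , w≡ , tail here (edge uw uw-edge) (nonEdge vw vw-non)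
          , (λ ≢0 → (λ _ _ → ≢0) , (λ _ ¬uw → contradiction (edge uw uw-edge) ¬uw))
          , inv , rows′)))
      (λ uw-non → run-if
        (λ vw-edge → run-assign (w , v , w≡ , v≡′ , head here (edge-sym H (edge vw vw-edge)) (nonEdge uw uw-non)
          , (λ ≢0 → (λ e _ → contradiction e (nonEdge uw uw-non)) , (λ _ _ → ≢0))
          , inv , rows′))
        (λ vw-non → run-skip (u , v , u≡′ , v≡′ , here
          , (λ _ → (λ e _ → contradiction e (nonEdge uw uw-non)) , (λ e _ → contradiction (edge-sym H e) (nonEdge vw vw-non)))
          , inv , rows′)))
    add : ∀ s₂ → Choice w s₂ → Run push s₂ pushTime (I (suc (toℕ w)))
    add s₂ (x , y , x≡ , y≡ , uv~xy , cover , (q , g , done) , rows₂) =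
      run-mono ≤-refl after (run-push rows₂ x≡ y≡ q (lexFirst-forces uv uv~xy))
      where
      after : ∀ s₃ → _ → QueueAt H s₃ × GrowsAt s₂ s₃ × arrays s₃ aArc (cell x y) ≢ 0 → I (suc (toℕ w)) s₃
      after s₃ _ (q₃ , g₃ , ≢0) = q₃ , grows-trans g g₃ , done′
        where
        done′ : ∀ z → toℕ z < suc (toℕ w) → Forced H (arrays s₃ aArc) u v z
        done′ z z< with z Fin.≟ w
        ... | yes refl = cover {arrays s₃ aArc} ≢0
        ... | no z≢w   = forced-mono {H = H} {arrays s₂ aArc} (λ {c} → Grows.arcs g₃ {c}) (done z (≤∧≢⇒< (≤-pred z<) (z≢w ∘ Fin.toℕ-injective)))

  run-scan : QueueAt H s → Run scan s (forTime n (reg rN) bodyTime)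
    (λ s′ → QueueAt H s′ × GrowsAt s s′ × (∀ z → Forced H (arrays s′ aArc) u v z))
  run-scan q = run-mono ≤-refl (λ _ _ (q′ , g , done) → q′ , g , λ z → done z (Fin.toℕ<n z))
    (run-for n I (λ f → trans (register f rN) n≡) id body (q , grows-refl , λ _ ()))

record Search {n} (H : Graph n) (D qx qy : ℕ → ℕ) (hd tl a b : ℕ) : Set where
  field
    queue  : Queue H D qx qy tl
    hd≤tl  : hd ≤ tl
    closed : ∀ {i x y} → i < hd → qx i ≡ toℕ x → qy i ≡ toℕ y → ∀ z → Forced H D x y z
    -- Conditional because for `n = 0` the starting position `b = 0` is already out of range.
    b<n    : a < n → b < n
    seeded : ∀ {x y} → cell x y < n * a + b → Edge H x y → D (cell x y) ≢ 0 ⊎ D (cell y x) ≢ 0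

module _ {n : ℕ} {H : Graph n} {D qx qy : ℕ → ℕ} {tl : ℕ} (q : Queue H D qx qy tl)
         (closed : ∀ {i x y} → i < tl → qx i ≡ toℕ x → qy i ≡ toℕ y → ∀ z → Forced H D x y z) where

  -- Once every queued arc has been scanned, the arcs found form a union of whole implication
  -- classes.
  arcs-closed : ∀ {x y x′ y′} → Forces H x y x′ y′ → D (cell x y) ≢ 0 → D (cell x′ y′) ≢ 0
  arcs-closed here ≢0 = ≢0
  arcs-closed (tail {a} {b} f e ne) ≢0 with Queue.found q {a} {b} (arcs-closed f ≢0)
  ... | i , i< , a≡ , b≡ = proj₁ (closed i< a≡ b≡ _) e ne
  arcs-closed (head {a} {b} f e ne) ≢0 with Queue.found q {a} {b} (arcs-closed f ≢0)
  ... | i , i< , a≡ , b≡ = proj₂ (closed i< a≡ b≡ _) e ne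

  -- If the class of `(a , b)` or its reversal contained an earlier cell, that edge would already
  -- have an arc in one direction, and closure would have carried this arc to `(a , b)` or
  -- `(b , a)`.
  seed-lexFirst : ∀ {a b} → Edge H a b → D (cell a b) ≡ 0 → D (cell b a) ≡ 0 →
    (∀ {x y} → cell x y < cell a b → Edge H x y → D (cell x y) ≢ 0 ⊎ D (cell y x) ≢ 0) →
    LexFirst H a b
  seed-lexFirst {a} {b} e ab ba before = record
    { edge = e ; seed-edge = e ; seed = here ; smallest = λ f → low f , low′ f }
    where
    low : ∀ {x y} → Forces H a b x y → cell a b ≤ cell x y
    low {x} {y} f with cell a b ≤? cell x y
    ... | yes le = le
    ... | no ≰ with before (≰⇒> ≰) (forces-edge e f)
    ...   | inj₁ ≢0 = contradiction ab (arcs-closed (forces-sym e f) ≢0)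
    ...   | inj₂ ≢0 = contradiction ba (arcs-closed (forces-reverse (forces-sym e f)) ≢0)
    low′ : ∀ {x y} → Forces H a b x y → cell a b ≤ cell y x
    low′ {x} {y} f with cell a b ≤? cell y x
    ... | yes le = le
    ... | no ≰ with before (≰⇒> ≰) (edge-sym H (forces-edge e f))
    ...   | inj₁ ≢0 = contradiction ba (arcs-closed (forces-reverse (forces-sym e f)) ≢0)
    ...   | inj₂ ≢0 = contradiction ab (arcs-closed (forces-sym e f) ≢0)

SearchAt : ∀ {n} → Graph n → State → Set
SearchAt H s = Search H (arrays s aArc) (arrays s aQueueX) (arrays s aQueueY)
                        (registers s rHead) (registers s rTail) (registers s rA) (registers s rB)

OrientedBy : ∀ {n} → Graph n → (ℕ → ℕ) → Set
OrientedBy H D = IsTransitiveOrientation H (λ u v → D (cell u v) ≡ 1) × (∀ c → D c ≤ 1)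

-- Every edge has an arc in some direction. For a `LexFirst` pair the reversed arc is excluded by
-- asymmetry, so the arcs found are exactly the lexicographic orientation.
search-complete : ∀ {n} {H : Graph n} {_⟶_ : Fin n → Fin n → Set} {D qx qy hd tl a b} →
  IsTransitiveOrientation H _⟶_ → Search H D qx qy hd tl a b → n ≤ a → OrientedBy H D
search-complete {n} {H} {D = D} {a = a} {b} F search n≤a = oriented , binary
  where
  open Search search
  open Queue queue
  open LexOrientation F
  L : ∀ {u v} → D (cell u v) ≡ 1 → LexFirst H u v
  L eq = lexFirst λ eq′ → contradiction (trans (sym eq) eq′) λ ()
  both : ∀ {u v} → Edge H u v → D (cell u v) ≢ 0 ⊎ D (cell v u) ≢ 0
  both {u} {v} = seeded {u} {v} (<-≤-trans (Fin.toℕ<n (combine u v)) (≤-trans (*-monoʳ-≤ n n≤a) (m≤m+n (n * a) b)))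
  one : ∀ {c} → D c ≢ 0 → D c ≡ 1
  one {c} ≢0 = ≤-antisym (binary c) (n≢0⇒n>0 ≢0)
  total : ∀ {u v} → Edge H u v → LexFirst H u v ⊎ LexFirst H v u
  total {u} {v} e with both e
  ... | inj₁ ≢0 = inj₁ (lexFirst ≢0)
  ... | inj₂ ≢0 = inj₂ (lexFirst ≢0)
  arc : ∀ {u v} → LexFirst H u v → D (cell u v) ≡ 1
  arc {u} {v} l with both (LexFirst.edge l)
  ... | inj₁ ≢0 = one ≢0
  ... | inj₂ ≢0 = contradiction (lexFirst ≢0) (lexFirst-asym l)
  open IsTransitiveOrientation (lexFirst-orientation total) using (transitive)
  oriented : IsTransitiveOrientation H (λ u v → D (cell u v) ≡ 1)
  oriented = record
    { ⟶⇒edge     = λ uv → LexFirst.edge (L uv)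
    ; edge⇒⟶     = λ e → case both e of λ { (inj₁ ≢0) → inj₁ (one ≢0) ; (inj₂ ≢0) → inj₂ (one ≢0) }
    ; asymmetric = λ uv vu → lexFirst-asym (L uv) (L vu)
    ; transitive = λ uv vw → arc (transitive (L uv) (L vw))
    }

-- 18 for the threefold test, then the two assignments with the push or `skip`, and 15 for
-- `advance`.
seedTime : ℕ
seedTime = 18 + (4 + pushTime + 1) + 15

popTime stepTime orientTime : ℕ → ℕ
popTime n = 10 + forTime n (reg rN) (4 + (24 + pushTime))
stepTime n = suc (3 + (seedTime + popTime n))
orientTime n = 8 + suc (n * n + n * n) * (8 + stepTime n)

module Orient {n : ℕ} {H : Graph n} {_⟶_ : Fin n → Fin n → Set} (F : IsTransitiveOrientation H _⟶_) {s₀ : State}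
              (n≡ : registers s₀ rN ≡ n) (rows : Rows n n (arrays s₀ aRow)) (nonEdges : NonEdges H (arrays s₀ aAdj))
              (blank : ∀ c → arrays s₀ aArc c ≡ 0) where

  step : Program
  step = ifz reg rTail ⊖ reg rHead then (seed ⨾ advance) else pop

  -- Each step moves on either the seed position or the head of the queue, and neither passes
  -- `n * n`. With a linear scan charged to every step, the phase is cubic.
  μ : State → ℕ
  μ s = (n * n ∸ (n * registers s rA + registers s rB)) + (n * n ∸ registers s rHead)

  module _ {s} (n≡′ : registers s rN ≡ n) (rows′ : Rows n n (arrays s aRow))
           (nonEdges′ : NonEdges H (arrays s aAdj)) (search : SearchAt H s) where

    open Search search

    private
      D  = arrays s aArc
      qx = arrays s aQueueX
      qy = arrays s aQueueY
      hd = registers s rHead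
      tl = registers s rTail
      a  = registers s rA
      b  = registers s rB

    run-pop : tl ∸ hd ≢ 0 → Run pop s (popTime n) (λ s′ → SearchAt H s′ × μ s′ < μ s)
    run-pop ≢0 with Queue.queued queue (m∸n≢0⇒n<m ≢0)
    ... | u , v , u≡ , v≡ , arc = assign-then (assign-then (assign-then (run-mono ≤-refl after
            (Scan.run-scan n≡′ rows′ nonEdges′ u≡ v≡ (Queue.lexFirst queue {u} {v} arc) queue))))
      where
      hd<tl : hd < tl
      hd<tl = m∸n≢0⇒n<m ≢0
      s₁ : State
      s₁ = setRegister (setRegister (setRegister s rU (qx hd)) rV (qy hd)) rHead (hd + 1)
      after : ∀ s′ → Frame scan s₁ s′ →
        QueueAt H s′ × GrowsAt s₁ s′ × (∀ z → Forced H (arrays s′ aArc) u v z) → SearchAt H s′ × μ s′ < μ s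
      after s′ f′ (q′ , g , forced) = record
        { queue  = q′
        ; hd≤tl  = subst (_≤ registers s′ rTail) (sym hd′) (≤-trans hd<tl (Grows.tl≤ g))
        ; closed = closed′
        ; b<n    = subst (λ a → a < n → registers s′ rB < n) (sym (register f′ rA)) (subst (λ b → a < n → b < n) (sym (register f′ rB)) b<n)
        ; seeded = λ {x} {y} → seeded′ {x} {y}
        } , less
        where
        hd′ : registers s′ rHead ≡ suc hd
        hd′ = trans (register f′ rHead) (+-comm hd 1)
        closed′ : ∀ {i x y} → i < registers s′ rHead → arrays s′ aQueueX i ≡ toℕ x → arrays s′ aQueueY i ≡ toℕ y →
                  ∀ z → Forced H (arrays s′ aArc) x y z
        closed′ {i} {x} {y} i< x≡ y≡ with i ≟ hd
        ... | no i≢hd = λ z → forced-mono {H = H} {D} (λ {c} → Grows.arcs g {c}) (closed i<hd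
                (trans (sym (Grows.oldx g (<-trans i<hd hd<tl))) x≡) (trans (sym (Grows.oldy g (<-trans i<hd hd<tl))) y≡) z)
          where
          i<hd : i < hd
          i<hd = ≤∧≢⇒< (≤-pred (subst (i <_) hd′ i<)) i≢hd
        ... | yes refl
          with Fin.toℕ-injective (trans (sym x≡) (trans (Grows.oldx g hd<tl) u≡))
             | Fin.toℕ-injective (trans (sym y≡) (trans (Grows.oldy g hd<tl) v≡))
        ...   | refl | refl = forced
        σ≡ : n * registers s′ rA + registers s′ rB ≡ n * a + b
        σ≡ = cong₂ (λ a b → n * a + b) (register f′ rA) (register f′ rB)
        seeded′ : ∀ {x y} → cell x y < n * registers s′ rA + registers s′ rB → Edge H x y →
                  arrays s′ aArc (cell x y) ≢ 0 ⊎ arrays s′ aArc (cell y x) ≢ 0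
        seeded′ {x} {y} lt e with seeded (subst (cell x y <_) σ≡ lt) e
        ... | inj₁ ≢0 = inj₁ (Grows.arcs g ≢0)
        ... | inj₂ ≢0 = inj₂ (Grows.arcs g ≢0)
        less : μ s′ < μ s
        less rewrite σ≡ | hd′ = +-monoʳ-< (n * n ∸ (n * a + b))
          (∸-monoʳ-< (n<1+n hd) (≤-trans hd<tl (queue-length queue)))

    Seeded : State → Set
    Seeded s′ = QueueAt H s′ × GrowsAt s s′
      × (∀ {x y} → cell x y < suc (n * a + b) → Edge H x y →
           arrays s′ aArc (cell x y) ≢ 0 ⊎ arrays s′ aArc (cell y x) ≢ 0)

    module _ (a<n : a < n) (tl≡hd : tl ≡ hd) where

      private
        A B : Fin n
        A = fromℕ< a<n
        B = fromℕ< (b<n a<n)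
        A≡ : a ≡ toℕ A
        A≡ = sym (Fin.toℕ-fromℕ< a<n)
        B≡ : b ≡ toℕ B
        B≡ = sym (Fin.toℕ-fromℕ< (b<n a<n))
        σ≡ : cell A B ≡ n * a + b
        σ≡ = trans (Fin.toℕ-combine A B) (sym (cong₂ (λ a b → n * a + b) A≡ B≡))
        ab : arrays s aRow a + b ≡ cell A B
        ab = row-cell {A = arrays s aRow} rows′ A B A≡ B≡
        ba : arrays s aRow b + a ≡ cell B A
        ba = row-cell {A = arrays s aRow} rows′ B A B≡ A≡
        adjacent = arrays s aAdj (arrays s aRow a + b)
        forward  = D (arrays s aRow a + b)
        backward = D (arrays s aRow b + a)

        seeded-from : (D′ : ℕ → ℕ) → (∀ {c} → D c ≢ 0 → D′ c ≢ 0) →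
          (Edge H A B → D′ (cell A B) ≢ 0 ⊎ D′ (cell B A) ≢ 0) →
          ∀ {x y} → cell x y < suc (n * a + b) → Edge H x y → D′ (cell x y) ≢ 0 ⊎ D′ (cell y x) ≢ 0
        seeded-from D′ mono new {x} {y} lt e = split (cell x y ≟ cell A B)
          where
          split : Dec (cell x y ≡ cell A B) → D′ (cell x y) ≢ 0 ⊎ D′ (cell y x) ≢ 0
          split (yes c≡) with cell-injective {i = x} {A} {y} {B} c≡
          ... | refl , refl = new e
          split (no c≢) with seeded (≤∧≢⇒< (≤-pred lt) (λ eq → c≢ (trans eq (sym σ≡)))) e
          ... | inj₁ ≢0 = inj₁ (mono ≢0)
          ... | inj₂ ≢0 = inj₂ (mono ≢0)

      run-seed : Run seed s (18 + (4 + pushTime + 1)) Seeded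
      run-seed = run-if
        (λ eq → assign-then (assign-then (run-mono ≤-refl
          (λ s′ _ (q′ , g , ≢0) → q′ , g , λ {x} {y} → seeded-from (arrays s′ aArc) (Grows.arcs g) (λ _ → inj₁ ≢0) {x} {y})
          (run-push rows′ A≡ B≡ queue (new eq)))))
        (λ ≢0 → run-skip (queue , grows-refl , λ {x} {y} → seeded-from D id (old ≢0) {x} {y}))
        where
        new : adjacent + forward + backward ≡ 0 → LexFirst H A B
        new eq = seed-lexFirst queue (λ i< → closed (subst (_ <_) tl≡hd i<))
          (nonEdges-zero {H = H} {arrays s aAdj} nonEdges′ (trans (cong (arrays s aAdj) (sym ab)) (m+n≡0⇒m≡0 adjacent eq′)))
          (trans (cong D (sym ab)) (m+n≡0⇒n≡0 adjacent eq′))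
          (trans (cong D (sym ba)) (m+n≡0⇒n≡0 (adjacent + forward) eq))
          (λ {x} {y} lt → seeded (subst (cell x y <_) σ≡ lt))
          where eq′ = m+n≡0⇒m≡0 (adjacent + forward) eq
        old : adjacent + forward + backward ≢ 0 → Edge H A B → D (cell A B) ≢ 0 ⊎ D (cell B A) ≢ 0
        old ≢0 e with D (cell A B) ≟ 0 | D (cell B A) ≟ 0
        ... | no ≢  | _     = inj₁ ≢
        ... | yes _ | no ≢  = inj₂ ≢
        ... | yes z | yes z′ = contradiction (cong₂ _+_ (cong₂ _+_ zero-adj (trans (cong D ab) z)) (trans (cong D ba) z′)) ≢0
          where
          zero-adj : adjacent ≡ 0
          zero-adj with adjacent ≟ 0
          ... | yes z = z
          ... | no ≢  = contradiction e (nonEdges-nonzero {H = H} {arrays s aAdj} nonEdges′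
                          (λ eq → ≢ (trans (cong (arrays s aAdj) ab) eq)))

      run-advance : ∀ {s′} → Frame seed s s′ → Seeded s′ →
        Run advance s′ 15 (λ s″ → SearchAt H s″ × μ s″ < μ s)
      run-advance {s′} f′ (q′ , g , seeded′) = assign-then (run-if
        (λ eq → assign-then (run-assign (wrap (≤-antisym (m∸n≡0⇒m≤n (trans (cong (_∸ b′) (sym n≡″)) eq)) b′≤n))))
        (λ ≢0 → run-skip (next (≰⇒> λ n≤ → ≢0 (trans (cong (_∸ b′) n≡″) (m≤n⇒m∸n≡0 n≤))))))
        where
        b′ = registers s′ rB + 1
        n≡″ : registers s′ rN ≡ n
        n≡″ = trans (register f′ rN) n≡′
        b′≡ : b′ ≡ suc b
        b′≡ = trans (+-comm _ 1) (cong suc (register f′ rB))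
        b′≤n : b′ ≤ n
        b′≤n = subst (_≤ n) (sym b′≡) (b<n a<n)
        D′ = arrays s′ aArc
        Goal : ℕ → ℕ → Set
        Goal a″ b″ = Search H D′ (arrays s′ aQueueX) (arrays s′ aQueueY) (registers s′ rHead) (registers s′ rTail) a″ b″
          × (n * n ∸ (n * a″ + b″)) + (n * n ∸ registers s′ rHead) < μ s
        goal : ∀ {a″ b″} → n * a″ + b″ ≡ suc (n * a + b) → (a″ < n → b″ < n) → Goal a″ b″
        goal {a″} {b″} σ″ b″<n = record
          { queue  = q′
          ; hd≤tl  = subst (_≤ registers s′ rTail) (sym hd′) (≤-trans hd≤tl (Grows.tl≤ g))
          ; closed = λ i< x≡ y≡ z → closed′ (subst (_ <_) hd′ i<) x≡ y≡ z
          ; b<n    = b″<n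
          ; seeded = λ {x} {y} lt → seeded′ (subst (cell x y <_) σ″ lt)
          } , less
          where
          hd′ : registers s′ rHead ≡ hd
          hd′ = register f′ rHead
          closed′ : ∀ {i x y} → i < hd → arrays s′ aQueueX i ≡ toℕ x → arrays s′ aQueueY i ≡ toℕ y →
                    ∀ z → Forced H D′ x y z
          closed′ i< x≡ y≡ z = forced-mono {H = H} {D} (λ {c} → Grows.arcs g {c}) (closed i<
            (trans (sym (Grows.oldx g (<-≤-trans i< hd≤tl))) x≡) (trans (sym (Grows.oldy g (<-≤-trans i< hd≤tl))) y≡) z)
          less : (n * n ∸ (n * a″ + b″)) + (n * n ∸ registers s′ rHead) < μ s
          less rewrite σ″ | hd′ = +-monoˡ-< (n * n ∸ hd) (∸-monoʳ-< (n<1+n _)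
            (subst (_< n * n) σ≡ (Fin.toℕ<n (combine A B))))
        next : b′ < n → Goal (registers s′ rA) b′
        next b′<n = goal (trans (cong₂ (λ a b → n * a + b) (register f′ rA) b′≡) (+-suc (n * a) b)) (λ _ → b′<n)
        wrap : n ≡ b′ → Goal (registers s′ rA + 1) 0
        wrap n≡b′ = goal (begin
            n * (registers s′ rA + 1) + 0  ≡⟨ +-identityʳ _ ⟩
            n * (registers s′ rA + 1)      ≡⟨ cong (n *_) (trans (+-comm _ 1) (cong suc (register f′ rA))) ⟩
            n * suc a                      ≡⟨ *-suc n a ⟩
            n + n * a                      ≡⟨ +-comm n (n * a) ⟩
            n * a + n                      ≡⟨ cong (n * a +_) (trans n≡b′ b′≡) ⟩
            n * a + suc b                  ≡⟨ +-suc (n * a) b ⟩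
            suc (n * a + b)                ∎) (λ _ → ≤-trans z<s (b<n a<n))
          where open ≡-Reasoning

    run-step : (registers s rN ∸ a) + (tl ∸ hd) ≢ 0 → Run step s (stepTime n) (λ s′ → SearchAt H s′ × μ s′ < μ s)
    run-step ≢0 = run-if
      (λ empty → let a<n = a<n empty ; tl≡hd = ≤-antisym (m∸n≡0⇒m≤n empty) hd≤tl in
         run-seq (run-seed a<n tl≡hd) (λ _ → run-advance a<n tl≡hd))
      run-pop
      where
      a<n : tl ∸ hd ≡ 0 → a < n
      a<n empty = ≰⇒> λ n≤a → ≢0 (cong₂ _+_ (trans (cong (_∸ a) n≡′) (m≤n⇒m∸n≡0 n≤a)) empty)

  run-orient : Run orient s₀ (orientTime n) (λ s′ → OrientedBy H (arrays s′ aArc))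
  run-orient = assign-then (assign-then (assign-then (assign-then (run-mono bound
    (λ s′ f (search , ≡0) → search-complete F search (n≤a s′ f (m+n≡0⇒m≡0 _ ≡0)))
    (run-whileᶠ {T₁ = stepTime n} (SearchAt H) μ (λ s f → run-step (trans (register f rN) n≡) (subst (Rows n n) (sym (array f aRow)) rows)
      (subst (NonEdges H) (sym (array f aAdj)) nonEdges)) start)))))
    where
    s₁ : State
    s₁ = setRegister (setRegister (setRegister (setRegister s₀ rHead 0) rTail 0) rA 0) rB 0
    n≤a : ∀ s′ → Frame _ s₁ s′ → registers s′ rN ∸ registers s′ rA ≡ 0 → n ≤ registers s′ rA
    n≤a s′ f ≡0 = m∸n≡0⇒m≤n (trans (cong (_∸ registers s′ rA) (sym (trans (register f rN) n≡))) ≡0)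
    start : SearchAt H s₁
    start = record
      { queue = record
        { lexFirst = λ ≢0 → contradiction (blank _) ≢0
        ; binary = λ c → subst (_≤ 1) (sym (blank c)) z≤n
        ; queued = λ ()
        ; found = λ ≢0 → contradiction (blank _) ≢0
        ; distinct = λ ()
        }
      ; hd≤tl = z≤n
      ; closed = λ ()
      ; b<n = id
      ; seeded = λ {x} {y} lt → contradiction (subst (cell x y <_) (trans (+-identityʳ _) (*-zeroʳ n)) lt) λ ()
      }
    bound : suc (μ s₁) * (8 + stepTime n) ≤ suc (n * n + n * n) * (8 + stepTime n)
    bound = *-monoˡ-≤ (8 + stepTime n) (s≤s (+-mono-≤ (m∸n≤m (n * n) (n * 0 + 0)) (m∸n≤m (n * n) 0)))

-- Sums over vertices, in-degrees and the radices.

sum-cong : ∀ {n} {f g : Fin n → ℕ} → (∀ v → f v ≡ g v) → sum f ≡ sum g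
sum-cong {zero}  f≡g = refl
sum-cong {suc n} f≡g = cong₂ _+_ (f≡g fzero) (sum-cong (f≡g ∘ fsuc))

sum-mono-≤ : ∀ {n} {f g : Fin n → ℕ} → (∀ v → f v ≤ g v) → sum f ≤ sum g
sum-mono-≤ {zero}  f≤g = z≤n
sum-mono-≤ {suc n} f≤g = +-mono-≤ (f≤g fzero) (sum-mono-≤ (f≤g ∘ fsuc))

sum-mono-< : ∀ {n} {f g : Fin n → ℕ} → (∀ v → f v ≤ g v) → ∀ u → f u < g u → sum f < sum g
sum-mono-< f≤g fzero    lt = +-mono-<-≤ lt (sum-mono-≤ (f≤g ∘ fsuc))
sum-mono-< f≤g (fsuc u) lt = +-mono-≤-< (f≤g fzero) (sum-mono-< (f≤g ∘ fsuc) u lt)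

sum-≤1 : ∀ {n} {f : Fin n → ℕ} → (∀ v → f v ≤ 1) → sum f ≤ n
sum-≤1 {zero}  f≤1 = z≤n
sum-≤1 {suc n} f≤1 = +-mono-≤ (f≤1 fzero) (sum-≤1 (f≤1 ∘ fsuc))

-- Indexed by a natural number rather than an element of `Fin`, as required of a loop invariant.
prefixSum : ∀ {n} → (Fin n → ℕ) → ℕ → ℕ
prefixSum {zero}  f i       = 0
prefixSum {suc n} f zero    = 0
prefixSum {suc n} f (suc i) = f fzero + prefixSum (f ∘ fsuc) i

prefixSum-zero : ∀ {n} (f : Fin n → ℕ) → prefixSum f 0 ≡ 0
prefixSum-zero {zero}  f = refl
prefixSum-zero {suc n} f = refl

prefixSum-suc : ∀ {n} (f : Fin n → ℕ) v → prefixSum f (suc (toℕ v)) ≡ prefixSum f (toℕ v) + f v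
prefixSum-suc {suc n} f fzero    = trans (cong (f fzero +_) (prefixSum-zero (f ∘ fsuc))) (+-comm (f fzero) 0)
prefixSum-suc {suc n} f (fsuc v) =
  trans (cong (f fzero +_) (prefixSum-suc (f ∘ fsuc) v)) (sym (+-assoc (f fzero) _ _))

prefixSum-all : ∀ {n} (f : Fin n → ℕ) → prefixSum f n ≡ sum f
prefixSum-all {zero}  f = refl
prefixSum-all {suc n} f = cong (f fzero +_) (prefixSum-all (f ∘ fsuc))

rJ rWeight rOffset : ℕ
rJ      = 12
rWeight = 13
rOffset = 14

aRank aRadix aOffset aMul : ℕ
aRank   = 7
aRadix  = 8
aOffset = 9
aMul    = 10

-- The accumulator is not cleared first: radices start from 1, because a profit between 0 and its
-- total has one more possible value than the total.
accumulate : Expr → Program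
accumulate e = for rU (reg rN) (rAcc ≔ reg rAcc ⊕ e)

accumulateTime : ℕ → Expr → ℕ
accumulateTime n e = forTime n (reg rN) (3 + cost e)

run-accumulate : ∀ {n s e} (f : Fin n → ℕ) → registers s rN ≡ n →
  (∀ v s′ → Frame (accumulate e) s s′ → registers s′ rU ≡ toℕ v → eval s′ e ≡ f v) →
  Run (accumulate e) s (accumulateTime n e) (λ s′ → registers s′ rAcc ≡ registers s rAcc + sum f)
run-accumulate {n} {s} {e} f n≡ e≡ = run-mono ≤-refl
  (λ _ _ eq → trans eq (cong (registers s rAcc +_) (prefixSum-all f)))
  (run-for n I (λ fr → trans (register fr rN) n≡) id body
    (sym (trans (cong (registers s rAcc +_) (prefixSum-zero f)) (+-identityʳ _))))
  where
  I : ℕ → State → Set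
  I i s′ = registers s′ rAcc ≡ registers s rAcc + prefixSum f i
  body : ∀ (v : Fin n) s′ → registers s′ rU ≡ toℕ v → Frame (accumulate e) s s′ → I (toℕ v) s′ →
         Run (rAcc ≔ reg rAcc ⊕ e) s′ (3 + cost e) (I (suc (toℕ v)))
  body v s′ v≡ fr acc = run-assign (begin
    registers s′ rAcc + eval s′ e                  ≡⟨ cong₂ _+_ acc (e≡ v s′ fr v≡) ⟩
    registers s rAcc + prefixSum f (toℕ v) + f v   ≡⟨ +-assoc (registers s rAcc) _ _ ⟩
    registers s rAcc + (prefixSum f (toℕ v) + f v) ≡⟨ cong (registers s rAcc +_) (prefixSum-suc f v) ⟨
    registers s rAcc + prefixSum f (suc (toℕ v))   ∎)
    where open ≡-Reasoning

inDegree : ∀ {n} → (ℕ → ℕ) → Fin n → ℕ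
inDegree {n} D v = sum λ (u : Fin n) → D (cell u v)

module _ {n : ℕ} {H : Graph n} {D : ℕ → ℕ} (o : OrientedBy H D) where

  open IsTransitiveOrientation (proj₁ o)

  arc-01 : ∀ c → D c ≡ 0 ⊎ D c ≡ 1
  arc-01 c with D c | proj₂ o c
  ... | 0 | _ = inj₁ refl
  ... | 1 | _ = inj₂ refl
  ... | suc (suc _) | s≤s ()

  -- By transitivity every in-neighbour of `u` is one of `v`, and `u` itself is an additional one.
  inDegree-mono : ∀ {u v : Fin n} → D (cell u v) ≡ 1 → inDegree D u < inDegree D v
  inDegree-mono {u} {v} uv = sum-mono-< le u lt
    where
    le : ∀ (w : Fin n) → D (cell w u) ≤ D (cell w v)
    le w with arc-01 (cell w u)
    ... | inj₁ 0≡ = subst (_≤ D (cell w v)) (sym 0≡) z≤n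
    ... | inj₂ wu = ≤-reflexive (trans wu (sym (transitive {w} {u} {v} wu uv)))
    lt : D (cell u u) < D (cell u v)
    lt with arc-01 (cell u u)
    ... | inj₁ 0≡ = subst₂ _<_ (sym 0≡) (sym uv) (n<1+n 0)
    ... | inj₂ uu = contradiction uu (asymmetric {u} {u} uu)

  inDegree≤n : ∀ (v : Fin n) → inDegree D v ≤ n
  inDegree≤n v = sum-≤1 (λ u → proj₂ o (cell u v))

rankBody ranks : Program
rankBody = rAcc ≔ lit 0 ⨾ accumulate (aArc ⟦ rU ∙ rV ⟧) ⨾ aRank ⟦ reg rV ⟧≔ reg rAcc
ranks = for rV (reg rN) rankBody

rankTime : ℕ → ℕ
rankTime n = forTime n (reg rN) (2 + (accumulateTime n (aArc ⟦ rU ∙ rV ⟧) + 3))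

run-ranks : ∀ {n s} → registers s rN ≡ n → Rows n n (arrays s aRow) →
  Run ranks s (rankTime n) (λ s′ → ∀ v → arrays s′ aRank (toℕ v) ≡ inDegree {n} (arrays s aArc) v)
run-ranks {n} {s} n≡ rows = run-mono ≤-refl (λ _ _ I v → I v (Fin.toℕ<n v))
  (run-for n I (λ f → trans (register f rN) n≡) id body λ _ ())
  where
  D = arrays s aArc
  I : ℕ → State → Set
  I i s′ = ∀ v → toℕ v < i → arrays s′ aRank (toℕ v) ≡ inDegree {n} D v
  body : ∀ (v : Fin n) s′ → registers s′ rV ≡ toℕ v → Frame ranks s s′ → I (toℕ v) s′ →
         Run rankBody s′ (2 + (accumulateTime n (aArc ⟦ rU ∙ rV ⟧) + 3)) (I (suc (toℕ v)))
  body v s′ v≡ f inv = assign-then (run-seq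
    (run-accumulate (λ u → D (cell u v)) (trans (register f rN) n≡) column)
    λ s₂ f₂ acc → run-store (stored s₂ f₂ acc))
    where
    s₁ = setRegister s′ rAcc 0
    column : ∀ u s₂ → Frame (accumulate (aArc ⟦ rU ∙ rV ⟧)) s₁ s₂ → registers s₂ rU ≡ toℕ u →
             eval s₂ (aArc ⟦ rU ∙ rV ⟧) ≡ D (cell u v)
    column u s₂ f₂ u≡ = trans (cong (λ A → A _) (trans (array f₂ aArc) (array f aArc)))
      (cong D (row-cell {A = arrays s₂ aRow} (subst (Rows n n) (sym (trans (array f₂ aRow) (array f aRow))) rows)
        u v u≡ (trans (register f₂ rV) v≡)))
    stored : ∀ s₂ → Frame (accumulate (aArc ⟦ rU ∙ rV ⟧)) s₁ s₂ → registers s₂ rAcc ≡ inDegree D v →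
             ∀ w → toℕ w < suc (toℕ v) → (arrays s₂ aRank [ registers s₂ rV ↦ registers s₂ rAcc ]) (toℕ w) ≡ inDegree D w
    stored s₂ f₂ acc w w< with w Fin.≟ v
    ... | yes refl = trans (cong (λ r → (arrays s₂ aRank [ r ↦ registers s₂ rAcc ]) (toℕ v)) rv)
                       (trans (update-same (arrays s₂ aRank) (toℕ v) _) acc)
      where rv = trans (register f₂ rV) v≡
    ... | no w≢v = trans (update-other (arrays s₂ aRank) _ (λ eq → w≢v (Fin.toℕ-injective (trans eq rv))))
                     (trans (cong (λ A → A (toℕ w)) (array f₂ aRank)) (inv w (≤∧≢⇒< (≤-pred w<) (w≢v ∘ Fin.toℕ-injective))))
      where rv = trans (register f₂ rV) v≡

low≢high : ∀ {k} (i j : Fin k) → toℕ i ≢ k + toℕ j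
low≢high {k} i j = <⇒≢ (<-≤-trans (Fin.toℕ<n i) (m≤m+n k (toℕ j)))

radixBody radices : ℕ → Program
radixBody k =
  aRadix ⟦ reg rJ ⟧≔ reg rN ⊕ lit 1 ⨾
  rAcc ≔ lit 1 ⨾
  accumulate (aProfit ⟦ rJ ∙ rU ⟧) ⨾
  aRadix ⟦ lit k ⊕ reg rJ ⟧≔ reg rAcc
radices k = for rJ (lit k) (radixBody k)

radixTime : ℕ → ℕ → ℕ
radixTime k n = forTime k (lit k) (7 + (accumulateTime n (aProfit ⟦ rJ ∙ rU ⟧) + 5))

-- A last vertex has `n` values besides 0 for the empty class. The separate totals are used for the
-- profits, so the program never computes their maximum.
Radices : ∀ {k n} → Profits k n → (ℕ → ℕ) → Set
Radices {k} {n} p A = ∀ j → A (toℕ j) ≡ suc n × A (k + toℕ j) ≡ suc (sum (p j))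

run-radices : ∀ {k n s} (p : Profits k n) → registers s rN ≡ n → Rows n k (arrays s aRow) →
  (∀ j v → arrays s aProfit (cell j v) ≡ p j v) →
  Run (radices k) s (radixTime k n) (λ s′ → Radices p (arrays s′ aRadix))
run-radices {k} {n} {s} p n≡ rows p≡ = run-mono ≤-refl (λ _ _ I j → I j (Fin.toℕ<n j))
  (run-for k I (λ _ → refl) id body λ _ ())
  where
  I : ℕ → State → Set
  I i s′ = ∀ j → toℕ j < i → arrays s′ aRadix (toℕ j) ≡ suc n × arrays s′ aRadix (k + toℕ j) ≡ suc (sum (p j))
  body : ∀ (j : Fin k) s′ → registers s′ rJ ≡ toℕ j → Frame (radices k) s s′ → I (toℕ j) s′ →
         Run (radixBody k) s′ (7 + (accumulateTime n (aProfit ⟦ rJ ∙ rU ⟧) + 5)) (I (suc (toℕ j)))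
  body j s′ j≡ f inv = store-then (assign-then (run-seq
    (run-accumulate (p j) (trans (register f rN) n≡) row)
    λ s₂ f₂ acc → run-store (stored (array f₂ aRadix) j≡ (trans (+-comm _ 1) (cong suc (trans (register f rN) n≡)))
      (cong (k +_) (trans (register f₂ rJ) j≡)) acc)))
    where
    s₁ = setRegister (setCell s′ aRadix (registers s′ rJ) (registers s′ rN + 1)) rAcc 1
    row : ∀ u s₂ → Frame (accumulate (aProfit ⟦ rJ ∙ rU ⟧)) s₁ s₂ → registers s₂ rU ≡ toℕ u →
          eval s₂ (aProfit ⟦ rJ ∙ rU ⟧) ≡ p j u
    row u s₂ f₂ u≡ = trans (cong₂ (λ A c → A c) (trans (array f₂ aProfit) (array f aProfit))
      (row-cell {A = arrays s₂ aRow} (subst (Rows n k) (sym (trans (array f₂ aRow) (array f aRow))) rows)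
        j u (trans (register f₂ rJ) j≡) u≡)) (p≡ j u)
    stored : ∀ {A c d b e} → A ≡ arrays s′ aRadix [ c ↦ d ] → c ≡ toℕ j → d ≡ suc n → b ≡ k + toℕ j →
             e ≡ suc (sum (p j)) → ∀ i → toℕ i < suc (toℕ j) →
             (A [ b ↦ e ]) (toℕ i) ≡ suc n × (A [ b ↦ e ]) (k + toℕ i) ≡ suc (sum (p i))
    stored refl refl refl refl refl i i< with i Fin.≟ j
    ... | yes refl = trans (update-other A₁ _ (low≢high i j)) (update-same A (toℕ j) _) , update-same A₁ (k + toℕ j) _
      where
      A = arrays s′ aRadix
      A₁ = A [ toℕ j ↦ suc n ]
    ... | no i≢j with inv i (≤∧≢⇒< (≤-pred i<) (i≢j ∘ Fin.toℕ-injective))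
    ...   | lo , hi = trans (update-other A₁ _ (low≢high i j)) (trans (update-other A _ (i≢j ∘ Fin.toℕ-injective)) lo)
                    , trans (update-other A₁ _ (i≢j ∘ Fin.toℕ-injective ∘ +-cancelˡ-≡ k _ _))
                        (trans (update-other A _ (low≢high j i ∘ sym)) hi)
      where
      A = arrays s′ aRadix
      A₁ = A [ toℕ j ↦ suc n ]

-- Mixed radix notation

-- A x is the radix of digit x, which ranges over [0, A x).
weight : (ℕ → ℕ) → ℕ → ℕ
weight A zero    = 1
weight A (suc x) = A x * weight A x

encode : (ℕ → ℕ) → ℕ → (ℕ → ℕ) → ℕ
encode A zero    d = 0
encode A (suc x) d = encode A x d + d x * weight A x

encode-cong : ∀ A x {d d′ : ℕ → ℕ} → (∀ y → y < x → d y ≡ d′ y) → encode A x d ≡ encode A x d′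
encode-cong A zero    eq = refl
encode-cong A (suc x) eq = cong₂ _+_ (encode-cong A x λ y y< → eq y (m<n⇒m<1+n y<)) (cong (_* weight A x) (eq x (n<1+n x)))

+*-< : ∀ {a b w} → a < w → ∀ {c} → b < c → a + b * w < c * w
+*-< {a} {b} {w} a<w {c} b<c = <-≤-trans (+-monoˡ-< (b * w) a<w) (*-monoˡ-≤ w b<c)

encode-< : ∀ A x {d : ℕ → ℕ} → (∀ y → y < x → d y < A y) → encode A x d < weight A x
encode-< A zero    d< = n<1+n 0
encode-< A (suc x) d< = +*-< (encode-< A x λ y y< → d< y (m<n⇒m<1+n y<)) (d< x (n<1+n x))

-- Uniqueness of remainder and quotient modulo `w`.
+*-injective : ∀ {a a′ b b′ w} → a < w → a′ < w → a + b * w ≡ a′ + b′ * w → a ≡ a′ × b ≡ b′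
+*-injective {a} {a′} {b} {b′} {w} a< a′< eq with <-cmp b b′
... | tri≈ _ refl _ = +-cancelʳ-≡ (b * w) a a′ eq , refl
... | tri< b<b′ _ _ = contradiction eq (<⇒≢ (<-≤-trans (+*-< a< b<b′) (m≤n+m (b′ * w) a′)))
... | tri> _ _ b′<b = contradiction (sym eq) (<⇒≢ (<-≤-trans (+*-< a′< b′<b) (m≤n+m (b * w) a)))

encode-injective : ∀ A x {d d′ : ℕ → ℕ} → (∀ y → y < x → d y < A y) → (∀ y → y < x → d′ y < A y) →
                   encode A x d ≡ encode A x d′ → ∀ y → y < x → d y ≡ d′ y
encode-injective A (suc x) {d} {d′} d< d′< eq y y< with
  +*-injective {b = d x} {d′ x} (encode-< A x λ z z< → d< z (m<n⇒m<1+n z<)) (encode-< A x λ z z< → d′< z (m<n⇒m<1+n z<)) eq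
... | lo , hi with y ≟ x
...   | yes refl = hi
...   | no y≢x   = encode-injective A x (λ z z< → d< z (m<n⇒m<1+n z<)) (λ z z< → d′< z (m<n⇒m<1+n z<)) lo y
                     (≤∧≢⇒< (≤-pred y<) y≢x)

-- Block `x` of `aMul` lists the multiples of the weight of digit `x`, obtained by repeated
-- addition. After the last one the accumulator holds `A x * weight A x`, which is the weight of the
-- next digit.
mulRow : Program
mulRow =
  aOffset ⟦ reg rJ ⟧≔ reg rOffset ⨾
  rAcc ≔ lit 0 ⨾
  for rI (aRadix ⟦ reg rJ ⟧)
    ( aMul ⟦ reg rOffset ⊕ reg rI ⟧≔ reg rAcc ⨾
      rAcc ≔ reg rAcc ⊕ reg rWeight ) ⨾
  rOffset ≔ reg rOffset ⊕ aRadix ⟦ reg rJ ⟧ ⨾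
  rWeight ≔ reg rAcc

mulTable : ℕ → Program
mulTable m =
  rWeight ≔ lit 1 ⨾
  rOffset ≔ lit 0 ⨾
  for rJ (lit m) mulRow

mulTableTime : ℕ → ℕ → ℕ
mulTableTime m b = 4 + forTime m (lit m) (5 + (forTime b (aRadix ⟦ reg rJ ⟧) 9 + 7))

Products : ℕ → (A off mul : ℕ → ℕ) → Set
Products m A off mul = ∀ x → x < m → ∀ y → y < A x → mul (off x + y) ≡ y * weight A x

run-mulTable : ∀ {s} m b → (∀ x → x < m → arrays s aRadix x ≤ b) →
  Run (mulTable m) s (mulTableTime m b) (λ s′ → Products m (arrays s aRadix) (arrays s′ aOffset) (arrays s′ aMul))
run-mulTable {s} m b A≤b = assign-then (assign-then (run-mono ≤-refl (λ _ _ I → proj₂ (proj₂ I))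
  (run-for m I (λ _ → refl) id body (refl , (λ _ ()) , λ _ ()))))
  where
  A = arrays s aRadix
  s₀ = setRegister (setRegister s rWeight 1) rOffset 0
  -- Earlier blocks end at or before the current offset, so filling the present block does not
  -- overwrite them.
  Below : ℕ → (ℕ → ℕ) → ℕ → Set
  Below o off x = ∀ x′ → x′ < x → off x′ + A x′ ≤ o
  I : ℕ → State → Set
  I x s′ = registers s′ rWeight ≡ weight A x × Below (registers s′ rOffset) (arrays s′ aOffset) x
         × Products x A (arrays s′ aOffset) (arrays s′ aMul)
  fill : Program
  fill = aMul ⟦ reg rOffset ⊕ reg rI ⟧≔ reg rAcc ⨾ rAcc ≔ reg rAcc ⊕ reg rWeight
  body : ∀ (i : Fin m) s′ → registers s′ rJ ≡ toℕ i → Frame (for rJ (lit m) mulRow) s₀ s′ → I (toℕ i) s′ →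
         Run mulRow s′ (5 + (forTime b (aRadix ⟦ reg rJ ⟧) 9 + 7)) (I (suc (toℕ i)))
  body i s′ i≡ f (w≡ , below , prods) = store-then (assign-then (run-seq inner after))
    where
    x = toℕ i
    o = registers s′ rOffset
    w = registers s′ rWeight
    off′ : ℕ → ℕ
    off′ = arrays s′ aOffset [ registers s′ rJ ↦ o ]
    off-old : ∀ {x′} → x′ < x → off′ x′ ≡ arrays s′ aOffset x′
    off-old x′< = update-other (arrays s′ aOffset) o (λ eq → <⇒≢ x′< (trans eq i≡))
    off-new : off′ x ≡ o
    off-new = trans (cong (λ r → (arrays s′ aOffset [ r ↦ o ]) x) i≡) (update-same (arrays s′ aOffset) x o)
    s₁ = setRegister (setCell s′ aOffset (registers s′ rJ) o) rAcc 0
    loop′ = for rI (aRadix ⟦ reg rJ ⟧) fill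
    J : ℕ → State → Set
    J y s″ = registers s″ rAcc ≡ y * weight A x
           × (∀ y′ → y′ < y → arrays s″ aMul (o + y′) ≡ y′ * weight A x)
           × Products x A off′ (arrays s″ aMul)
    bound : ∀ {s″} → Frame loop′ s₁ s″ → arrays s″ aRadix (registers s″ rJ) ≡ A x
    bound f′ = cong₂ (λ B r → B r) (trans (array f′ aRadix) (array f aRadix)) (trans (register f′ rJ) i≡)
    step : ∀ (y : Fin (A x)) s″ → registers s″ rI ≡ toℕ y → Frame loop′ s₁ s″ → J (toℕ y) s″ →
           Run fill s″ 9 (J (suc (toℕ y)))
    step y s″ y≡ f′ (acc , row , old) = store-then (run-assign
      ( trans (cong₂ _+_ acc (trans (register f′ rWeight) w≡)) (+-comm _ (weight A x)) , row′ , old′))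
      where
      c≡ : registers s″ rOffset + registers s″ rI ≡ o + toℕ y
      c≡ = cong₂ _+_ (register f′ rOffset) y≡
      M = arrays s″ aMul
      row′ : ∀ y′ → y′ < suc (toℕ y) → (M [ _ ↦ _ ]) (o + y′) ≡ y′ * weight A x
      row′ y′ y′< with y′ ≟ toℕ y
      ... | yes refl = trans (cong (λ c → (M [ c ↦ registers s″ rAcc ]) (o + toℕ y)) c≡)
                         (trans (update-same M (o + toℕ y) _) acc)
      ... | no y′≢   = trans (update-other M _ (λ eq → y′≢ (+-cancelˡ-≡ o _ _ (trans eq c≡))))
                         (row y′ (≤∧≢⇒< (≤-pred y′<) y′≢))
      old′ : Products x A off′ (M [ _ ↦ _ ])
      old′ x′ x′< z z< = trans (update-other M _ (λ eq → <⇒≢ lt (trans eq c≡))) (old x′ x′< z z<)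
        where
        lt : off′ x′ + z < o + toℕ y
        lt = <-≤-trans (+-monoʳ-< (off′ x′) z<)
          (≤-trans (subst (λ q → q + A x′ ≤ o) (sym (off-old x′<)) (below x′ x′<)) (m≤m+n o (toℕ y)))
    inner : Run loop′ s₁ (forTime b (aRadix ⟦ reg rJ ⟧) 9) (J (A x))
    inner = run-mono (*-monoˡ-≤ _ (s≤s (A≤b x (Fin.toℕ<n i)))) (λ _ _ → id)
      (run-for (A x) J bound id step
        (refl , (λ _ ()) , λ x′ x′< z z< → trans (cong (λ q → arrays s′ aMul (q + z)) (off-old x′<)) (prods x′ x′< z z<)))
    after : ∀ s″ → Frame loop′ s₁ s″ → J (A x) s″ →
            Run (rOffset ≔ reg rOffset ⊕ aRadix ⟦ reg rJ ⟧ ⨾ rWeight ≔ reg rAcc) s″ 7 (I (suc x))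
    after s″ f′ (acc , row , old) = assign-then (run-assign (acc , below′ , prods′))
      where
      o′≡ : registers s″ rOffset + arrays s″ aRadix (registers s″ rJ) ≡ o + A x
      o′≡ = cong₂ _+_ (register f′ rOffset) (bound f′)
      off≡ : ∀ z → arrays s″ aOffset z ≡ off′ z
      off≡ z = cong (λ B → B z) (array f′ aOffset)
      below′ : ∀ x′ → x′ < suc x → arrays s″ aOffset x′ + A x′ ≤ registers s″ rOffset + arrays s″ aRadix (registers s″ rJ)
      below′ x′ x′< rewrite o′≡ | off≡ x′ with x′ ≟ x
      ... | yes refl = ≤-reflexive (cong (_+ A x) off-new)
      ... | no x′≢ = ≤-trans (subst (λ q → q + A x′ ≤ o) (sym (off-old x′<x)) (below x′ x′<x)) (m≤m+n o (A x))
        where x′<x = ≤∧≢⇒< (≤-pred x′<) x′≢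
      prods′ : ∀ x′ → x′ < suc x → ∀ y → y < A x′ → arrays s″ aMul (arrays s″ aOffset x′ + y) ≡ y * weight A x′
      prods′ x′ x′< y y< rewrite off≡ x′ with x′ ≟ x
      ... | yes refl = trans (cong (λ q → arrays s″ aMul (q + y)) off-new) (row y y<)
      ... | no x′≢ = old x′ (≤∧≢⇒< (≤-pred x′<) x′≢) y y<

-- Partial colorings and the states describing them

complement-edge : ∀ {n} (G : Graph n) {u v} → Edge (complement G) u v → ¬ Edge G u v
complement-edge G {u} {v} e e′ with adj G u v
... | true = e

edge-complement : ∀ {n} (G : Graph n) {u v} → u ≢ v → ¬ Edge G u v → Edge (complement G) u v
edge-complement G {u} {v} u≢v ¬e with adj G u v | u Fin.≟ v
... | _     | yes u≡v = contradiction u≡v u≢v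
... | true  | no _    = contradiction tt ¬e
... | false | no _    = tt

sum-change : ∀ {n} {f g : Fin n → ℕ} {d} v → (∀ w → w ≢ v → g w ≡ f w) → g v ≡ f v + d → sum g ≡ sum f + d
sum-change {f = f} {g} {d} fzero same new = begin
  g fzero + sum (g ∘ fsuc)     ≡⟨ cong₂ _+_ new (sum-cong λ w → same (fsuc w) λ ()) ⟩
  f fzero + d + sum (f ∘ fsuc) ≡⟨ eq (f fzero) d (sum (f ∘ fsuc)) ⟩
  f fzero + sum (f ∘ fsuc) + d ∎
  where
  open ≡-Reasoning
  eq : ∀ a b c → a + b + c ≡ a + c + b
  eq = solve-∀
sum-change {f = f} {g} {d} (fsuc v) same new = begin
  g fzero + sum (g ∘ fsuc)       ≡⟨ cong₂ _+_ (same fzero λ ())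
                                     (sum-change v (λ w w≢v → same (fsuc w) (w≢v ∘ Fin.suc-injective)) new) ⟩
  f fzero + (sum (f ∘ fsuc) + d) ≡⟨ +-assoc (f fzero) _ d ⟨
  f fzero + sum (f ∘ fsuc) + d   ∎
  where open ≡-Reasoning

<ᵇ-suc : ∀ a b → a ≢ b → (a <ᵇ suc b) ≡ (a <ᵇ b)
<ᵇ-suc zero    zero    a≢b = contradiction refl a≢b
<ᵇ-suc zero    (suc b) a≢b = refl
<ᵇ-suc (suc a) zero    a≢b = refl
<ᵇ-suc (suc a) (suc b) a≢b = <ᵇ-suc a b (a≢b ∘ cong suc)

<⇒<ᵇ≡true : ∀ {a b} → a < b → (a <ᵇ b) ≡ true
<⇒<ᵇ≡true lt = Equivalence.to T-≡ (<⇒<ᵇ lt)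

<ᵇ≡true⇒< : ∀ {a b} → (a <ᵇ b) ≡ true → a < b
<ᵇ≡true⇒< {a} {b} eq = <ᵇ⇒< a b (Equivalence.from T-≡ eq)

∧-true : ∀ {a b} → a ∧ b ≡ true → a ≡ true × b ≡ true
∧-true {true} eq = refl , eq

-- Boolean functions in place of vectors make insertion a pointwise disjunction; `lookup` and
-- `tabulate` translate at the end.
Coloring : ℕ → ℕ → Set
Coloring k n = Fin k → Fin n → Bool

value : ∀ {n} → (Fin n → ℕ) → (Fin n → Bool) → ℕ
value f Y = sum λ v → if Y v then f v else 0

value-cong : ∀ {n} (f : Fin n → ℕ) {Y Z} → (∀ v → Y v ≡ Z v) → value f Y ≡ value f Z
value-cong f Y≡Z = sum-cong λ v → cong (if_then f v else 0) (Y≡Z v)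

value-empty : ∀ {n} (f : Fin n → ℕ) {Y} → (∀ v → Y v ≡ false) → value f Y ≡ 0
value-empty {zero}  f empty = refl
value-empty {suc n} f empty = cong₂ _+_ (cong (if_then f fzero else 0) (empty fzero)) (value-empty (f ∘ fsuc) (empty ∘ fsuc))

value≤sum : ∀ {n} (f : Fin n → ℕ) Y → value f Y ≤ sum f
value≤sum f Y = sum-mono-≤ le
  where
  le : ∀ v → (if Y v then f v else 0) ≤ f v
  le v with Y v
  ... | true  = ≤-refl
  ... | false = z≤n

module _ {k n : ℕ} where

  insert : Fin k → Fin n → Coloring k n → Coloring k n
  insert j v Y i w = (does (i Fin.≟ j) ∧ does (w Fin.≟ v)) ∨ Y i w

  insert-new : ∀ j v Y → insert j v Y j v ≡ true
  insert-new j v Y with j Fin.≟ j | v Fin.≟ v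
  ... | yes _  | yes _  = refl
  ... | no j≢j | _      = contradiction refl j≢j
  ... | yes _  | no v≢v = contradiction refl v≢v

  insert-old : ∀ j v Y {i w} → Y i w ≡ true → insert j v Y i w ≡ true
  insert-old j v Y {i} {w} eq with does (i Fin.≟ j) ∧ does (w Fin.≟ v)
  ... | true  = refl
  ... | false = eq

  insert-inv : ∀ j v Y {i w} → insert j v Y i w ≡ true → (i ≡ j × w ≡ v) ⊎ Y i w ≡ true
  insert-inv j v Y {i} {w} eq with i Fin.≟ j | w Fin.≟ v
  ... | yes i≡j | yes w≡v = inj₁ (i≡j , w≡v)
  ... | yes _   | no _    = inj₂ eq
  ... | no _    | _       = inj₂ eq

  insert-class : ∀ {j} v Y {i} w → i ≢ j → insert j v Y i w ≡ Y i w
  insert-class {j} v Y {i} w i≢j with i Fin.≟ j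
  ... | yes i≡j = contradiction i≡j i≢j
  ... | no _    = refl

  insert-vertex : ∀ j {v} Y i {w} → w ≢ v → insert j v Y i w ≡ Y i w
  insert-vertex j {v} Y i {w} w≢v with i Fin.≟ j | w Fin.≟ v
  ... | _     | yes w≡v = contradiction w≡v w≢v
  ... | yes _ | no _    = refl
  ... | no _  | no _    = refl

  value-insert : ∀ f j v (Y : Coloring k n) → Y j v ≡ false → value f (insert j v Y j) ≡ value f (Y j) + f v
  value-insert f j v Y new = sum-change v
    (λ w w≢v → cong (if_then f w else 0) (insert-vertex j Y j w≢v))
    (trans (cong (if_then f v else 0) (insert-new j v Y)) (sym (cong (λ b → (if b then f v else 0) + f v) new)))

digit-cases : ∀ {k} x → x < k + k → (Σ[ j ∈ Fin k ] x ≡ toℕ j) ⊎ (Σ[ j ∈ Fin k ] x ≡ k + toℕ j)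
digit-cases {k} x x< with x <? k
... | yes x<k = inj₁ (fromℕ< x<k , sym (Fin.toℕ-fromℕ< x<k))
... | no x≮k  = inj₂ (fromℕ< lt , sym (trans (cong (k +_) (Fin.toℕ-fromℕ< lt)) (m+[n∸m]≡n (≮⇒≥ x≮k))))
  where
  lt : x ∸ k < k
  lt = +-cancelˡ-< k _ _ (subst (_< k + k) (sym (m+[n∸m]≡n (≮⇒≥ x≮k))) x<)

low<2k : ∀ {k} (j : Fin k) → toℕ j < k + k
low<2k {k} j = <-≤-trans (Fin.toℕ<n j) (m≤m+n k k)

high<2k : ∀ {k} (j : Fin k) → k + toℕ j < k + k
high<2k {k} j = +-monoʳ-< k (Fin.toℕ<n j)

record Valid {k n} (G : Graph n) (Y : Coloring k n) : Set where
  field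
    independent : ∀ {j w w′} → Y j w ≡ true → Y j w′ ≡ true → ¬ Edge G w w′
    disjoint    : ∀ {i j w} → Y i w ≡ true → Y j w ≡ true → i ≡ j

-- A state of the dynamic program is a list of 2k digits: digit j is one plus
-- the last vertex of class j (0 for an empty class), digit k + j its profit.
module States {k n : ℕ} (G : Graph n) (p : Profits k n) (D : ℕ → ℕ) (o : OrientedBy (complement G) D) where

  open IsTransitiveOrientation (proj₁ o)

  extend : (ℕ → ℕ) → Fin k → Fin n → ℕ → ℕ
  extend d j v = (d [ toℕ j ↦ suc (toℕ v) ]) [ k + toℕ j ↦ d (k + toℕ j) + p j v ]

  module _ (d : ℕ → ℕ) (j : Fin k) (v : Fin n) where

    private
      d₁ = d [ toℕ j ↦ suc (toℕ v) ]

    extend-last : extend d j v (toℕ j) ≡ suc (toℕ v)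
    extend-last = trans (update-other d₁ _ (low≢high j j)) (update-same d (toℕ j) _)

    extend-profit : extend d j v (k + toℕ j) ≡ d (k + toℕ j) + p j v
    extend-profit = update-same d₁ (k + toℕ j) _

    extend-last-other : ∀ {i} → i ≢ j → extend d j v (toℕ i) ≡ d (toℕ i)
    extend-last-other {i} i≢j = trans (update-other d₁ _ (low≢high i j)) (update-other d _ (i≢j ∘ Fin.toℕ-injective))

    extend-profit-other : ∀ {i} → i ≢ j → extend d j v (k + toℕ i) ≡ d (k + toℕ i)
    extend-profit-other {i} i≢j = trans (update-other d₁ _ (i≢j ∘ Fin.toℕ-injective ∘ +-cancelˡ-≡ k _ _))
      (update-other d _ (low≢high j i ∘ sym))

  -- Weak on purpose: a nonzero digit only has to name some member of the class. This is all that
  -- following an arbitrary coloring requires. That the member really is the last one is the field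
  -- `top` of `Sound`.
  record Describes (d : ℕ → ℕ) (Y : Coloring k n) : Set where
    field
      profit≡ : ∀ j → d (k + toℕ j) ≡ value (p j) (Y j)
      last    : ∀ j → d (toℕ j) ≡ 0 ⊎ Σ[ u ∈ Fin n ] (d (toℕ j) ≡ suc (toℕ u) × Y j u ≡ true)

  describes-cong : ∀ {d d′ Y Y′} → (∀ x → x < k + k → d′ x ≡ d x) → (∀ j w → Y′ j w ≡ Y j w) →
                   Describes d Y → Describes d′ Y′
  describes-cong {d} {d′} {Y} {Y′} d≡ Y≡ desc = record
    { profit≡ = λ j → trans (d≡ _ (high<2k j)) (trans (profit≡ j) (sym (value-cong (p j) (Y≡ j))))
    ; last    = last′
    }
    where
    open Describes desc
    last′ : ∀ j → d′ (toℕ j) ≡ 0 ⊎ Σ[ u ∈ Fin n ] (d′ (toℕ j) ≡ suc (toℕ u) × Y′ j u ≡ true)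
    last′ j with last j
    ... | inj₁ eq = inj₁ (trans (d≡ _ (low<2k j)) eq)
    ... | inj₂ (u , eq , Yu) = inj₂ (u , trans (d≡ _ (low<2k j)) eq , trans (Y≡ j u) Yu)

  describes-extend : ∀ {d Y j v} → Describes d Y → Y j v ≡ false → Describes (extend d j v) (insert j v Y)
  describes-extend {d} {Y} {j} {v} desc new = record { profit≡ = profit′ ; last = last′ }
    where
    open Describes desc
    profit′ : ∀ i → extend d j v (k + toℕ i) ≡ value (p i) (insert j v Y i)
    profit′ i = split (i Fin.≟ j)
      where
      split : Dec (i ≡ j) → extend d j v (k + toℕ i) ≡ value (p i) (insert j v Y i)
      split (yes refl) = trans (extend-profit d j v) (trans (cong (_+ p j v) (profit≡ j)) (sym (value-insert (p j) j v Y new)))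
      split (no i≢j)   = trans (extend-profit-other d j v i≢j)
                           (trans (profit≡ i) (value-cong (p i) (λ w → sym (insert-class v Y w i≢j))))
    last′ : ∀ i → extend d j v (toℕ i) ≡ 0 ⊎ Σ[ u ∈ Fin n ] (extend d j v (toℕ i) ≡ suc (toℕ u) × insert j v Y i u ≡ true)
    last′ i = split (i Fin.≟ j)
      where
      split : Dec (i ≡ j) → _
      split (yes refl) = inj₂ (v , extend-last d j v , insert-new j v Y)
      split (no i≢j) with last i
      ... | inj₁ eq = inj₁ (trans (extend-last-other d j v i≢j) eq)
      ... | inj₂ (u , eq , Yu) = inj₂ (u , trans (extend-last-other d j v i≢j) eq , insert-old j v Y Yu)

  describes-< : ∀ {A d Y} → Radices p A → Describes d Y → ∀ x → x < k + k → d x < A x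
  describes-< {A} {d} {Y} rad desc x x< with digit-cases {k} x x<
  ... | inj₂ (j , refl) rewrite proj₂ (rad j) | Describes.profit≡ desc j = s≤s (value≤sum (p j) (Y j))
  ... | inj₁ (j , refl) rewrite proj₁ (rad j) with Describes.last desc j
  ...   | inj₁ eq rewrite eq = z<s
  ...   | inj₂ (u , eq , _) rewrite eq = s≤s (Fin.toℕ<n u)

  Compatible : (ℕ → ℕ) → Fin k → Fin n → Set
  Compatible d j v = d (toℕ j) ≡ 0 ⊎ Σ[ u ∈ Fin n ] (d (toℕ j) ≡ suc (toℕ u) × D (cell u v) ≡ 1)

  record Sound (d : ℕ → ℕ) (Y : Coloring k n) : Set where
    field
      describes : Describes d Y
      valid     : Valid G Y
      top       : ∀ {j w} → Y j w ≡ true →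
                  Σ[ u ∈ Fin n ] (d (toℕ j) ≡ suc (toℕ u) × (w ≡ u ⊎ D (cell w u) ≡ 1))

  sound-cong : ∀ {d d′ Y} → (∀ x → x < k + k → d′ x ≡ d x) → Sound d Y → Sound d′ Y
  sound-cong d≡ sound = record
    { describes = describes-cong d≡ (λ _ _ → refl) describes
    ; valid     = valid
    ; top       = λ {j} Yw → case top Yw of λ { (u , eq , r) → u , trans (d≡ _ (low<2k j)) eq , r }
    }
    where open Sound sound

  -- By `top` and transitivity the arc from the last vertex to `v` spreads to all members of the
  -- class. That `v` lies in no class yet keeps the classes disjoint.
  sound-extend : ∀ {d Y j v} → Sound d Y → (∀ i → Y i v ≡ false) → Compatible d j v →
                 Sound (extend d j v) (insert j v Y)
  sound-extend {d} {Y} {j} {v} sound new compat = record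
    { describes = describes-extend describes (new j)
    ; valid     = record { independent = independent′ ; disjoint = disjoint′ }
    ; top       = top′
    }
    where
    open Sound sound
    open Valid valid
    below′ : ∀ {w} → Compatible d j v → Y j w ≡ true → D (cell w v) ≡ 1
    below′ (inj₁ eq′) Yw with top Yw
    ... | u , eq , _ = contradiction (trans (sym eq) eq′) λ ()
    below′ {w} (inj₂ (u′ , eq′ , uv)) Yw with top Yw
    ... | u , eq , wu with Fin.toℕ-injective (suc-injective (trans (sym eq) eq′)) | wu
    ...   | refl | inj₁ refl = uv
    ...   | refl | inj₂ wu′  = transitive {w} {u} {v} wu′ uv
    below : ∀ {w} → Y j w ≡ true → D (cell w v) ≡ 1
    below = below′ compat
    apart : ∀ {w} → Y j w ≡ true → ¬ Edge G w v
    apart {w} Yw = complement-edge G (⟶⇒edge {w} {v} (below Yw))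
    independent′ : ∀ {i w w′} → insert j v Y i w ≡ true → insert j v Y i w′ ≡ true → ¬ Edge G w w′
    independent′ Yw Yw′ with insert-inv j v Y Yw | insert-inv j v Y Yw′
    ... | inj₁ (refl , refl) | inj₁ (_ , refl) = edge-irrefl G
    ... | inj₁ (refl , refl) | inj₂ Yw′₁       = apart Yw′₁ ∘ edge-sym G
    ... | inj₂ Yw₁           | inj₁ (refl , refl) = apart Yw₁
    ... | inj₂ Yw₁           | inj₂ Yw′₁       = independent Yw₁ Yw′₁
    disjoint′ : ∀ {i i′ w} → insert j v Y i w ≡ true → insert j v Y i′ w ≡ true → i ≡ i′
    disjoint′ {i} {i′} Yi Yi′ with insert-inv j v Y Yi | insert-inv j v Y Yi′
    ... | inj₁ (refl , refl) | inj₁ (refl , _) = refl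
    ... | inj₁ (refl , refl) | inj₂ Yi′₁ = contradiction (trans (sym (new i′)) Yi′₁) λ ()
    ... | inj₂ Yi₁           | inj₁ (refl , refl) = contradiction (trans (sym (new i)) Yi₁) λ ()
    ... | inj₂ Yi₁           | inj₂ Yi′₁ = disjoint Yi₁ Yi′₁
    top′ : ∀ {i w} → insert j v Y i w ≡ true →
           Σ[ u ∈ Fin n ] (extend d j v (toℕ i) ≡ suc (toℕ u) × (w ≡ u ⊎ D (cell w u) ≡ 1))
    top′ {i} Yw with insert-inv j v Y Yw
    ... | inj₁ (refl , refl) = v , extend-last d j v , inj₁ refl
    ... | inj₂ Yw₁ with i Fin.≟ j
    ...   | yes refl = v , extend-last d j v , inj₂ (below Yw₁)
    ...   | no i≢j with top Yw₁
    ...     | u , eq , r = u , trans (extend-last-other d j v i≢j) eq , r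

  module Ordered (τ : Fin n → ℕ) (τ-injective : ∀ {u v} → τ u ≡ τ v → u ≡ v)
                 (τ-mono : ∀ {u v} → D (cell u v) ≡ 1 → τ u < τ v) where

    restrict : ℕ → Coloring k n → Coloring k n
    restrict c Y j w = Y j w ∧ (τ w <ᵇ c)

    restrict-skip : ∀ c Y j w → (τ w ≡ c → Y j w ≡ false) → restrict (suc c) Y j w ≡ restrict c Y j w
    restrict-skip c Y j w absent with τ w ≟ c
    ... | no τ≢c = cong (Y j w ∧_) (<ᵇ-suc (τ w) c τ≢c)
    ... | yes τ≡c rewrite absent τ≡c = refl

    restrict-insert : ∀ {Y j v} → Valid G Y → Y j v ≡ true →
                      ∀ i w → restrict (suc (τ v)) Y i w ≡ insert j v (restrict (τ v) Y) i w
    restrict-insert {Y} {j} {v} valid Yv i w = split (w Fin.≟ v) (i Fin.≟ j)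
      where
      split : Dec (w ≡ v) → Dec (i ≡ j) → restrict (suc (τ v)) Y i w ≡ insert j v (restrict (τ v) Y) i w
      split (yes refl) (yes refl) = trans (cong₂ _∧_ Yv (<⇒<ᵇ≡true (n<1+n (τ v)))) (sym (insert-new j v (restrict (τ v) Y)))
      split (yes refl) (no i≢j)   = trans (restrict-skip (τ v) Y i v λ _ → ¬-not λ Yi → i≢j (Valid.disjoint valid Yi Yv))
                                      (sym (insert-class v (restrict (τ v) Y) v i≢j))
      split (no w≢v)   _          = trans (restrict-skip (τ v) Y i w λ eq → contradiction (τ-injective eq) w≢v)
                                      (sym (insert-vertex j (restrict (τ v) Y) i w≢v))

    -- Two members of one class are joined by an arc in some direction, and only the arc from the
    -- earlier `u` to `v` agrees with `τ-mono`.
    compatible : ∀ {Y j v d} → Valid G Y → Y j v ≡ true → Describes d (restrict (τ v) Y) → Compatible d j v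
    compatible {Y} {j} {v} valid Yv desc with Describes.last desc j
    ... | inj₁ eq = inj₁ eq
    ... | inj₂ (u , eq , Yu) with ∧-true {Y j u} Yu
    ...   | Yu′ , τu< with edge⇒⟶ {u} {v} (edge-complement G u≢v (Valid.independent valid Yu′ Yv))
      where
      u≢v : u ≢ v
      u≢v refl = <-irrefl refl (<ᵇ≡true⇒< {τ v} {τ v} τu<)
    ...     | inj₁ uv = inj₂ (u , eq , uv)
    ...     | inj₂ vu = contradiction (<ᵇ≡true⇒< τu<) (<-asym (τ-mono {v} {u} vu))

    describes-insert : ∀ {Y j v d} → Valid G Y → Y j v ≡ true → Describes d (restrict (τ v) Y) →
                       Describes (extend d j v) (restrict (suc (τ v)) Y)
    describes-insert {Y} {j} {v} valid Yv desc = describes-cong (λ _ _ → refl) (restrict-insert valid Yv)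
      (describes-extend desc (¬-not λ r → <-irrefl refl (<ᵇ≡true⇒< {τ v} {τ v} (proj₂ (∧-true {Y j v} r)))))

module Tables {k n : ℕ} (G : Graph n) (p : Profits k n) (D : ℕ → ℕ) (o : OrientedBy (complement G) D)
              (A : ℕ → ℕ) (rad : Radices p A) where

  open States G p D o

  digits : (ℕ → ℕ) → ℕ → ℕ → ℕ
  digits S i x = S ((k + k) * i + x)

  key : (ℕ → ℕ) → ℕ → ℕ
  key S i = encode A (k + k) (digits S i)

  -- `X` is a ghost: memory holds only digits, parents and inserted cells, and `X i` is the coloring
  -- that the parent chain of state `i` spells out.
  record Table (S seen par cel : ℕ → ℕ) (len : ℕ) (X : ℕ → Coloring k n) : Set where
    field
      nonempty      : 0 < len
      root          : ∀ j w → X 0 j w ≡ false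
      sound         : ∀ {i} → i < len → Sound (digits S i) (X i)
      parent        : ∀ {i} → 0 < i → i < len → par i < i ×
                      Σ[ j ∈ Fin k ] Σ[ v ∈ Fin n ] (cel i ≡ cell j v × (∀ j′ w → X i j′ w ≡ insert j v (X (par i)) j′ w))
      distinct      : ∀ {i i′} → i < len → i′ < len → key S i ≡ key S i′ → i ≡ i′
      seen-sound    : ∀ {c} → seen c ≢ 0 → Σ[ i ∈ ℕ ] (i < len × key S i ≡ c)
      seen-complete : ∀ {i} → i < len → seen (key S i) ≢ 0

    digits< : ∀ {i} → i < len → ∀ x → x < k + k → digits S i x < A x
    digits< i< = describes-< rad (Sound.describes (sound i<))

    length≤ : len ≤ weight A (k + k)
    length≤ = injection⇒≤ (key S) (λ i< → encode-< A (k + k) (digits< i<)) distinct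

  -- The slot at `len` is scratch space for the next candidate, so only the slots below it are
  -- claimed to survive.
  Keeps : (S : ℕ → ℕ) (len : ℕ) (S′ : ℕ → ℕ) → Set
  Keeps S len S′ = ∀ {i} → i < len → ∀ x → x < k + k → digits S′ i x ≡ digits S i x

  below⇒keeps : ∀ {S S′ len} → (∀ c → c < (k + k) * len → S′ c ≡ S c) → Keeps S len S′
  below⇒keeps {len = len} same {i} i< x x< = same _ (begin-strict
    (k + k) * i + x       <⟨ +-monoʳ-< ((k + k) * i) x< ⟩
    (k + k) * i + (k + k) ≡⟨ +-comm ((k + k) * i) (k + k) ⟩
    (k + k) + (k + k) * i ≡⟨ *-suc (k + k) i ⟨
    (k + k) * suc i       ≤⟨ *-monoʳ-≤ (k + k) i< ⟩
    (k + k) * len         ∎)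
    where open ≤-Reasoning

  table-transport : ∀ {S seen par cel len X S′ seen′ par′ cel′ len′} →
    Keeps S len S′ → seen′ ≡ seen → par′ ≡ par → cel′ ≡ cel → len′ ≡ len →
    Table S seen par cel len X → Table S′ seen′ par′ cel′ len′ X
  table-transport {S} {seen} {len = len} {S′ = S′} same refl refl refl refl t = record
    { nonempty      = nonempty
    ; root          = root
    ; sound         = λ i< → sound-cong (same i<) (sound i<)
    ; parent        = parent
    ; distinct      = λ i< i′< eq → distinct i< i′< (trans (sym (key≡ i<)) (trans eq (key≡ i′<)))
    ; seen-sound    = λ ≢0 → case seen-sound ≢0 of λ { (i , i< , eq) → i , i< , trans (key≡ i<) eq }
    ; seen-complete = λ i< → subst (λ c → seen c ≢ 0) (sym (key≡ i<)) (seen-complete i<)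
    }
    where
    open Table t
    key≡ : ∀ {i} → i < len → key S′ i ≡ key S i
    key≡ i< = encode-cong A (k + k) (same i<)

  table-append : ∀ {S seen par cel len X i j v} → Table S seen par cel len X → i < len →
    Sound (digits S len) (insert j v (X i)) → seen (key S len) ≡ 0 →
    Table S (seen [ key S len ↦ 1 ]) (par [ len ↦ i ]) (cel [ len ↦ cell j v ]) (suc len)
          (X [ len ↦ insert j v (X i) ])
  table-append {S} {seen} {par} {cel} {len} {X} {i₀} {j₀} {v₀} t i₀< new-sound unseen = record
    { nonempty      = z<s
    ; root          = λ j w → trans (cong (λ Y → Y j w) (X-old nonempty)) (root j w)
    ; sound         = sound′
    ; parent        = parent′
    ; distinct      = distinct′
    ; seen-sound    = seen-sound′
    ; seen-complete = seen-complete′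
    }
    where
    open Table t
    Y = insert j₀ v₀ (X i₀)
    X′ : ℕ → Coloring k n
    X′ = X [ len ↦ Y ]
    X-old : ∀ {i} → i < len → X′ i ≡ X i
    X-old i< = update-other X Y (<⇒≢ i<)
    X-new : X′ len ≡ Y
    X-new = update-same X len Y
    old-or-new : ∀ {i} → i < suc len → i < len ⊎ i ≡ len
    old-or-new i< = m≤n⇒m<n∨m≡n (≤-pred i<)
    sound′ : ∀ {i} → i < suc len → Sound (digits S i) (X′ i)
    sound′ i< with old-or-new i<
    ... | inj₁ i<len = subst (Sound _) (sym (X-old i<len)) (sound i<len)
    ... | inj₂ refl  = subst (Sound _) (sym X-new) new-sound
    parent′ : ∀ {i} → 0 < i → i < suc len → (par [ len ↦ i₀ ]) i < i ×
      Σ[ j ∈ Fin k ] Σ[ v ∈ Fin n ] ((cel [ len ↦ cell j₀ v₀ ]) i ≡ cell j v ×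
        (∀ j′ w → X′ i j′ w ≡ insert j v (X′ ((par [ len ↦ i₀ ]) i)) j′ w))
    parent′ {i} 0<i i< with old-or-new i<
    ... | inj₁ i<len with parent 0<i i<len
    ...   | par< , j , v , cel≡ , X≡ = subst (_< i) (sym par≡) par< , j , v , trans (update-other cel _ (<⇒≢ i<len)) cel≡ , X≡′
      where
      par≡ : (par [ len ↦ i₀ ]) i ≡ par i
      par≡ = update-other par i₀ (<⇒≢ i<len)
      X≡′ : ∀ j′ w → X′ i j′ w ≡ insert j v (X′ ((par [ len ↦ i₀ ]) i)) j′ w
      X≡′ j′ w rewrite par≡ | X-old i<len | X-old (<-trans par< i<len) = X≡ j′ w
    parent′ {i} 0<i i< | inj₂ refl = subst (_< i) (sym par≡) i₀< , j₀ , v₀ , update-same cel len _ , X≡′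
      where
      par≡ : (par [ len ↦ i₀ ]) len ≡ i₀
      par≡ = update-same par len i₀
      X≡′ : ∀ j′ w → X′ len j′ w ≡ insert j₀ v₀ (X′ ((par [ len ↦ i₀ ]) len)) j′ w
      X≡′ j′ w rewrite par≡ | X-old i₀< | X-new = refl
    fresh : ∀ {i} → i < len → key S i ≢ key S len
    fresh i< eq = seen-complete i< (trans (cong seen eq) unseen)
    distinct′ : ∀ {i i′} → i < suc len → i′ < suc len → key S i ≡ key S i′ → i ≡ i′
    distinct′ i< i′< eq with old-or-new i< | old-or-new i′<
    ... | inj₁ i<len | inj₁ i′<len = distinct i<len i′<len eq
    ... | inj₁ i<len | inj₂ refl   = contradiction eq (fresh i<len)
    ... | inj₂ refl  | inj₁ i′<len = contradiction (sym eq) (fresh i′<len)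
    ... | inj₂ refl  | inj₂ refl   = refl
    seen-sound′ : ∀ {c} → (seen [ key S len ↦ 1 ]) c ≢ 0 → Σ[ i ∈ ℕ ] (i < suc len × key S i ≡ c)
    seen-sound′ {c} ≢0 with c ≟ key S len
    ... | yes c≡ = len , n<1+n len , sym c≡
    ... | no c≢ with seen-sound (λ eq → ≢0 (trans (update-other seen 1 c≢) eq))
    ...   | i , i< , eq = i , m<n⇒m<1+n i< , eq
    seen-complete′ : ∀ {i} → i < suc len → (seen [ key S len ↦ 1 ]) (key S i) ≢ 0
    seen-complete′ {i} i< with old-or-new i<
    ... | inj₁ i<len = λ eq → seen-complete i<len (trans (sym (update-other seen 1 (fresh i<len))) eq)
    ... | inj₂ refl  = λ eq → contradiction (trans (sym (update-same seen (key S len) 1)) eq) λ ()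

  -- Injectivity of the encoding turns an occupied key into a state with the same digits, so
  -- discarding the candidate loses nothing.
  table-found : ∀ {S seen par cel len X} {d : ℕ → ℕ} → Table S seen par cel len X →
    (∀ x → x < k + k → d x < A x) → seen (encode A (k + k) d) ≢ 0 →
    Σ[ i ∈ ℕ ] (i < len × (∀ x → x < k + k → digits S i x ≡ d x))
  table-found t d< ≢0 with Table.seen-sound t ≢0
  ... | i , i< , eq = i , i< , encode-injective A (k + k) (Table.digits< t i<) d< eq

  -- The empty coloring has all digits 0 and therefore key 0, so blank memory already contains its
  -- slot.
  table-root : ∀ {S seen par cel} → (∀ c → S c ≡ 0) → (∀ c → seen c ≡ 0) →
    Table S (seen [ 0 ↦ 1 ]) par cel 1 (λ _ _ _ → false)
  table-root {S} {seen} S≡0 seen≡0 = record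
    { nonempty      = z<s
    ; root          = λ _ _ → refl
    ; sound         = λ _ → record
      { describes = record { profit≡ = λ j → trans (S≡0 _) (sym (value-empty (p j) λ _ → refl)) ; last = λ j → inj₁ (S≡0 _) }
      ; valid = record { independent = λ () ; disjoint = λ () }
      ; top = λ ()
      }
    ; parent        = λ { z<s (s≤s ()) }
    ; distinct      = λ { {zero} {zero} _ _ _ → refl ; {zero} {suc _} _ (s≤s ()) ; {suc _} (s≤s ()) }
    ; seen-sound    = λ {c} → seen-sound′ c
    ; seen-complete = λ {i} _ eq → contradiction (trans (sym (cong (seen [ 0 ↦ 1 ]) (key≡0 i))) eq) λ ()
    }
    where
    encode-zero : ∀ m i → encode A m (digits S i) ≡ 0
    encode-zero zero    i = refl
    encode-zero (suc m) i = cong₂ _+_ (encode-zero m i) (cong (_* weight A m) (S≡0 _))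
    key≡0 : ∀ i → key S i ≡ 0
    key≡0 = encode-zero (k + k)
    seen-sound′ : ∀ c → (seen [ 0 ↦ 1 ]) c ≢ 0 → Σ[ i ∈ ℕ ] (i < 1 × key S i ≡ c)
    seen-sound′ zero    _  = 0 , z<s , key≡0 0
    seen-sound′ (suc c) ≢0 = contradiction (seen≡0 (suc c)) ≢0

-- Exploring the reachable states

rLen rLen₀ rKey rLast rRank rC rS : ℕ
rLen  = 15
rLen₀ = 16
rKey  = 17
rLast = 18
rRank = 19
rC    = 20
rS    = 21

aDigit aBase aSeen aParent aCell : ℕ
aDigit  = 11
aBase   = 12
aSeen   = 13
aParent = 14
aCell   = 15

digit : ℕ → Expr → Expr
digit i x = aDigit ⟦ aBase ⟦ reg i ⟧ ⊕ x ⟧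

copyBody hashBody : Program
copyBody = aDigit ⟦ aBase ⟦ reg rLen ⟧ ⊕ reg rC ⟧≔ digit rS (reg rC)
hashBody = rKey ≔ reg rKey ⊕ aMul ⟦ aOffset ⟦ reg rC ⟧ ⊕ digit rLen (reg rC) ⟧

copy modify hash commit candidate process visit initial dynamic : ℕ → Program
copy k = for rC (lit (k + k)) copyBody
modify k =
  aDigit ⟦ aBase ⟦ reg rLen ⟧ ⊕ reg rJ ⟧≔ reg rV ⊕ lit 1 ⨾
  aDigit ⟦ aBase ⟦ reg rLen ⟧ ⊕ (lit k ⊕ reg rJ) ⟧≔ digit rLen (lit k ⊕ reg rJ) ⊕ aProfit ⟦ rJ ∙ rV ⟧
hash k = rKey ≔ lit 0 ⨾ for rC (lit (k + k)) hashBody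

-- A candidate is drafted in the first free slot, which is kept only if its key is new.
commit k =
  ifz aSeen ⟦ reg rKey ⟧ then
    ( aSeen ⟦ reg rKey ⟧≔ lit 1 ⨾
      aParent ⟦ reg rLen ⟧≔ reg rS ⨾
      aCell ⟦ reg rLen ⟧≔ aRow ⟦ reg rJ ⟧ ⊕ reg rV ⨾
      aBase ⟦ reg rLen ⊕ lit 1 ⟧≔ aBase ⟦ reg rLen ⟧ ⊕ lit (k + k) ⨾
      rLen ≔ reg rLen ⊕ lit 1 )
  else skip

-- If the class is empty, rLast is 0 and 1 ⊖ rLast makes the test succeed whatever
-- (irrelevant) arc is looked up.
candidate k =
  rLast ≔ digit rS (reg rJ) ⨾
  ifz (lit 1 ⊖ reg rLast) ⊕ aArc ⟦ aRow ⟦ reg rLast ⊖ lit 1 ⟧ ⊕ reg rV ⟧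
    then skip
    else (copy k ⨾ modify k ⨾ hash k ⨾ commit k)
process k =
  -- The length is frozen because the states appended in this round already contain the vertex.
  rLen₀ ≔ reg rLen ⨾
  for rS (reg rLen₀) (for rJ (lit k) (candidate k))
visit k =
  ifz (aRank ⟦ reg rV ⟧ ⊖ reg rRank) ⊕ (reg rRank ⊖ aRank ⟦ reg rV ⟧) then process k else skip
initial k =
  aSeen ⟦ lit 0 ⟧≔ lit 1 ⨾
  aBase ⟦ lit 0 ⟧≔ lit 0 ⨾
  -- The base of the free slot must be known before a candidate is drafted there; for the same
  -- reason `commit` always prepares the next one.
  aBase ⟦ lit 1 ⟧≔ lit (k + k) ⨾
  rLen ≔ lit 1
-- Scanning all vertices once per rank visits them in the order of `n * rank + index` without
-- sorting. In-degrees are at most `n`, hence `n + 1` rounds.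
dynamic k = initial k ⨾ for rRank (reg rN ⊕ lit 1) (for rV (reg rN) (visit k))

update-shift : ∀ (f : ℕ → ℕ) b y z x → (f [ b + y ↦ z ]) (b + x) ≡ ((λ x → f (b + x)) [ y ↦ z ]) x
update-shift f b y z x with x ≟ y
... | yes refl = trans (update-same f (b + x) z) (sym (update-same (λ x → f (b + x)) x z))
... | no x≢y   = trans (update-other f z (x≢y ∘ +-cancelˡ-≡ b x y)) (sym (update-other (λ x → f (b + x)) z x≢y))

update-cong : ∀ (f g : ℕ → ℕ) {y z z′} x → f x ≡ g x → z ≡ z′ → (f [ y ↦ z ]) x ≡ (g [ y ↦ z′ ]) x
update-cong f g {y} x f≡g refl with x ≡ᵇ y
... | true  = refl
... | false = f≡g

-- 3 for the test, 24 for recording a state and 1 for `skip`.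
commitTime : ℕ
commitTime = 28

-- These depend on `k` alone: with the multiples tabulated, a key is a sum of `k + k` table entries.
copyTime hashTime candidateTime : ℕ → ℕ
copyTime k = forTime (k + k) (lit (k + k)) 10
hashTime k = 2 + forTime (k + k) (lit (k + k)) 12
candidateTime k = 6 + suc (11 + (1 + (copyTime k + (8 + 20 + (hashTime k + commitTime)))))

processTime visitTime : ℕ → ℕ → ℕ
processTime k W = 2 + forTime W (reg rLen₀) (forTime k (lit k) (candidateTime k))
visitTime k W = suc (9 + (processTime k W + 1))

dynamicTime : ℕ → ℕ → ℕ → ℕ
dynamicTime k n W = 11 + forTime (n + 1) (reg rN ⊕ lit 1) (forTime n (reg rN) (visitTime k W))

module Dynamic {k n : ℕ} (G : Graph n) (p : Profits k n) (D : ℕ → ℕ) (o : OrientedBy (complement G) D)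
               (A : ℕ → ℕ) (rad : Radices p A) where

  open Tables G p D o A rad

  m : ℕ
  m = k + k

  record Static (N : ℕ) (row arc prof off mul : ℕ → ℕ) : Set where
    field
      n≡       : N ≡ n
      rowsₙ    : Rows n n row
      rowsₖ    : Rows n k row
      arc≡     : ∀ c → arc c ≡ D c
      prof≡    : ∀ j v → prof (cell j v) ≡ p j v
      products : Products m A off mul

  StaticAt : State → Set
  StaticAt s = Static (registers s rN) (arrays s aRow) (arrays s aArc) (arrays s aProfit) (arrays s aOffset) (arrays s aMul)

  static-transport : ∀ {N row arc prof off mul N′ row′ arc′ prof′ off′ mul′} →
    N′ ≡ N → row′ ≡ row → arc′ ≡ arc → prof′ ≡ prof → off′ ≡ off → mul′ ≡ mul →
    Static N row arc prof off mul → Static N′ row′ arc′ prof′ off′ mul′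
  static-transport refl refl refl refl refl refl st = st

  static-frame : ∀ P {s s′} {_ : T (not (writesRegister P rN))} {_ : T (not (writesArray P aRow))}
    {_ : T (not (writesArray P aArc))} {_ : T (not (writesArray P aProfit))}
    {_ : T (not (writesArray P aOffset))} {_ : T (not (writesArray P aMul))} →
    Frame P s s′ → StaticAt s → StaticAt s′
  static-frame P {_} {_} {h₁} {h₂} {h₃} {h₄} {h₅} {h₆} f = static-transport (register f rN {h₁}) (array f aRow {h₂})
    (array f aArc {h₃}) (array f aProfit {h₄}) (array f aOffset {h₅}) (array f aMul {h₆})

  Bases : (ℕ → ℕ) → ℕ → Set
  Bases base len = ∀ i → i ≤ len → base i ≡ m * i

  run-copy : ∀ {s i} → registers s rS ≡ i → i < registers s rLen → Bases (arrays s aBase) (registers s rLen) →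
    Run (copy k) s (copyTime k) (λ s′ →
      (∀ c → c < m * registers s rLen → arrays s′ aDigit c ≡ arrays s aDigit c) ×
      (∀ x → x < m → digits (arrays s′ aDigit) (registers s rLen) x ≡ digits (arrays s aDigit) i x))
  run-copy {s} {i} i≡ i<len bases = run-for m I (λ _ → refl) id body ((λ _ _ → refl) , λ _ ())
    where
    len = registers s rLen
    S = arrays s aDigit
    I : ℕ → State → Set
    I x s′ = (∀ c → c < m * len → arrays s′ aDigit c ≡ S c) × (∀ y → y < x → arrays s′ aDigit (m * len + y) ≡ S (m * i + y))
    body : ∀ (x : Fin m) s′ → registers s′ rC ≡ toℕ x → Frame (copy k) s s′ → I (toℕ x) s′ →
           Run copyBody s′ 10 (I (suc (toℕ x)))
    body x s′ x≡ f (low , done) = run-store (low′ , done′)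
      where
      S′ = arrays s′ aDigit
      target : arrays s′ aBase (registers s′ rLen) + registers s′ rC ≡ m * len + toℕ x
      target = cong₂ _+_ (trans (cong₂ (λ B r → B r) (array f aBase) (register f rLen)) (bases len ≤-refl)) x≡
      source : arrays s′ aBase (registers s′ rS) + registers s′ rC ≡ m * i + toℕ x
      source = cong₂ _+_ (trans (cong₂ (λ B r → B r) (array f aBase) (trans (register f rS) i≡)) (bases i (<⇒≤ i<len))) x≡
      low′ : ∀ c → c < m * len → (S′ [ _ ↦ _ ]) c ≡ S c
      low′ c c< = trans (update-other S′ _ λ eq → <⇒≢ (<-≤-trans c< (m≤m+n (m * len) (toℕ x))) (trans eq target)) (low c c<)
      done′ : ∀ y → y < suc (toℕ x) → (S′ [ _ ↦ _ ]) (m * len + y) ≡ S (m * i + y)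
      done′ y y< with y ≟ toℕ x
      ... | yes refl = trans (cong (λ c → (S′ [ c ↦ S′ (arrays s′ aBase (registers s′ rS) + registers s′ rC) ]) (m * len + toℕ x)) target)
                         (trans (update-same S′ (m * len + toℕ x) _)
                           (trans (cong S′ source) (below⇒keeps {S} {S′} {len} low i<len (toℕ x) (Fin.toℕ<n x))))
      ... | no y≢    = trans (update-other S′ _ λ eq → y≢ (+-cancelˡ-≡ (m * len) _ _ (trans eq target)))
                         (done y (≤∧≢⇒< (≤-pred y<) y≢))

  run-hash : ∀ {s} → StaticAt s → Bases (arrays s aBase) (registers s rLen) →
    (∀ x → x < m → digits (arrays s aDigit) (registers s rLen) x < A x) →
    Run (hash k) s (hashTime k) (λ s′ → registers s′ rKey ≡ key (arrays s aDigit) (registers s rLen))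
  run-hash {s} static bases d< = assign-then (run-for m I (λ _ → refl) id body refl)
    where
    len = registers s rLen
    d = digits (arrays s aDigit) len
    s₁ = setRegister s rKey 0
    I : ℕ → State → Set
    I x s′ = registers s′ rKey ≡ encode A x d
    body : ∀ (x : Fin m) s′ → registers s′ rC ≡ toℕ x → Frame (for rC (lit m) hashBody) s₁ s′ → I (toℕ x) s′ →
           Run hashBody s′ 12 (I (suc (toℕ x)))
    body x s′ x≡ f acc = run-assign (cong₂ _+_ acc (trans (cong₂ (λ M c → M c) (array f aMul) address)
      (Static.products static (toℕ x) (Fin.toℕ<n x) (d (toℕ x)) (d< (toℕ x) (Fin.toℕ<n x)))))
      where
      base≡ : arrays s′ aBase (registers s′ rLen) + registers s′ rC ≡ m * len + toℕ x
      base≡ = cong₂ _+_ (trans (cong₂ (λ B r → B r) (array f aBase) (register f rLen)) (bases len ≤-refl)) x≡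
      address : arrays s′ aOffset (registers s′ rC) + arrays s′ aDigit (arrays s′ aBase (registers s′ rLen) + registers s′ rC)
                ≡ arrays s aOffset (toℕ x) + d (toℕ x)
      address = cong₂ _+_ (cong₂ (λ B r → B r) (array f aOffset) x≡) (cong₂ (λ B r → B r) (array f aDigit) base≡)

module Processing {k n : ℕ} (G : Graph n) (p : Profits k n) (D : ℕ → ℕ) (o : OrientedBy (complement G) D)
                  (A : ℕ → ℕ) (rad : Radices p A)
                  (τ : Fin n → ℕ) (v : Fin n) (len₀ : ℕ) (S₀ : ℕ → ℕ) where

  open States G p D o
  open Tables G p D o A rad
  open Dynamic G p D o A rad

  -- `len₀` and `S₀` are the list as it stood before the round of `v`. `older` shows that `v` is not
  -- yet in the states being extended, and `newer` becomes `within` for the next round.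
  record Progress (S seen par cel base : ℕ → ℕ) (len : ℕ) : Set where
    field
      X     : ℕ → Coloring k n
      table : Table S seen par cel len X
      bases : Bases base len
      len₀≤ : len₀ ≤ len
      old   : Keeps S₀ len₀ S
      older : ∀ {i j w} → i < len₀ → X i j w ≡ true → τ w < τ v
      newer : ∀ {i j w} → i < len → X i j w ≡ true → τ w < suc (τ v)

  ProgressAt : State → Set
  ProgressAt s = Progress (arrays s aDigit) (arrays s aSeen) (arrays s aParent) (arrays s aCell) (arrays s aBase) (registers s rLen)

  Covered : (ℕ → ℕ) → ℕ → ℕ → Fin k → Set
  Covered S len i j = Compatible (digits S₀ i) j v →
    Σ[ i′ ∈ ℕ ] (i′ < len × (∀ x → x < m → digits S i′ x ≡ extend (digits S₀ i) j v x))

  Grown : (S : ℕ → ℕ) (len : ℕ) (S′ : ℕ → ℕ) (len′ : ℕ) → Set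
  Grown S len S′ len′ = len ≤ len′ × Keeps S len S′

  covered-mono : ∀ {S len S′ len′ i j} → Grown S len S′ len′ → Covered S len i j → Covered S′ len′ i j
  covered-mono (le , keeps) cov c with cov c
  ... | i′ , i′< , eq = i′ , <-≤-trans i′< le , λ x x< → trans (keeps i′< x x<) (eq x x<)

  module Draft {S seen par cel base S′ : ℕ → ℕ} {len i : ℕ} {j : Fin k}
               (progress : Progress S seen par cel base len) (i< : i < len₀)
               (low : ∀ c → c < m * len → S′ c ≡ S c)
               (drafted : ∀ x → x < m → digits S′ len x ≡ extend (digits S₀ i) j v x)
               (compat : Compatible (digits S₀ i) j v) where

    open Progress progress

    private
      keeps : Keeps S len S′
      keeps = below⇒keeps {S} {S′} {len} low
      i<len : i < len
      i<len = <-≤-trans i< len₀≤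
      table′ : Table S′ seen par cel len X
      table′ = table-transport keeps refl refl refl refl table
      old′ : Keeps S₀ len₀ S′
      old′ i<′ x x< = trans (keeps (<-≤-trans i<′ len₀≤) x x<) (old i<′ x x<)
      sound-draft : Sound (extend (digits S₀ i) j v) (insert j v (X i))
      sound-draft = sound-extend (sound-cong (λ x x< → sym (old i< x x<)) (Table.sound table i<len))
        (λ _ → ¬-not λ Xv → <-irrefl refl (older i< Xv)) compat

    commit-new : seen (key S′ len) ≡ 0 →
      Progress S′ (seen [ key S′ len ↦ 1 ]) (par [ len ↦ i ]) (cel [ len ↦ cell j v ]) (base [ suc len ↦ base len + m ]) (suc len)
      × Grown S len S′ (suc len) × Covered S′ (suc len) i j
    commit-new unseen = record
      { X     = X [ len ↦ insert j v (X i) ]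
      ; table = table-append table′ i<len (sound-cong drafted sound-draft) unseen
      ; bases = bases′
      ; len₀≤ = m≤n⇒m≤1+n len₀≤
      ; old   = old′
      ; older = λ {i′} {j′} {w} i′< Xw → older i′< (trans (sym (X-old j′ w (<-≤-trans i′< len₀≤))) Xw)
      ; newer = newer′
      } , (n≤1+n len , keeps) , (λ _ → len , n<1+n len , drafted)
      where
      X-old : ∀ {i′} j′ w → i′ < len → (X [ len ↦ insert j v (X i) ]) i′ j′ w ≡ X i′ j′ w
      X-old j′ w i′< = cong (λ Y → Y j′ w) (update-other X _ (<⇒≢ i′<))
      newer′ : ∀ {i′ j′ w} → i′ < suc len → (X [ len ↦ insert j v (X i) ]) i′ j′ w ≡ true → τ w < suc (τ v)
      newer′ {i′} {j′} {w} i′< Xw with m≤n⇒m<n∨m≡n (≤-pred i′<)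
      ... | inj₁ i′<len = newer i′<len (trans (sym (X-old j′ w i′<len)) Xw)
      ... | inj₂ refl with insert-inv j v (X i) (trans (sym (cong (λ Y → Y j′ w) (update-same X len (insert j v (X i))))) Xw)
      ...   | inj₁ (refl , refl) = n<1+n (τ v)
      ...   | inj₂ Xiw = newer i<len Xiw
      bases′ : Bases (base [ suc len ↦ base len + m ]) (suc len)
      bases′ i′ i′≤ with m≤n⇒m<n∨m≡n i′≤
      ... | inj₁ i′< = trans (update-other base _ (<⇒≢ i′<)) (bases i′ (≤-pred i′<))
      ... | inj₂ refl = trans (update-same base (suc len) _) (trans (cong (_+ m) (bases len ≤-refl))
                          (trans (+-comm (m * len) m) (sym (*-suc m len))))

    commit-old : seen (key S′ len) ≢ 0 →
      Progress S′ seen par cel base len × Grown S len S′ len × Covered S′ len i j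
    commit-old ≢0 = record
      { X = X ; table = table′ ; bases = bases ; len₀≤ = len₀≤ ; old = old′ ; older = older ; newer = newer }
      , (≤-refl , keeps)
      , λ _ → table-found table′ (describes-< rad (Sound.describes sound-draft))
                (subst (λ c → seen c ≢ 0) (encode-cong A m drafted) ≢0)

    draft< : ∀ x → x < m → digits S′ len x < A x
    draft< x x< = subst (_< A x) (sym (drafted x x<)) (describes-< rad (Sound.describes sound-draft) x x<)

  draft-digits : ∀ {d : ℕ → ℕ} {S c₁ c₂ V P len} {j : Fin k} →
    c₁ ≡ m * len + toℕ j → c₂ ≡ m * len + (k + toℕ j) → V ≡ suc (toℕ v) → P ≡ p j v →
    (∀ x → x < m → digits S len x ≡ d x) →
    ∀ x → x < m → digits ((S [ c₁ ↦ V ]) [ c₂ ↦ (S [ c₁ ↦ V ]) c₂ + P ]) len x ≡ extend d j v x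
  draft-digits {d} {S} {len = len} {j} refl refl refl refl copied x x< =
    trans (update-shift S′ b (k + toℕ j) _ x)
      (update-cong (digits S′ len) (d [ toℕ j ↦ suc (toℕ v) ]) x
        (trans (update-shift S b (toℕ j) _ x) (update-cong (digits S len) d x (copied x x<) refl)) (cong (_+ p j v) profit≡))
    where
    b = m * len
    S′ : ℕ → ℕ
    S′ = S [ b + toℕ j ↦ suc (toℕ v) ]
    profit≡ : S′ (b + (k + toℕ j)) ≡ d (k + toℕ j)
    profit≡ = trans (update-other S _ (low≢high j j ∘ sym ∘ +-cancelˡ-≡ b _ _)) (copied _ (high<2k j))

  draft-low : ∀ {S : ℕ → ℕ} {c₁ c₂ a b V P len} → c₁ ≡ m * len + a → c₂ ≡ m * len + b →
    ∀ c → c < m * len → ((S [ c₁ ↦ V ]) [ c₂ ↦ P ]) c ≡ S c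
  draft-low {S} {V = V} {len = len} refl refl c c< =
    trans (update-other (S [ _ ↦ V ]) _ (<⇒≢ (<-≤-trans c< (m≤m+n (m * len) _))))
          (update-other S _ (<⇒≢ (<-≤-trans c< (m≤m+n (m * len) _))))

  module _ {s : State} {i : ℕ} {j : Fin k} (static : StaticAt s) (progress : ProgressAt s)
           (i≡ : registers s rS ≡ i) (i< : i < len₀) (j≡ : registers s rJ ≡ toℕ j) (v≡ : registers s rV ≡ toℕ v) where

    open Progress progress
    open Static static

    private
      S = arrays s aDigit
      len = registers s rLen
      d = digits S₀ i
      l = S (arrays s aBase (registers s rS) + registers s rJ)
      arc = arrays s aArc (arrays s aRow (l ∸ 1) + registers s rV)

      Post : State → Set
      Post s′ = ProgressAt s′ × Grown S len (arrays s′ aDigit) (registers s′ rLen)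
              × Covered (arrays s′ aDigit) (registers s′ rLen) i j

      i<len : i < len
      i<len = <-≤-trans i< len₀≤

      l≡ : l ≡ d (toℕ j)
      l≡ = trans (cong S (cong₂ _+_ (trans (cong (arrays s aBase) i≡) (bases i (<⇒≤ i<len))) j≡)) (old i< _ (low<2k j))

      arc≡D : ∀ {u} → d (toℕ j) ≡ suc (toℕ u) → arc ≡ D (cell u v)
      arc≡D {u} eq = trans (arc≡ _) (cong D (row-cell {A = arrays s aRow} rowsₙ u v (cong (_∸ 1) (trans l≡ eq)) v≡))

      incompatible : (1 ∸ l) + arc ≡ 0 → ¬ Compatible d j v
      incompatible eq (inj₁ zero≡) = contradiction (trans (sym (cong (1 ∸_) (trans l≡ zero≡))) (m+n≡0⇒m≡0 (1 ∸ l) eq)) λ ()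
      incompatible eq (inj₂ (u , suc≡ , uv)) =
        contradiction (trans (sym uv) (trans (sym (arc≡D suc≡)) (m+n≡0⇒n≡0 (1 ∸ l) eq))) λ ()

      compat : (1 ∸ l) + arc ≢ 0 → Compatible d j v
      compat ≢0 with Describes.last (Sound.describes (Table.sound table i<len)) j
      ... | inj₁ zero≡ = inj₁ (trans (sym (old i< _ (low<2k j))) zero≡)
      ... | inj₂ (u , suc≡ , _) with trans (sym (old i< _ (low<2k j))) suc≡
      ...   | d≡ with arc-01 o (cell u v)
      ...     | inj₂ uv = inj₂ (u , d≡ , uv)
      ...     | inj₁ zero≡ = contradiction (cong₂ _+_ {1 ∸ l} {0} (trans (cong (1 ∸_) (trans l≡ d≡)) (0∸n≡0 (toℕ u))) (trans (arc≡D d≡) zero≡)) ≢0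

    run-candidate : Run (candidate k) s (candidateTime k) Post
    run-candidate = assign-then (run-if
      (λ eq → run-skip (progress , (≤-refl , λ _ _ _ → refl) , λ c → contradiction c (incompatible eq)))
      (λ ≢0 → run-seq (run-copy i≡ i<len bases) λ s₁ f₁ copied →
        run-seq {Q = Drafted} (store-then (run-store (drafted s₁ f₁ copied))) λ s₂ f₂ dr →
        finish (compat ≢0) s₂ (frame-trans {P = copy k ⨾ modify k} (frame-left (copy k) (modify k) f₁) (frame-right (copy k) (modify k) f₂)) dr))
      where
      s₀ = setRegister s rLast l
      Drafted : State → Set
      Drafted s₂ = (∀ c → c < m * len → arrays s₂ aDigit c ≡ S c)
                 × (∀ x → x < m → digits (arrays s₂ aDigit) len x ≡ extend d j v x)
      drafted : ∀ s₁ → Frame (copy k) s₀ s₁ →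
        ((∀ c → c < m * len → arrays s₁ aDigit c ≡ S c) × (∀ x → x < m → digits (arrays s₁ aDigit) len x ≡ digits S i x)) →
        Drafted (setCell (setCell s₁ aDigit _ _) aDigit _ _)
      drafted s₁ f₁ (low , copied) =
          (λ c c< → trans (draft-low {arrays s₁ aDigit} {len = len} c₁≡ c₂≡ c c<) (low c c<))
        , draft-digits {d} {arrays s₁ aDigit} {len = len} {j} c₁≡ c₂≡ (trans (+-comm _ 1) (cong suc (trans (register f₁ rV) v≡)))
            (trans (cong₂ (λ B c → B c) (array f₁ aProfit) (row-cell {A = arrays s₁ aRow}
               (subst (Rows n k) (sym (array f₁ aRow)) rowsₖ) j v (trans (register f₁ rJ) j≡) (trans (register f₁ rV) v≡))) (prof≡ j v))
            (λ x x< → trans (copied x x<) (old i< x x<))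
        where
        base≡ : arrays s₁ aBase (registers s₁ rLen) ≡ m * len
        base≡ = trans (cong₂ (λ B r → B r) (array f₁ aBase) (register f₁ rLen)) (bases len ≤-refl)
        c₁≡ : arrays s₁ aBase (registers s₁ rLen) + registers s₁ rJ ≡ m * len + toℕ j
        c₁≡ = cong₂ _+_ base≡ (trans (register f₁ rJ) j≡)
        c₂≡ : arrays s₁ aBase (registers s₁ rLen) + (k + registers s₁ rJ) ≡ m * len + (k + toℕ j)
        c₂≡ = cong₂ _+_ base≡ (cong (k +_) (trans (register f₁ rJ) j≡))
      finish : Compatible d j v → ∀ s₂ → Frame (copy k ⨾ modify k) s₀ s₂ → Drafted s₂ →
               Run (hash k ⨾ commit k) s₂ (hashTime k + commitTime) Post
      finish c s₂ f₂ (low , dr) = run-seq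
        (run-hash (static-frame (copy k ⨾ modify k) f₂ static)
          (λ i′ i′≤ → trans (cong (λ B → B i′) (array f₂ aBase)) (bases i′ (subst (i′ ≤_) (register f₂ rLen) i′≤)))
          (λ x x< → subst (λ q → digits (arrays s₂ aDigit) q x < A x) (sym (register f₂ rLen)) (Draft.draft< progress i< low dr c x x<)))
        λ s₃ f₃ key≡ → run-if
          (λ eq → store-then (store-then (store-then (store-then (run-assign
            (new (array f₃ aDigit) (seen≡ f₃) (trans (array f₃ aParent) (array f₂ aParent)) (trans (array f₃ aCell) (array f₂ aCell))
              (trans (array f₃ aBase) (array f₂ aBase)) (len≡ f₃) (trans (+-comm _ 1) (cong suc (len≡ f₃))) (κ≡ f₃ key≡)
              (trans (register f₃ rS) (trans (register f₂ rS) i≡)) (cell≡ f₃) eq))))))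
          (λ ≢0 → run-skip
            (found (array f₃ aDigit) (seen≡ f₃) (trans (array f₃ aParent) (array f₂ aParent)) (trans (array f₃ aCell) (array f₂ aCell))
              (trans (array f₃ aBase) (array f₂ aBase)) (len≡ f₃) (κ≡ f₃ key≡) ≢0))
        where
        S₂ = arrays s₂ aDigit
        open Draft {S′ = S₂} progress i< low dr c
        module _ {s₃} (f₃ : Frame (hash k) s₂ s₃) where
          seen≡ : arrays s₃ aSeen ≡ arrays s aSeen
          seen≡ = trans (array f₃ aSeen) (array f₂ aSeen)
          len≡ : registers s₃ rLen ≡ len
          len≡ = trans (register f₃ rLen) (register f₂ rLen)
          κ≡ : registers s₃ rKey ≡ key S₂ (registers s₂ rLen) → registers s₃ rKey ≡ key S₂ len
          κ≡ eq = trans eq (cong (key S₂) (register f₂ rLen))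
          cell≡ : arrays s₃ aRow (registers s₃ rJ) + registers s₃ rV ≡ cell j v
          cell≡ = row-cell {A = arrays s₃ aRow} (subst (Rows n k) (sym (trans (array f₃ aRow) (array f₂ aRow))) rowsₖ) j v
            (trans (register f₃ rJ) (trans (register f₂ rJ) j≡)) (trans (register f₃ rV) (trans (register f₂ rV) v≡))
        new : ∀ {S₃ seen₃ par₃ cel₃ base₃ len₃ len′ κ i₃ c₃} → S₃ ≡ S₂ → seen₃ ≡ arrays s aSeen →
          par₃ ≡ arrays s aParent → cel₃ ≡ arrays s aCell → base₃ ≡ arrays s aBase → len₃ ≡ len → len′ ≡ suc len →
          κ ≡ key S₂ len → i₃ ≡ i → c₃ ≡ cell j v → seen₃ κ ≡ 0 →
          Progress S₃ (seen₃ [ κ ↦ 1 ]) (par₃ [ len₃ ↦ i₃ ]) (cel₃ [ len₃ ↦ c₃ ]) (base₃ [ len′ ↦ base₃ len₃ + m ]) len′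
          × Grown S len S₃ len′ × Covered S₃ len′ i j
        new refl refl refl refl refl refl refl refl refl refl = commit-new
        found : ∀ {S₃ seen₃ par₃ cel₃ base₃ len₃ κ} → S₃ ≡ S₂ → seen₃ ≡ arrays s aSeen →
          par₃ ≡ arrays s aParent → cel₃ ≡ arrays s aCell → base₃ ≡ arrays s aBase → len₃ ≡ len →
          κ ≡ key S₂ len → seen₃ κ ≢ 0 →
          Progress S₃ seen₃ par₃ cel₃ base₃ len₃ × Grown S len S₃ len₃ × Covered S₃ len₃ i j
        found refl refl refl refl refl refl refl = commit-old

module Exploration {k n : ℕ} (G : Graph n) (p : Profits k n) (D : ℕ → ℕ) (o : OrientedBy (complement G) D)
                   (A : ℕ → ℕ) (rad : Radices p A)
                   (τ : Fin n → ℕ) (τ-injective : ∀ {u v} → τ u ≡ τ v → u ≡ v)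
                   (τ-mono : ∀ {u v} → D (cell u v) ≡ 1 → τ u < τ v)
                   (W : ℕ) (weight≤W : weight A (k + k) ≤ W) where

  open States G p D o
  open Ordered τ τ-injective τ-mono
  open Tables G p D o A rad
  open Dynamic G p D o A rad

  -- `complete` follows one full coloring through all rounds. Its part below `c` is described by
  -- some state, whose own coloring `X i` may be a different one.
  record Inv (c : ℕ) (S seen par cel base : ℕ → ℕ) (len : ℕ) : Set where
    field
      X        : ℕ → Coloring k n
      table    : Table S seen par cel len X
      bases    : Bases base len
      within   : ∀ {i j w} → i < len → X i j w ≡ true → τ w < c
      complete : ∀ Y → Valid G Y → Σ[ i ∈ ℕ ] (i < len × Describes (digits S i) (restrict c Y))

  InvAt : ℕ → State → Set
  InvAt c s = Inv c (arrays s aDigit) (arrays s aSeen) (arrays s aParent) (arrays s aCell) (arrays s aBase) (registers s rLen)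

  -- The counter runs through all `n * (n + 1)` values, and only `n` of them are positions of
  -- vertices.
  inv-skip : ∀ {c S seen par cel base len} → (∀ w → τ w ≢ c) → Inv c S seen par cel base len → Inv (suc c) S seen par cel base len
  inv-skip {c} absent inv = record
    { X = X ; table = table ; bases = bases
    ; within = λ i< Xw → m<n⇒m<1+n (within i< Xw)
    ; complete = λ Y valid → case complete Y valid of λ { (i , i< , desc) → i , i< ,
        describes-cong (λ _ _ → refl) (λ j w → restrict-skip c Y j w λ eq → contradiction eq (absent w)) desc }
    }
    where open Inv inv

  module _ {s : State} {v : Fin n} (static : StaticAt s) (v≡ : registers s rV ≡ toℕ v) (inv : InvAt (τ v) s) where

    open Inv inv

    private
      len₀ = registers s rLen
      S₀ = arrays s aDigit

    open Processing G p D o A rad τ v len₀ S₀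

    private
      s₁ = setRegister s rLen₀ len₀
      Row : ℕ → State → Set
      Row i s′ = ∀ j → Covered (arrays s′ aDigit) (registers s′ rLen) i j
      I : ℕ → State → Set
      I i s′ = ProgressAt s′ × (∀ i′ → i′ < i → Row i′ s′)
      inner outer : Program
      inner = for rJ (lit k) (candidate k)
      outer = for rS (reg rLen₀) inner

      body : ∀ (i : Fin len₀) s′ → registers s′ rS ≡ toℕ i → Frame outer s₁ s′ → I (toℕ i) s′ →
             Run inner s′ (forTime k (lit k) (candidateTime k)) (I (suc (toℕ i)))
      body i s′ i≡ f (progress , rows) = run-mono ≤-refl
        (λ s″ _ (progress″ , rows″ , row) → progress″ , λ i′ i′< → close s″ rows″ row i′ (m≤n⇒m<n∨m≡n (≤-pred i′<)))
        (run-for k J (λ _ → refl) id step (progress , rows , λ _ ()))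
        where
        J : ℕ → State → Set
        J x s″ = ProgressAt s″ × (∀ i′ → i′ < toℕ i → Row i′ s″)
               × (∀ j → toℕ j < x → Covered (arrays s″ aDigit) (registers s″ rLen) (toℕ i) j)
        close : ∀ s″ → (∀ i′ → i′ < toℕ i → Row i′ s″) →
                (∀ j → toℕ j < k → Covered (arrays s″ aDigit) (registers s″ rLen) (toℕ i) j) →
                ∀ i′ → i′ < toℕ i ⊎ i′ ≡ toℕ i → Row i′ s″
        close s″ rows″ row i′ (inj₁ i′<)  = rows″ i′ i′<
        close s″ rows″ row i′ (inj₂ refl) = λ j → row j (Fin.toℕ<n j)
        step : ∀ (j : Fin k) s″ → registers s″ rJ ≡ toℕ j → Frame inner s′ s″ → J (toℕ j) s″ →
               Run (candidate k) s″ (candidateTime k) (J (suc (toℕ j)))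
        step j s″ j≡ f′ (progress″ , rows″ , row) = run-mono ≤-refl
          (λ s‴ _ (progress‴ , grown , covered) → progress‴
            , (λ i′ i′< j′ → covered-mono {arrays s″ aDigit} {S′ = arrays s‴ aDigit} grown (rows″ i′ i′< j′))
            , λ j′ j′< → extend-row s‴ grown covered j′ (j′ Fin.≟ j) j′<)
          (run-candidate (static-frame inner f′ (static-frame outer f static)) progress″
            (trans (register f′ rS) i≡) (Fin.toℕ<n i) j≡ (trans (register f′ rV) (trans (register f rV) v≡)))
          where
          extend-row : ∀ s‴ → Grown (arrays s″ aDigit) (registers s″ rLen) (arrays s‴ aDigit) (registers s‴ rLen) →
            Covered (arrays s‴ aDigit) (registers s‴ rLen) (toℕ i) j →
            ∀ j′ → Dec (j′ ≡ j) → toℕ j′ < suc (toℕ j) → Covered (arrays s‴ aDigit) (registers s‴ rLen) (toℕ i) j′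
          extend-row s‴ grown covered j′ (yes refl) _ = covered
          extend-row s‴ grown covered j′ (no j′≢j) j′< =
            covered-mono {arrays s″ aDigit} {S′ = arrays s‴ aDigit} grown (row j′ (≤∧≢⇒< (≤-pred j′<) (j′≢j ∘ Fin.toℕ-injective)))

      finish : ∀ s′ → I len₀ s′ → InvAt (suc (τ v)) s′
      finish s′ (progress , rows) = record
        { X = P.X ; table = P.table ; bases = P.bases ; within = P.newer ; complete = complete′ }
        where
        module P = Progress progress
        complete′ : ∀ Y → Valid G Y →
          Σ[ i ∈ ℕ ] (i < registers s′ rLen × Describes (digits (arrays s′ aDigit) i) (restrict (suc (τ v)) Y))
        complete′ Y valid with complete Y valid | Fin.any? (λ j → Y j v Bool.≟ true)
        ... | i , i< , desc | yes (j , Yv) with rows i i< j (compatible valid Yv desc)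
        ...   | i′ , i′< , eq = i′ , i′< , describes-cong eq (λ _ _ → refl) (describes-insert valid Yv desc)
        -- A vertex that `Y` leaves uncolored changes nothing, and the state of the previous round
        -- is still in the list.
        complete′ Y valid | i , i< , desc | no none = i , <-≤-trans i< P.len₀≤ , describes-cong (P.old i<)
          (λ j w → restrict-skip (τ v) Y j w λ eq → ¬-not λ Yw → none (j , subst (λ u → Y j u ≡ true) (τ-injective eq) Yw)) desc

    run-process : Run (process k) s (processTime k W) (InvAt (suc (τ v)))
    run-process = assign-then (run-mono (*-monoˡ-≤ _ (s≤s (≤-trans (Table.length≤ table) weight≤W))) (λ s′ _ → finish s′)
      (run-for len₀ I (λ f → register f rLen₀) id body (start , λ _ ())))
      where
      start : ProgressAt s₁
      start = record { X = X ; table = table ; bases = bases ; len₀≤ = ≤-refl ; old = λ _ _ _ → refl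
                     ; older = within ; newer = λ i< Xw → m<n⇒m<1+n (within i< Xw) }

  run-visit : ∀ {s r} {v : Fin n} → StaticAt s → registers s rV ≡ toℕ v → registers s rRank ≡ r →
    (arrays s aRank (toℕ v) ≡ r → τ v ≡ n * r + toℕ v) →
    (arrays s aRank (toℕ v) ≢ r → ∀ w → τ w ≢ n * r + toℕ v) →
    InvAt (n * r + toℕ v) s → Run (visit k) s (visitTime k W) (InvAt (suc (n * r + toℕ v)))
  run-visit {s} {r} {v} static v≡ r≡ hit miss inv = run-if
    (λ eq → let τ≡ = hit (≤-antisym (le eq) (ge eq)) in
      run-mono ≤-refl (λ s′ _ → subst (λ c → InvAt (suc c) s′) τ≡)
        (run-process static v≡ (subst (λ c → InvAt c s) (sym τ≡) inv)))
    (λ ≢0 → run-skip (inv-skip (miss λ eq → ≢0 (zero≡ eq)) inv))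
    where
    ρ≡ : arrays s aRank (registers s rV) ≡ arrays s aRank (toℕ v)
    ρ≡ = cong (arrays s aRank) v≡
    ρ = arrays s aRank (registers s rV)
    r′ = registers s rRank
    le : (ρ ∸ r′) + (r′ ∸ ρ) ≡ 0 → arrays s aRank (toℕ v) ≤ r
    le eq = subst₂ _≤_ ρ≡ r≡ (m∸n≡0⇒m≤n (m+n≡0⇒m≡0 (ρ ∸ r′) eq))
    ge : (ρ ∸ r′) + (r′ ∸ ρ) ≡ 0 → r ≤ arrays s aRank (toℕ v)
    ge eq = subst₂ _≤_ r≡ ρ≡ (m∸n≡0⇒m≤n (m+n≡0⇒n≡0 (ρ ∸ r′) eq))
    zero≡ : arrays s aRank (toℕ v) ≡ r → (ρ ∸ r′) + (r′ ∸ ρ) ≡ 0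
    zero≡ eq rewrite trans ρ≡ (trans eq (sym r≡)) = cong₂ _+_ (n∸n≡0 r′) (n∸n≡0 r′)

  run-dynamic : ∀ {s} → StaticAt s → (∀ v → τ v ≡ n * arrays s aRank (toℕ v) + toℕ v) →
    (∀ c → arrays s aDigit c ≡ 0) → (∀ c → arrays s aSeen c ≡ 0) →
    Run (dynamic k) s (dynamicTime k n W) (InvAt (n * (n + 1)))
  run-dynamic {s} static τ≡ blank unseen = run-seq {Q = λ s′ → InvAt (n * 0) s′}
    (store-then (store-then (store-then (run-assign start))))
    λ s₁ f₁ inv₁ → run-for {T₁ = forTime n (reg rN) (visitTime k W)} (n + 1) (λ r → InvAt (n * r))
      (λ f → cong (_+ 1) (trans (register f rN) (trans (register f₁ rN) (Static.n≡ static)))) id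
      (λ r s₂ r≡ f₂ inv₂ → run-mono ≤-refl
        (λ s′ _ → subst (λ c → InvAt c s′) (trans (+-comm (n * toℕ r) n) (sym (*-suc n (toℕ r)))))
        (run-for {T₁ = visitTime k W} n (λ x → InvAt (n * toℕ r + x))
          (λ f → trans (register f rN) (trans (register f₂ rN) (trans (register f₁ rN) (Static.n≡ static)))) id
          (λ v s₃ v≡ f₃ inv₃ → run-mono ≤-refl (λ s′ _ → subst (λ c → InvAt c s′) (sym (+-suc (n * toℕ r) (toℕ v))))
            (let rank≡ = trans (array f₃ aRank) (trans (array f₂ aRank) (array f₁ aRank)) in
             run-visit (static-frame (for rV (reg rN) (visit k)) f₃
                         (static-frame (for rRank (reg rN ⊕ lit 1) (for rV (reg rN) (visit k))) f₂
                           (static-frame (initial k) f₁ static)))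
               v≡ (trans (register f₃ rRank) r≡)
               (λ eq → trans (τ≡ v) (cong (λ q → n * q + toℕ v) (trans (sym (cong (λ B → B (toℕ v)) rank≡)) eq)))
               (λ ≢r w eq → ≢r (trans (cong (λ B → B (toℕ v)) rank≡) (miss {r = toℕ r} v w (trans (sym (τ≡ w)) eq))))
               inv₃))
          (subst (λ c → InvAt c s₂) (sym (+-identityʳ (n * toℕ r))) inv₂)))
      inv₁
    where
    -- The number `n * r + toℕ v` determines rank and index, so a vertex at this position is `v`
    -- itself, with rank `r`.
    miss : ∀ {r} v w → n * arrays s aRank (toℕ w) + toℕ w ≡ n * r + toℕ v → arrays s aRank (toℕ v) ≡ r
    miss {r} v w eq with +*-injective (Fin.toℕ<n w) (Fin.toℕ<n v)
      (trans (cong (toℕ w +_) (*-comm _ n)) (trans (+-comm (toℕ w) _) (trans eq (trans (+-comm _ (toℕ v)) (cong (toℕ v +_) (*-comm n r))))))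
    ... | w≡v , r≡ = trans (cong (arrays s aRank) (sym w≡v)) r≡
    start : InvAt (n * 0) (setRegister (setCell (setCell (setCell s aSeen 0 1) aBase 0 0) aBase 1 m) rLen 1)
    start = record
      { X = λ _ _ _ → false
      ; table = table-root blank unseen
      ; bases = λ { 0 _ → sym (*-zeroʳ m) ; 1 _ → sym (*-identityʳ m) ; (suc (suc _)) (s≤s ()) }
      ; within = λ _ ()
      ; complete = λ Y _ → 0 , z<s , record
        { profit≡ = λ j → trans (blank _) (sym (value-empty (p j) λ w → none Y j w)) ; last = λ j → inj₁ (blank _) }
      }
      where
      none : ∀ Y j w → restrict (n * 0) Y j w ≡ false
      none Y j w rewrite *-zeroʳ n with Y j w
      ... | true  = refl
      ... | false = refl

-- Selecting the best state and tracing its coloring.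

rBest rBestValue rMin : ℕ
rBest      = 22
rBestValue = 23
rMin       = 24

minStep : ℕ → Program
minStep k = rMin ≔ reg rMin ⊖ (reg rMin ⊖ digit rS (lit k ⊕ reg rJ))

compare : Program
compare =
  ifz reg rMin ⊖ reg rBestValue
    then skip
    else (rBestValue ≔ reg rMin ⨾ rBest ≔ reg rS)

bestBody best : ℕ → Program
-- The minimum starts from the profit of the first class, which exists as there is at least one
-- class; the loop meets it again without effect.
bestBody k = rMin ≔ digit rS (lit k) ⨾ for rJ (lit k) (minStep k) ⨾ compare
-- State 0 is the empty coloring and has value 0, so the initial pair is consistent.
best k = rBest ≔ lit 0 ⨾ rBestValue ≔ lit 0 ⨾ for rS (reg rLen) (bestBody k)

-- Index 0 belongs to the empty coloring, so the index itself tells when the chain ends. The output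
-- array starts blank, and only ones are written.
traceBody trace : Program
traceBody = aOut ⟦ aCell ⟦ reg rBest ⟧ ⟧≔ lit 1 ⨾ rBest ≔ aParent ⟦ reg rBest ⟧
trace = while reg rBest loop traceBody

m∸[m∸n]≡m⊓n : ∀ m n → m ∸ (m ∸ n) ≡ m ⊓ n
m∸[m∸n]≡m⊓n m n with ≤-total n m
... | inj₁ n≤m = trans (m∸[m∸n]≡n n≤m) (sym (m≥n⇒m⊓n≡n n≤m))
... | inj₂ m≤n = trans (cong (m ∸_) (m≤n⇒m∸n≡0 m≤n)) (sym (m≤n⇒m⊓n≡m m≤n))

bestBodyTime traceTime : ℕ → ℕ
bestBodyTime k = 6 + (forTime k (lit k) 12 + 9)
traceTime W = W * 9

bestTime : ℕ → ℕ → ℕ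
bestTime k W = 4 + forTime W (reg rLen) (bestBodyTime k)

module Readout {k n : ℕ} (G : Graph n) (p : Profits (suc k) n) (D : ℕ → ℕ) (o : OrientedBy (complement G) D)
               (A : ℕ → ℕ) (rad : Radices p A) (W : ℕ) (weight≤W : weight A (suc k + suc k) ≤ W) where

  open States G p D o
  open Tables G p D o A rad

  private
    K = suc k

  gain : (ℕ → ℕ) → ℕ → Fin K → ℕ
  gain S i j = digits S i (K + toℕ j)

  module _ {s : State} {X : ℕ → Coloring K n}
           (table : Table (arrays s aDigit) (arrays s aSeen) (arrays s aParent) (arrays s aCell) (registers s rLen) X)
           (bases : ∀ i → i ≤ registers s rLen → arrays s aBase i ≡ (K + K) * i) where

    private
      S = arrays s aDigit
      len = registers s rLen
      s₀ = setRegister (setRegister s rBest 0) rBestValue 0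
      loop′ = for rS (reg rLen) (bestBody K)

      I : ℕ → State → Set
      I i s′ = registers s′ rBest < len × (∀ j → registers s′ rBestValue ≤ gain S (registers s′ rBest) j)
             × (∀ i′ → i′ < i → Σ[ j ∈ Fin K ] gain S i′ j ≤ registers s′ rBestValue)

    -- Compares the minima of two states without mentioning a minimum: some class of state `i` gains
    -- no more than any class of the best state.
    Best : State → Set
    Best s′ = registers s′ rBest < len × (∀ i → i < len → Σ[ j ∈ Fin K ] (∀ j′ → gain S i j ≤ gain S (registers s′ rBest) j′))

    run-best : Run (best K) s (bestTime K W) Best
    run-best = assign-then (assign-then (run-mono (*-monoˡ-≤ ((bestBodyTime K) + 10) (s≤s (≤-trans (Table.length≤ table) weight≤W)))
      (λ _ _ (b< , low , high) → b< , λ i i< → case high i i< of λ { (j , le) → j , λ j′ → ≤-trans le (low j′) })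
      (run-for {T₁ = (bestBodyTime K)} len I (λ f → register f rLen) id body (Table.nonempty table , (λ _ → z≤n) , λ _ ()))))
      where
      body : ∀ (i : Fin len) s′ → registers s′ rS ≡ toℕ i → Frame loop′ s₀ s′ → I (toℕ i) s′ →
             Run (bestBody K) s′ (bestBodyTime K) (I (suc (toℕ i)))
      body i s′ i≡ f inv = assign-then (run-seq
        (run-for K J (λ _ → refl) id step (inv , (λ _ ()) , fzero , start)) after)
        where
        J : ℕ → State → Set
        J x s″ = I (toℕ i) s″ × (∀ j → toℕ j < x → registers s″ rMin ≤ gain S (toℕ i) j)
               × Σ[ j ∈ Fin K ] registers s″ rMin ≡ gain S (toℕ i) j
        s₁ = setRegister s′ rMin (arrays s′ aDigit (arrays s′ aBase (registers s′ rS) + K))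
        base≡ : arrays s′ aBase (registers s′ rS) ≡ (K + K) * toℕ i
        base≡ = trans (cong₂ (λ B r → B r) (array f aBase) i≡) (bases (toℕ i) (<⇒≤ (Fin.toℕ<n i)))
        start : arrays s′ aDigit (arrays s′ aBase (registers s′ rS) + K) ≡ gain S (toℕ i) fzero
        start = cong₂ (λ B c → B c) (array f aDigit) (cong₂ _+_ base≡ (sym (+-identityʳ K)))
        step : ∀ (j : Fin K) s″ → registers s″ rJ ≡ toℕ j → Frame (for rJ (lit K) (minStep K)) s₁ s″ → J (toℕ j) s″ →
               Run (minStep K) s″ 12 (J (suc (toℕ j)))
        step j s″ j≡ f′ (inv′ , low , j₀ , eq) = run-assign (inv′ , low′ , attained)
          where
          μ = registers s″ rMin
          q = arrays s″ aDigit (arrays s″ aBase (registers s″ rS) + (K + registers s″ rJ))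
          q≡ : q ≡ gain S (toℕ i) j
          q≡ = cong₂ (λ B c → B c) (trans (array f′ aDigit) (array f aDigit))
            (cong₂ _+_ (trans (cong₂ (λ B r → B r) (array f′ aBase) (register f′ rS)) base≡) (cong (K +_) j≡))
          low′ : ∀ j′ → toℕ j′ < suc (toℕ j) → μ ∸ (μ ∸ q) ≤ gain S (toℕ i) j′
          low′ j′ j′< rewrite m∸[m∸n]≡m⊓n μ q with j′ Fin.≟ j
          ... | yes refl = ≤-trans (m⊓n≤n μ q) (≤-reflexive q≡)
          ... | no j′≢j  = ≤-trans (m⊓n≤m μ q) (low j′ (≤∧≢⇒< (≤-pred j′<) (j′≢j ∘ Fin.toℕ-injective)))
          attained : Σ[ j′ ∈ Fin K ] μ ∸ (μ ∸ q) ≡ gain S (toℕ i) j′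
          attained with ⊓-sel μ q
          ... | inj₁ ≡μ = j₀ , trans (m∸[m∸n]≡m⊓n μ q) (trans ≡μ eq)
          ... | inj₂ ≡q = j , trans (m∸[m∸n]≡m⊓n μ q) (trans ≡q q≡)
        after : ∀ s″ → Frame (for rJ (lit K) (minStep K)) s₁ s″ → J K s″ → Run compare s″ 9 (I (suc (toℕ i)))
        after s″ f′ ((b< , low , high) , min-low , j₀ , min≡) = run-if
          (λ eq → run-skip (b< , low , high′ ≤-refl (m∸n≡0⇒m≤n eq)))
          (λ ≢0 → let value< = ≰⇒> {registers s″ rMin} {registers s″ rBestValue} (λ le → ≢0 (m≤n⇒m∸n≡0 le)) in
            assign-then (run-assign
              ( subst (_< len) (sym i≡′) (Fin.toℕ<n i)
              , (λ j → subst (λ r → registers s″ rMin ≤ gain S r j) (sym i≡′) (min-low j (Fin.toℕ<n j)))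
              , high′ (<⇒≤ value<) ≤-refl)))
          where
          i≡′ : registers s″ rS ≡ toℕ i
          i≡′ = trans (register f′ rS) i≡
          high′ : ∀ {b} → registers s″ rBestValue ≤ b → registers s″ rMin ≤ b →
                  ∀ i′ → i′ < suc (toℕ i) → Σ[ j ∈ Fin K ] gain S i′ j ≤ b
          high′ le le′ i′ i′< with m≤n⇒m<n∨m≡n (≤-pred i′<)
          ... | inj₂ refl = j₀ , ≤-trans (≤-reflexive (sym min≡)) le′
          ... | inj₁ i′<i with high i′ i′<i
          ...   | j , le″ = j , ≤-trans le″ le

  insert-other : ∀ {j v} (Y : Coloring K n) i w → ¬ (i ≡ j × w ≡ v) → insert j v Y i w ≡ Y i w
  insert-other {j} {v} Y i w ≢ = split (i Fin.≟ j)
    where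
    split : Dec (i ≡ j) → insert j v Y i w ≡ Y i w
    split (yes refl) = insert-vertex j Y i λ w≡v → ≢ (refl , w≡v)
    split (no i≢j)   = insert-class v Y w i≢j

  -- The invariant holds cell by cell: either the one has been written, rightly, or the current
  -- ancestor still agrees there with the coloring to be output. At the empty root the second case
  -- means absence.
  run-trace : ∀ {s X S seen len} → Table S seen (arrays s aParent) (arrays s aCell) len X → registers s rBest < len →
    (∀ c → arrays s aOut c ≡ 0) →
    Run trace s (traceTime W) (λ s′ → ∀ j w → arrays s′ aOut (cell j w) ≡ bit (X (registers s rBest) j w))
  run-trace {s} {X} {len = len} table b< blank = run-mono
    -- `b <` the length leaves room for the final test; a round costs 2 for the test and 7 for the
    -- body.
    (*-monoˡ-≤ 9 (≤-trans b< (≤-trans (Table.length≤ table) weight≤W))) finish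
    (run-whileᶠ {T₁ = 7} I (λ s′ → registers s′ rBest) step (b< , λ j w → inj₂ (blank _ , refl)))
    where
    b = registers s rBest
    I : State → Set
    I s′ = registers s′ rBest < len × (∀ j w → (arrays s′ aOut (cell j w) ≡ 1 × X b j w ≡ true)
                                             ⊎ (arrays s′ aOut (cell j w) ≡ 0 × X (registers s′ rBest) j w ≡ X b j w))
    finish : ∀ s′ → _ → I s′ × registers s′ rBest ≡ 0 → ∀ j w → arrays s′ aOut (cell j w) ≡ bit (X b j w)
    finish s′ _ ((_ , inv) , ≡0) j w with inv j w
    ... | inj₁ (out≡ , Xb) = trans out≡ (cong bit (sym Xb))
    ... | inj₂ (out≡ , X≡) = trans out≡ (cong bit (trans (sym (Table.root table j w)) (trans (cong (λ i → X i j w) (sym ≡0)) X≡)))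
    step : ∀ s′ → Frame traceBody s s′ → I s′ → registers s′ rBest ≢ 0 →
           Run traceBody s′ 7 (λ s″ → I s″ × registers s″ rBest < registers s′ rBest)
    step s′ f (c< , inv) ≢0 with Table.parent table (n≢0⇒n>0 ≢0) c<
    ... | par< , j₀ , v₀ , cell≡ , X≡ = store-then (run-assign ((subst (_< len) (sym par≡) (<-trans par< c<) , inv′) , subst (_< c) (sym par≡) par<))
      where
      c = registers s′ rBest
      par≡ : arrays s′ aParent c ≡ arrays s aParent c
      par≡ = cong (λ B → B c) (array f aParent)
      out = arrays s′ aOut
      e = arrays s′ aCell c
      e≡ : e ≡ cell j₀ v₀
      e≡ = trans (cong (λ B → B c) (array f aCell)) cell≡
      inv′ : ∀ j w → ((out [ e ↦ 1 ]) (cell j w) ≡ 1 × X b j w ≡ true)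
                   ⊎ ((out [ e ↦ 1 ]) (cell j w) ≡ 0 × X (arrays s′ aParent c) j w ≡ X b j w)
      inv′ j w = split (cell j w ≟ e)
        where
        split : Dec (cell j w ≡ e) → _
        split (yes eq) with cell-injective {i = j} {j₀} {w} {v₀} (trans eq e≡)
        ... | refl , refl = inj₁ (trans (cong (λ e → (out [ e ↦ 1 ]) (cell j w)) (sym eq)) (update-same out (cell j w) 1) , Xb)
          where
          Xb : X b j w ≡ true
          Xb with inv j w
          ... | inj₁ (_ , Xb) = Xb
          ... | inj₂ (_ , X≡b) = trans (sym X≡b) (trans (X≡ j w) (insert-new j w (X (arrays s aParent c))))
        split (no ≢e) with inv j w
        ... | inj₁ (out≡ , Xb) = inj₁ (trans (update-other out 1 ≢e) out≡ , Xb)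
        ... | inj₂ (out≡ , X≡b) = inj₂ (trans (update-other out 1 ≢e) out≡ ,
                trans (trans (cong (λ i → X i j w) par≡) (sym (trans (X≡ j w) (insert-other (X (arrays s aParent c)) j w λ { (refl , refl) → ≢e (sym e≡) })))) X≡b)

-- Running time

record _≲_ (f g : ℕ → ℕ → ℕ) : Set where
  constructor bounded
  field
    factor : ℕ
    bound  : ∀ n Q → f n Q ≤ factor * g n Q

infix 4 _≲_

Positive : (ℕ → ℕ → ℕ) → Set
Positive g = ∀ n Q → 1 ≤ g n Q

≲-refl : ∀ {g} → g ≲ g
≲-refl {g} = bounded 1 λ n Q → ≤-reflexive (sym (*-identityˡ (g n Q)))

≲-const : ∀ c {g} → Positive g → (λ _ _ → c) ≲ g
≲-const c {g} pos = bounded c λ n Q → m≤m*n c (g n Q) {{>-nonZero (pos n Q)}}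

≲-+ : ∀ {f f′ g} → f ≲ g → f′ ≲ g → (λ n Q → f n Q + f′ n Q) ≲ g
≲-+ {g = g} (bounded c b) (bounded c′ b′) = bounded (c + c′) λ n Q →
  ≤-trans (+-mono-≤ (b n Q) (b′ n Q)) (≤-reflexive (sym (*-distribʳ-+ (g n Q) c c′)))

≲-* : ∀ {f f′ g g′} → f ≲ g → f′ ≲ g′ → (λ n Q → f n Q * f′ n Q) ≲ (λ n Q → g n Q * g′ n Q)
≲-* {g = g} {g′} (bounded c b) (bounded c′ b′) = bounded (c * c′) λ n Q →
  ≤-trans (*-mono-≤ (b n Q) (b′ n Q)) (≤-reflexive (eq c (g n Q) c′ (g′ n Q)))
  where
  eq : ∀ a x b y → a * x * (b * y) ≡ a * b * (x * y)
  eq = solve-∀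

≲-weaken : ∀ {f g h} → (∀ n Q → g n Q ≤ h n Q) → f ≲ g → f ≲ h
≲-weaken g≤h (bounded c b) = bounded c λ n Q → ≤-trans (b n Q) (*-monoʳ-≤ c (g≤h n Q))

≲-for : ∀ {m f g h : ℕ → ℕ → ℕ} e → (λ n Q → suc (m n Q)) ≲ g → f ≲ h → Positive h →
        (λ n Q → forTime (m n Q) e (f n Q)) ≲ (λ n Q → g n Q * h n Q)
≲-for e m≲ f≲ pos = ≲-* m≲ (≲-+ f≲ (≲-const (cost e + 9) pos))

^-distribʳ-* : ∀ o m n → (m * n) ^ o ≡ m ^ o * n ^ o
^-distribʳ-* zero    m n = refl
^-distribʳ-* (suc o) m n = trans (cong (m * n *_) (^-distribʳ-* o m n)) (eq m n (m ^ o) (n ^ o))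
  where
  eq : ∀ a b c d → a * b * (c * d) ≡ a * c * (b * d)
  eq = solve-∀

module Times (k : ℕ) where

  private
    K = suc k

  stateBound budget : ℕ → ℕ → ℕ
  stateBound n Q = suc n ^ K * suc Q ^ K
  budget n Q = suc n ^ (K + 2) * suc Q ^ K

  totalTime : ℕ → ℕ → ℕ
  totalTime n Q =
    (2 + forTime (n + K) (reg rN ⊕ lit K) 7) + (forTime n (reg rN) 6 + (orientTime n + (rankTime n + (radixTime K n +
    (mulTableTime (K + K) (suc n * suc Q) + (dynamicTime K n (stateBound n Q) + (bestTime K (stateBound n Q) +
    traceTime (stateBound n Q))))))))

  private
    N NN NNN NQ NNM : ℕ → ℕ → ℕ
    N n Q = suc n
    NN n Q = suc n * suc n
    NNN n Q = suc n * suc n * suc n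
    NQ n Q = suc n * suc Q
    NNM n Q = suc n * (suc n * stateBound n Q)

    state-pos : Positive stateBound
    state-pos n Q = *-mono-≤ (m^n>0 (suc n) K) (m^n>0 (suc Q) K)

    N≤state : ∀ n Q → suc n ≤ stateBound n Q
    N≤state n Q = ≤-trans (m≤m*n (suc n) (suc n ^ k) {{m^n≢0 (suc n) k}}) (m≤m*n (suc n ^ K) (suc Q ^ K) {{m^n≢0 (suc Q) K}})

    budget≡ : ∀ n Q → NNM n Q ≡ budget n Q
    budget≡ n Q = trans (eq (suc n) (suc n ^ K) (suc Q ^ K)) (cong (_* suc Q ^ K) (sym (^-distribˡ-+-* (suc n) K 2)))
      where
      eq : ∀ a b c → a * (a * (b * c)) ≡ b * (a * (a * 1)) * c
      eq = solve-∀

    NNM≤ : ∀ n Q → NNM n Q ≤ budget n Q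
    NNM≤ n Q = ≤-reflexive (budget≡ n Q)

    state≤ : ∀ n Q → stateBound n Q ≤ budget n Q
    state≤ n Q = ≤-trans (≤-trans (m≤n*m (stateBound n Q) (suc n)) (m≤n*m (suc n * stateBound n Q) (suc n))) (NNM≤ n Q)

    N≤ : ∀ n Q → N n Q ≤ budget n Q
    N≤ n Q = ≤-trans (N≤state n Q) (state≤ n Q)

    -- Here the cubic orientation phase is paid for: `K` is at least 1, so one factor `suc n` is
    -- contained in `stateBound`.
    NNN≤ : ∀ n Q → NNN n Q ≤ budget n Q
    NNN≤ n Q = ≤-trans (≤-reflexive (*-assoc (suc n) (suc n) (suc n)))
      (≤-trans (*-monoʳ-≤ (suc n) (*-monoʳ-≤ (suc n) (N≤state n Q))) (NNM≤ n Q))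

    NN≤ : ∀ n Q → NN n Q ≤ budget n Q
    NN≤ n Q = ≤-trans (m≤m*n (NN n Q) (suc n)) (NNN≤ n Q)

    NQ≤ : ∀ n Q → NQ n Q ≤ budget n Q
    NQ≤ n Q = ≤-trans (*-mono-≤ (m≤m*n (suc n) (suc n ^ k) {{m^n≢0 (suc n) k}}) (m≤m*n (suc Q) (suc Q ^ k) {{m^n≢0 (suc Q) k}}))
      (state≤ n Q)

    budget-pos : Positive budget
    budget-pos n Q = ≤-trans (s≤s z≤n) (N≤ n Q)

    sn≲ : (λ n Q → suc n) ≲ N
    sn≲ = ≲-refl
    const-N : ∀ c → (λ n Q → c) ≲ N
    const-N c = ≲-const c λ n Q → s≤s z≤n
    const : ∀ c → (λ n Q → c) ≲ budget
    const c = ≲-const c budget-pos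
    one : ℕ → ℕ → ℕ
    one _ _ = 1
    one-pos : Positive one
    one-pos _ _ = ≤-refl
    N1≤N : ∀ n Q → suc n * 1 ≤ N n Q
    N1≤N n Q = ≤-reflexive (*-identityʳ (suc n))
    for-N : ∀ c e → (λ n Q → forTime n e c) ≲ N
    for-N c e = ≲-weaken N1≤N (≲-for {λ n Q → n} {λ _ _ → c} {N} {one} e sn≲ (≲-const c one-pos) one-pos)
    N-pos : Positive N
    N-pos n Q = s≤s z≤n

    rows≲ : (λ n Q → 2 + forTime (n + K) (reg rN ⊕ lit K) 7) ≲ budget
    rows≲ = ≲-+ (const 2) (≲-weaken {g = N} N≤ (≲-weaken N1≤N (≲-for {λ n Q → n + K} {λ _ _ → 7} {N} {one} (reg rN ⊕ lit K) (bounded (suc K) le) (≲-const 7 one-pos) one-pos)))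
      where
      le : ∀ n Q → suc (n + K) ≤ suc K * suc n
      le n Q = ≤-trans (m≤m+n (suc (n + K)) (K * n)) (≤-reflexive (eq n K))
        where
        eq : ∀ n K → suc (n + K) + K * n ≡ suc K * suc n
        eq = solve-∀

    pop≲ : (λ n Q → popTime n) ≲ N
    pop≲ = ≲-+ (const-N 10) (for-N (4 + (24 + pushTime)) (reg rN))

    step≲ : (λ n Q → 8 + stepTime n) ≲ N
    step≲ = ≲-+ {f′ = λ n Q → popTime n} (const-N (12 + seedTime)) pop≲

    orient≲ : (λ n Q → orientTime n) ≲ budget
    orient≲ = ≲-+ {f′ = λ n Q → suc (n * n + n * n) * (8 + stepTime n)} (const 8) (≲-weaken NNN≤
      (≲-* {λ n Q → suc (n * n + n * n)} {λ n Q → 8 + stepTime n} {λ n Q → suc n * suc n} {N} (bounded 2 le) step≲))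
      where
      le : ∀ n Q → suc (n * n + n * n) ≤ 2 * (suc n * suc n)
      le n Q = ≤-trans (m≤m+n _ (1 + 4 * n)) (≤-reflexive (eq n))
        where
        eq : ∀ n → suc (n * n + n * n) + (1 + 4 * n) ≡ 2 * (suc n * suc n)
        eq = solve-∀

    column≲ : (λ n Q → 2 + (accumulateTime n (aArc ⟦ rU ∙ rV ⟧) + 3)) ≲ N
    column≲ = ≲-+ (const-N 2) (≲-+ {λ n Q → accumulateTime n (aArc ⟦ rU ∙ rV ⟧)} (for-N (3 + cost (aArc ⟦ rU ∙ rV ⟧)) (reg rN)) (const-N 3))

    rank≲ : (λ n Q → rankTime n) ≲ budget
    rank≲ = ≲-weaken NN≤ (≲-for {λ n Q → n} {g = N} {N} (reg rN) sn≲ column≲ N-pos)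

    row≲ : (λ n Q → 7 + (accumulateTime n (aProfit ⟦ rJ ∙ rU ⟧) + 5)) ≲ N
    row≲ = ≲-+ (const-N 7) (≲-+ {λ n Q → accumulateTime n (aProfit ⟦ rJ ∙ rU ⟧)} (for-N (3 + cost (aProfit ⟦ rJ ∙ rU ⟧)) (reg rN)) (const-N 5))

    radix≲ : (λ n Q → radixTime K n) ≲ budget
    radix≲ = ≲-weaken (λ n Q → ≤-trans (≤-reflexive (*-identityˡ (suc n))) (N≤ n Q))
      (≲-for {λ _ _ → K} {g = one} {N} (lit K) (≲-const (suc K) one-pos) row≲ N-pos)

    twice : ∀ {g} → Positive g → (λ n Q → suc (g n Q)) ≲ g
    twice {g} pos = bounded 2 λ n Q → ≤-trans (+-monoˡ-≤ (g n Q) (pos n Q)) (≤-reflexive (cong (g n Q +_) (sym (+-identityʳ (g n Q)))))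

    loop≲ : ∀ {g} c e → Positive g → (λ n Q → forTime (g n Q) e c) ≲ g
    loop≲ {g} c e pos = ≲-weaken (λ n Q → ≤-reflexive (*-identityʳ (g n Q)))
      (≲-for {g} {λ _ _ → c} {g} {one} e (twice pos) (≲-const c one-pos) one-pos)

    NQ-pos : Positive NQ
    NQ-pos n Q = s≤s z≤n

    mulRow≲ : (λ n Q → 5 + (forTime (suc n * suc Q) (aRadix ⟦ reg rJ ⟧) 9 + 7)) ≲ NQ
    mulRow≲ = ≲-+ (≲-const 5 NQ-pos) (≲-+ {λ n Q → forTime (suc n * suc Q) (aRadix ⟦ reg rJ ⟧) 9}
      (loop≲ {NQ} 9 (aRadix ⟦ reg rJ ⟧) NQ-pos) (≲-const 7 NQ-pos))

    mulTable≲ : (λ n Q → mulTableTime (K + K) (suc n * suc Q)) ≲ budget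
    mulTable≲ = ≲-+ (const 4) (≲-weaken (λ n Q → ≤-trans (≤-reflexive (*-identityˡ (NQ n Q))) (NQ≤ n Q))
      (≲-for {λ _ _ → K + K} {g = one} {NQ} (lit (K + K)) (≲-const (suc (K + K)) one-pos) mulRow≲ NQ-pos))

    process≲ : (λ n Q → processTime K (stateBound n Q)) ≲ stateBound
    process≲ = ≲-+ {λ _ _ → 2} {λ n Q → forTime (stateBound n Q) (reg rLen₀) (forTime K (lit K) (candidateTime K))} (≲-const 2 state-pos) (loop≲ {stateBound} (forTime K (lit K) (candidateTime K)) (reg rLen₀) state-pos)

    visit≲ : (λ n Q → visitTime K (stateBound n Q)) ≲ stateBound
    visit≲ = ≲-+ {λ _ _ → 10} {λ n Q → processTime K (stateBound n Q) + 1} (≲-const 10 state-pos) (≲-+ {λ n Q → processTime K (stateBound n Q)} process≲ (≲-const 1 state-pos))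

    dynamic≲ : (λ n Q → dynamicTime K n (stateBound n Q)) ≲ budget
    dynamic≲ = ≲-+ {λ _ _ → 11} {λ n Q → forTime (n + 1) (reg rN ⊕ lit 1) (forTime n (reg rN) (visitTime K (stateBound n Q)))} (const 11) (≲-weaken NNM≤
      (≲-for {λ n Q → n + 1} {λ n Q → forTime n (reg rN) (visitTime K (stateBound n Q))} {N} {λ n Q → suc n * stateBound n Q}
        (reg rN ⊕ lit 1) (bounded 2 λ n Q → ≤-trans (m≤m+n (suc (n + 1)) n) (≤-reflexive (eq n)))
        (≲-for {λ n Q → n} {g = N} {stateBound} (reg rN) sn≲ visit≲ state-pos)
        (λ n Q → *-mono-≤ {1} {suc n} (s≤s z≤n) (state-pos n Q))))
      where
      eq : ∀ n → suc (n + 1) + n ≡ 2 * suc n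
      eq = solve-∀

    best≲ : (λ n Q → bestTime K (stateBound n Q)) ≲ budget
    best≲ = ≲-+ {λ _ _ → 4} {λ n Q → forTime (stateBound n Q) (reg rLen) (bestBodyTime K)} (const 4) (≲-weaken state≤ (loop≲ {stateBound} (bestBodyTime K) (reg rLen) state-pos))

    trace≲ : (λ n Q → traceTime (stateBound n Q)) ≲ budget
    trace≲ = ≲-weaken state≤ (bounded 9 λ n Q → ≤-reflexive (*-comm (stateBound n Q) 9))

  totalTime≲ : totalTime ≲ budget
  totalTime≲ = ≲-+ rows≲ (≲-+ {λ n Q → forTime n (reg rN) 6} (≲-weaken N≤ (for-N 6 (reg rN)))
    (≲-+ {λ n Q → orientTime n} orient≲ (≲-+ {λ n Q → rankTime n} rank≲ (≲-+ {λ n Q → radixTime K n} radix≲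
    (≲-+ {λ n Q → mulTableTime (K + K) (suc n * suc Q)} mulTable≲ (≲-+ {λ n Q → dynamicTime K n (stateBound n Q)} dynamic≲
    (≲-+ {λ n Q → bestTime K (stateBound n Q)} {λ n Q → traceTime (stateBound n Q)} best≲ trace≲)))))))

  abstract
    totalTime-bound : Σ[ c ∈ ℕ ] (∀ n Q → 1 ≤ n → totalTime n Q ≤ c * (n ^ (K + 2) * (Q + 1) ^ K))
    totalTime-bound = c * 2 ^ (K + 2) , λ n Q 1≤n → begin
      totalTime n Q                                 ≤⟨ _≲_.bound totalTime≲ n Q ⟩
      -- `suc n ≤ n + n` is where `1 ≤ n` enters, and the source of the factor `2 ^ (K + 2)`.
      c * (suc n ^ (K + 2) * suc Q ^ K)             ≤⟨ *-monoʳ-≤ c (*-monoˡ-≤ (suc Q ^ K) (^-monoˡ-≤ (K + 2) (+-monoˡ-≤ n 1≤n))) ⟩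
      c * ((n + n) ^ (K + 2) * suc Q ^ K)           ≡⟨ cong (λ x → c * (x ^ (K + 2) * suc Q ^ K)) (cong (n +_) (sym (+-identityʳ n))) ⟩
      c * ((2 * n) ^ (K + 2) * suc Q ^ K)           ≡⟨ cong₂ (λ x y → c * (x * y ^ K)) (^-distribʳ-* (K + 2) 2 n) (+-comm 1 Q) ⟩
      c * (2 ^ (K + 2) * n ^ (K + 2) * (Q + 1) ^ K) ≡⟨ eq c (2 ^ (K + 2)) (n ^ (K + 2)) ((Q + 1) ^ K) ⟩
      c * 2 ^ (K + 2) * (n ^ (K + 2) * (Q + 1) ^ K) ∎
      where
      open ≤-Reasoning
      c : ℕ
      c = _≲_.factor totalTime≲
      eq : ∀ a b x y → a * (b * x * y) ≡ a * b * (x * y)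
      eq = solve-∀

-- The number of keys, optimality and the assembled solver.

weight-≤ : ∀ A a x → (∀ y → y < x → A y ≤ a) → weight A x ≤ a ^ x
weight-≤ A a zero    A≤ = ≤-refl
weight-≤ A a (suc x) A≤ = *-mono-≤ (A≤ x (n<1+n x)) (weight-≤ A a x λ y y< → A≤ y (m<n⇒m<1+n y<))

-- Splits the weight between vertex digits and profit digits, which have different radix bounds.
weight-+ : ∀ A b k x → (∀ y → y < x → A (k + y) ≤ b) → weight A (k + x) ≤ weight A k * b ^ x
weight-+ A b k zero    A≤ rewrite +-identityʳ k = ≤-reflexive (sym (*-identityʳ (weight A k)))
weight-+ A b k (suc x) A≤ rewrite +-suc k x = begin
  A (k + x) * weight A (k + x)  ≤⟨ *-mono-≤ (A≤ x (n<1+n x)) (weight-+ A b k x λ y y< → A≤ y (m<n⇒m<1+n y<)) ⟩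
  b * (weight A k * b ^ x)      ≡⟨ eq b (weight A k) (b ^ x) ⟩
  weight A k * (b * b ^ x)      ∎
  where
  open ≤-Reasoning
  eq : ∀ a b c → a * (b * c) ≡ b * (a * c)
  eq = solve-∀

maximum-≥ : ∀ {k} (f : Vector ℕ k) j → f j ≤ maximum f
maximum-≥ f fzero    = m≤m⊔n _ _
maximum-≥ f (fsuc j) = ≤-trans (maximum-≥ (f ∘ fsuc) j) (m≤n⊔m _ _)

minimum-≤ : ∀ {k} (f : Vector ℕ (suc k)) j → minimum f ≤ f j
minimum-≤ f = λ { fzero → below-seed (f ∘ fsuc) ; (fsuc j) → below-entry (f ∘ fsuc) j }
  where
  below-seed : ∀ {k} (g : Vector ℕ k) → foldr _⊓_ (f fzero) g ≤ f fzero
  below-seed {zero}  g = ≤-refl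
  below-seed {suc k} g = ≤-trans (m⊓n≤n _ _) (below-seed (g ∘ fsuc))
  below-entry : ∀ {k} (g : Vector ℕ k) j → foldr _⊓_ (f fzero) g ≤ g j
  below-entry g fzero    = m⊓n≤m _ _
  below-entry g (fsuc j) = ≤-trans (m⊓n≤n _ _) (below-entry (g ∘ fsuc) j)

minimum-glb : ∀ {k c} (f : Vector ℕ (suc k)) → (∀ j → c ≤ f j) → c ≤ minimum f
minimum-glb {c = c} f c≤ = go (f ∘ fsuc) (c≤ ∘ fsuc)
  where
  go : ∀ {k} (g : Vector ℕ k) → (∀ j → c ≤ g j) → c ≤ foldr _⊓_ (f fzero) g
  go {zero}  g c≤g = c≤ fzero
  go {suc k} g c≤g = ⊓-glb (c≤g fzero) (go (g ∘ fsuc) (c≤g ∘ fsuc))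

sum≤maxTotalProfit : ∀ {k n} (p : Profits k n) j → sum (p j) ≤ maxTotalProfit p
sum≤maxTotalProfit {n = n} p j = ≤-trans
  (≤-reflexive (sum-cong λ v → cong (if_then p j v else 0) (sym (lookup-replicate v true))))
  (maximum-≥ (λ j → profit (p j) ⊤) j)

valid⇒partialColoring : ∀ {k n} {G : Graph n} {Y : Coloring k n} → Valid G Y → IsPartialColoring G (λ j → tabulate (Y j))
valid⇒partialColoring {Y = Y} valid = record
  { independent = λ j u∈ v∈ → Valid.independent valid (member u∈) (member v∈)
  ; disjoint    = λ { i≢j (v , v∈) → let v∈i , v∈j = x∈p∩q⁻ _ _ v∈ in i≢j (Valid.disjoint valid (member v∈i) (member v∈j)) }
  }
  where
  member : ∀ {j v} → v ∈ tabulate (Y j) → Y j v ≡ true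
  member {j} {v} v∈ = trans (sym (lookup∘tabulate (Y j) v)) ([]=⇒lookup v∈)

partialColoring⇒valid : ∀ {k n} {G : Graph n} {X : Vector (Subset n) k} → IsPartialColoring G X → Valid G (λ j → lookup (X j))
partialColoring⇒valid {X = X} coloring = record
  { independent = λ {j} {w} {w′} Xw Xw′ → independent j (lookup⇒[]= w (X j) Xw) (lookup⇒[]= w′ (X j) Xw′)
  ; disjoint    = disjoint′
  }
  where
  open IsPartialColoring coloring
  disjoint′ : ∀ {i j w} → lookup (X i) w ≡ true → lookup (X j) w ≡ true → i ≡ j
  disjoint′ {i} {j} {w} Xi Xj with i Fin.≟ j
  ... | yes i≡j = i≡j
  ... | no i≢j  = ⊥-elim (disjoint i≢j (w , x∈p∩q⁺ (lookup⇒[]= w (X i) Xi , lookup⇒[]= w (X j) Xj)))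

-- In-degrees increase along the arcs of a transitive orientation, so sorting by
-- in-degree, ties broken by index, is a topological order.
module Topological {n : ℕ} {H : Graph n} {D : ℕ → ℕ} (o : OrientedBy H D) where

  position : Fin n → ℕ
  position v = n * inDegree D v + toℕ v

  private
    next-row : ∀ (v : Fin n) d → n * d + toℕ v < n * suc d
    next-row v d = subst (n * d + toℕ v <_) (trans (+-comm (n * d) n) (sym (*-suc n d))) (+-monoʳ-< (n * d) (Fin.toℕ<n v))

  position-injective : ∀ {u v} → position u ≡ position v → u ≡ v
  position-injective {u} {v} eq = Fin.toℕ-injective (proj₁ (+*-injective {b = inDegree D u} {inDegree D v} (Fin.toℕ<n u) (Fin.toℕ<n v)
    (trans (swap u) (trans eq (sym (swap v))))))
    where
    swap : ∀ w → toℕ w + inDegree D w * n ≡ position w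
    swap w = trans (+-comm (toℕ w) _) (cong (_+ toℕ w) (*-comm (inDegree D w) n))

  position-mono : ∀ {u v} → D (cell u v) ≡ 1 → position u < position v
  position-mono {u} {v} uv = <-≤-trans (next-row u (inDegree D u))
    (≤-trans (*-monoʳ-≤ n (inDegree-mono {H = H} o {u} {v} uv)) (m≤m+n _ (toℕ v)))

  position< : ∀ v → position v < n * (n + 1)
  position< v = <-≤-trans (next-row v (inDegree D v))
    (*-monoʳ-≤ n (≤-trans (s≤s (inDegree≤n {H = H} o v)) (≤-reflexive (+-comm 1 n))))

solver : ℕ → Program
solver k =
  rowTable k ⨾ diagonal ⨾ orient ⨾ ranks ⨾ radices k ⨾ mulTable (k + k) ⨾ dynamic k ⨾ best k ⨾ trace

module Solver {k n : ℕ} (G : Graph n) (p : Profits (suc k) n)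
              {_⟶_ : Fin n → Fin n → Set} (F : IsTransitiveOrientation (complement G) _⟶_) where

  open Times k

  private
    K = suc k
    Q = maxTotalProfit p
    s₀ = input G p

  Solved : State → Set
  Solved s = Σ[ X ∈ Vector (Subset n) K ] (Outputs s X × IsOptimal G p X)

  module _ {D A : ℕ → ℕ} (o : OrientedBy (complement G) D) (rad : Radices p A) where

    open Topological {H = complement G} o
    open States G p D o
    open Ordered position position-injective position-mono
    open Tables G p D o A rad

    -- A product instead of a maximum is a crude common bound, but the table of multiples still fits
    -- the budget.
    radix≤ : ∀ x → x < K + K → A x ≤ suc n * suc Q
    radix≤ x x< with digit-cases {K} x x<
    ... | inj₁ (j , refl) = ≤-trans (≤-reflexive (proj₁ (rad j))) (m≤m*n (suc n) (suc Q))
    ... | inj₂ (j , refl) = ≤-trans (≤-reflexive (proj₂ (rad j))) (≤-trans (s≤s (sum≤maxTotalProfit p j)) (m≤n*m (suc Q) (suc n)))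

    weight≤ : weight A (K + K) ≤ stateBound n Q
    weight≤ = ≤-trans (weight-+ A (suc Q) K K high) (*-monoˡ-≤ (suc Q ^ K) (weight-≤ A (suc n) K low))
      where
      low : ∀ y → y < K → A y ≤ suc n
      low y y< = subst (λ y → A y ≤ suc n) (Fin.toℕ-fromℕ< y<) (≤-reflexive (proj₁ (rad (fromℕ< y<))))
      high : ∀ y → y < K → A (K + y) ≤ suc Q
      high y y< = subst (λ y → A (K + y) ≤ suc Q) (Fin.toℕ-fromℕ< y<)
        (≤-trans (≤-reflexive (proj₂ (rad (fromℕ< y<)))) (s≤s (sum≤maxTotalProfit p (fromℕ< y<))))

    open Dynamic G p D o A rad using (StaticAt)
    open Exploration G p D o A rad position position-injective position-mono (stateBound n Q) weight≤
    open Readout G p D o A rad (stateBound n Q) weight≤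

    restrict-all : ∀ Y j w → restrict (n * (n + 1)) Y j w ≡ Y j w
    restrict-all Y j w = trans (cong (Y j w ∧_) (<⇒<ᵇ≡true (position< w))) (Bool.∧-identityʳ (Y j w))

    -- A competitor `Y` is described by some state `i`. Its satisfaction is at most the gain of the
    -- class `j` of that state which no class of the best state falls below.
    optimal : ∀ {S seen par cel base len b} (inv : Inv (n * (n + 1)) S seen par cel base len) → b < len →
      (∀ i → i < len → Σ[ j ∈ Fin K ] (∀ j′ → gain S i j ≤ gain S b j′)) →
      IsOptimal G p (λ j → tabulate (Inv.X inv b j))
    optimal {S} {b = b} inv b< best = record
      { isPartialColoring = valid⇒partialColoring (Sound.valid sound)
      ; maximal = λ Y coloring → minimum-glb (λ j → profit (p j) (tabulate (X b j))) (λ j′ → beaten Y coloring j′)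
      }
      where
      open Inv inv
      sound = Table.sound table b<
      beaten : ∀ Y → IsPartialColoring G Y → ∀ j′ → satisfaction p Y ≤ profit (p j′) (tabulate (X b j′))
      beaten Y coloring j′ with complete (λ j → lookup (Y j)) (partialColoring⇒valid coloring)
      ... | i , i< , desc with best i i<
      ...   | j , le = begin
        satisfaction p Y                               ≤⟨ minimum-≤ (λ j → profit (p j) (Y j)) j ⟩
        profit (p j) (Y j)                             ≡⟨ value-cong (p j) (restrict-all (λ j → lookup (Y j)) j) ⟨
        value (p j) (restrict (n * (n + 1)) (λ j → lookup (Y j)) j) ≡⟨ Describes.profit≡ desc j ⟨
        gain S i j                                     ≤⟨ le j′ ⟩
        gain S b j′                                    ≡⟨ Describes.profit≡ (Sound.describes sound) j′ ⟩
        value (p j′) (X b j′)                          ≡⟨ value-cong (p j′) (λ w → sym (lookup∘tabulate (X b j′) w)) ⟩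
        profit (p j′) (tabulate (X b j′))              ∎
        where open ≤-Reasoning

    run-search : ∀ {s} → StaticAt s → (∀ v → arrays s aRank (toℕ v) ≡ inDegree {n} D v) →
      (∀ c → arrays s aDigit c ≡ 0) → (∀ c → arrays s aSeen c ≡ 0) → (∀ c → arrays s aOut c ≡ 0) →
      Run (dynamic K ⨾ best K ⨾ trace) s
          (dynamicTime K n (stateBound n Q) + (bestTime K (stateBound n Q) + traceTime (stateBound n Q))) Solved
    run-search {s} static rank≡ digit0 seen0 out0 = run-seq
      (run-dynamic static (λ v → cong (λ d → n * d + toℕ v) (sym (rank≡ v))) digit0 seen0)
      λ s₁ f₁ inv → run-seq (run-best (Inv.table inv) (Inv.bases inv))
      λ { s₂ f₂ (b< , high) → run-mono ≤-refl
          (λ s₃ f₃ out → (λ j → tabulate (Inv.X inv (registers s₂ rBest) j))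
            , (λ j v → trans (out j v) (cong bit (sym (lookup∘tabulate (Inv.X inv (registers s₂ rBest) j) v))))
            , optimal inv b< high)
          (run-trace {S = arrays s₁ aDigit} (table-transport {S′ = arrays s₁ aDigit} (λ _ _ _ → refl) refl (array f₂ aParent) (array f₂ aCell) refl (Inv.table inv)) b<
            (λ c → trans (cong (λ B → B c) (trans (array f₂ aOut) (array f₁ aOut))) (out0 c))) }

  private
    fromDiagonalTime fromOrientTime fromRanksTime fromRadicesTime fromMulTableTime : ℕ
    fromMulTableTime = mulTableTime (K + K) (suc n * suc Q) + (dynamicTime K n (stateBound n Q)
       + (bestTime K (stateBound n Q) + traceTime (stateBound n Q)))
    fromRadicesTime = radixTime K n + fromMulTableTime
    fromRanksTime = rankTime n + fromRadicesTime
    fromOrientTime = orientTime n + fromRanksTime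
    fromDiagonalTime = forTime n (reg rN) 6 + fromOrientTime

    fromMulTable fromRadices fromRanks fromOrient fromDiagonal : Program
    fromMulTable = mulTable (K + K) ⨾ dynamic K ⨾ best K ⨾ trace
    fromRadices = radices K ⨾ fromMulTable
    fromRanks = ranks ⨾ fromRadices
    fromOrient = orient ⨾ fromRanks
    fromDiagonal = diagonal ⨾ fromOrient

    -- Arrays that have to be blank when the dynamic program starts; they are blank in the input,
    -- and the earlier phases do not write them.
    Fresh : State → Set
    Fresh s = (∀ c → arrays s aDigit c ≡ 0) × (∀ c → arrays s aSeen c ≡ 0) × (∀ c → arrays s aOut c ≡ 0)

    fresh-frame : ∀ P {s s′} {_ : T (not (writesArray P aDigit))} {_ : T (not (writesArray P aSeen))}
      {_ : T (not (writesArray P aOut))} → Frame P s s′ → Fresh s → Fresh s′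
    fresh-frame P {_} {_} {h₁} {h₂} {h₃} f (digit0 , seen0 , out0) =
        (λ c → trans (cong (λ B → B c) (array f aDigit {h₁})) (digit0 c))
      , (λ c → trans (cong (λ B → B c) (array f aSeen {h₂})) (seen0 c))
      , (λ c → trans (cong (λ B → B c) (array f aOut {h₃})) (out0 c))

    record Ready (s : State) : Set where
      field
        n≡    : registers s rN ≡ n
        rows  : ∀ i → i < n + K → arrays s aRow i ≡ n * i
        prof≡ : ∀ j v → arrays s aProfit (cell j v) ≡ p j v
        fresh : Fresh s

      rowsₙ : Rows n n (arrays s aRow)
      rowsₙ i = rows (toℕ i) (<-≤-trans (Fin.toℕ<n i) (m≤m+n n K))
      rowsₖ : Rows n K (arrays s aRow)
      rowsₖ i = rows (toℕ i) (<-≤-trans (Fin.toℕ<n i) (m≤n+m K n))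

    ready-frame : ∀ P {s s′} {_ : T (not (writesRegister P rN))} {_ : T (not (writesArray P aRow))}
      {_ : T (not (writesArray P aProfit))} {_ : T (not (writesArray P aDigit))} {_ : T (not (writesArray P aSeen))}
      {_ : T (not (writesArray P aOut))} → Frame P s s′ → Ready s → Ready s′
    ready-frame P {_} {_} {h₁} {h₂} {h₃} {h₄} {h₅} {h₆} f ready = record
      { n≡    = trans (register f rN {h₁}) n≡
      ; rows  = λ i i< → trans (cong (λ B → B i) (array f aRow {h₂})) (rows i i<)
      ; prof≡ = λ j v → trans (cong (λ B → B (cell j v)) (array f aProfit {h₃})) (prof≡ j v)
      ; fresh = fresh-frame P {_} {_} {h₄} {h₅} {h₆} f fresh
      }
      where open Ready ready

    run-fromMulTable : ∀ {s D} → Ready s → (o : OrientedBy (complement G) D) → (∀ c → arrays s aArc c ≡ D c) →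
      (∀ v → arrays s aRank (toℕ v) ≡ inDegree {n} D v) → Radices p (arrays s aRadix) → Run fromMulTable s fromMulTableTime Solved
    run-fromMulTable ready o arc≡ rank≡ rad = run-seq (run-mulTable (K + K) (suc n * suc Q) (radix≤ o rad)) λ s′ f products →
      let open Ready (ready-frame (mulTable (K + K)) f ready)
          digit0 , seen0 , out0 = fresh
      in run-search o rad
        (record
          { n≡ = n≡ ; rowsₙ = rowsₙ ; rowsₖ = rowsₖ ; prof≡ = prof≡ ; products = products
          ; arc≡ = λ c → trans (cong (λ B → B c) (array f aArc)) (arc≡ c) })
        (λ v → trans (cong (λ B → B (toℕ v)) (array f aRank)) (rank≡ v)) digit0 seen0 out0

    run-fromRadices : ∀ {s D} → Ready s → OrientedBy (complement G) D → (∀ c → arrays s aArc c ≡ D c) →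
      (∀ v → arrays s aRank (toℕ v) ≡ inDegree {n} D v) → Run fromRadices s fromRadicesTime Solved
    run-fromRadices ready o arc≡ rank≡ = run-seq (run-radices p n≡ rowsₖ prof≡) λ s′ f →
      run-fromMulTable (ready-frame (radices K) f ready) o (λ c → trans (cong (λ B → B c) (array f aArc)) (arc≡ c))
        (λ v → trans (cong (λ B → B (toℕ v)) (array f aRank)) (rank≡ v))
      where open Ready ready

    run-fromRanks : ∀ {s} → Ready s → OrientedBy (complement G) (arrays s aArc) → Run fromRanks s fromRanksTime Solved
    run-fromRanks ready o = run-seq (run-ranks n≡ rowsₙ) λ s′ f →
      run-fromRadices (ready-frame ranks f ready) o (λ c → cong (λ B → B c) (array f aArc))
      where open Ready ready

    run-fromOrient : ∀ {s} → Ready s → NonEdges (complement G) (arrays s aAdj) → (∀ c → arrays s aArc c ≡ 0) → Run fromOrient s fromOrientTime Solved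
    run-fromOrient ready nonEdges blank = run-seq (Orient.run-orient F n≡ rowsₙ nonEdges blank) λ s′ f →
      run-fromRanks (ready-frame orient f ready)
      where open Ready ready

    run-fromDiagonal : ∀ {s} → Ready s → (∀ u v → arrays s aAdj (cell u v) ≡ bit (adj G u v)) → (∀ c → arrays s aArc c ≡ 0) → Run fromDiagonal s fromDiagonalTime Solved
    run-fromDiagonal ready A≡ blank = run-seq (run-diagonal G n≡ rowsₙ A≡) λ s′ f nonEdges →
      run-fromOrient (ready-frame diagonal f ready) nonEdges (λ c → trans (cong (λ B → B c) (array f aArc)) (blank c))
      where open Ready ready

  run-solver : Run (solver K) s₀ (totalTime n Q) Solved
  run-solver = run-seq {T₂ = fromDiagonalTime} (run-rowTable K refl) λ s′ f rows → run-fromDiagonal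
    (record { n≡ = register f rN ; rows = rows
            ; prof≡ = λ j v → trans (cong (λ B → B (cell j v)) (array f aProfit)) (matrix-cell p j v)
            ; fresh = fresh-frame (rowTable K) f ((λ _ → refl) , (λ _ → refl) , (λ _ → refl)) })
    (λ u v → trans (cong (λ B → B (cell u v)) (array f aAdj)) (matrix-cell (λ u v → bit (adj G u v)) u v))
    (λ c → cong (λ B → B c) (array f aArc))

  Solution : ℕ → Set
  Solution T = ∃[ t ] ∃[ s ] ∃[ X ] (⟪ solver K , s₀ ⟫⇓[ t ] s × Outputs s X × IsOptimal G p X × t ≤ T)

  solution : ∀ {T} → Run (solver K) s₀ T Solved → Solution T
  solution (run {t} {s} halts fast (X , outputs , optimal)) = t , s , X , halts , outputs , optimal , fast

theorem5 : (k : ℕ) .{{_ : NonZero k}} →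
    ∃[ P ] ∃[ c ]
    ((n : ℕ) (G : Graph n) (p : Profits k n) → IsCocomparability G →
    ∃[ t ] ∃[ s ] ∃[ X ]
    (⟪ P , input G p ⟫⇓[ t ] s
    × Outputs s X
    × IsOptimal G p X
    × (1 ≤ n → t ≤ c * (n ^ (k + 2) * (maxTotalProfit p + 1) ^ k))))
theorem5 zero {{k≢0}} = ⊥-elim-irr (NonZero.nonZero k≢0)
theorem5 (suc k) = solver (suc k) , proj₁ (Times.totalTime-bound k) , λ n G p cocomparability →
  conclude n G p (Solver.solution G p (proj₂ cocomparability) (Solver.run-solver G p (proj₂ cocomparability)))
  where
  conclude : ∀ n (G : Graph n) (p : Profits (suc k) n) →
    ∃[ t ] ∃[ s ] ∃[ X ] (⟪ solver (suc k) , input G p ⟫⇓[ t ] s × Outputs s X × IsOptimal G p X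
      × t ≤ Times.totalTime k n (maxTotalProfit p)) →
    ∃[ t ] ∃[ s ] ∃[ X ] (⟪ solver (suc k) , input G p ⟫⇓[ t ] s × Outputs s X × IsOptimal G p X
      × (1 ≤ n → t ≤ proj₁ (Times.totalTime-bound k) * (n ^ (suc k + 2) * (maxTotalProfit p + 1) ^ suc k)))
  conclude n G p (t , s , X , halts , outputs , optimal , fast) =
    t , s , X , halts , outputs , optimal , λ 1≤n → ≤-trans fast (proj₂ (Times.totalTime-bound k) n (maxTotalProfit p) 1≤n)
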